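{- For all sufficiently large $n$, the largest size of a $2$-dimensional hypercut over $\mathbb{F}_2$ on vertex set $[n]$ is $\binom{n}{3}-\left(\frac34n^2-\frac72n+4\right)$ if $n$ is even and $\binom{n}{3}-\left(\frac34n^2-4n+\frac{25}{4}\right)$ if $n$ is odd.
   Context: Over $\mathbb{F}_2$, consider the boundary matrix $\partial_2$ whose columns are indexed by the triples in $\binom{[n]}{3}$ and rows by pairs in $\binom{[n]}{2}$, the column of $\{a,b,c\}$ being the indicator vector of $\{ab,bc,ac\}$. A set of triples is acyclic if its columns are linearly independent over $\mathbb{F}_2$; a $2$-hypertree is a maximal acyclic set of triples. A $2$-dimensional hypercut is an inclusion-minimal set of triples meeting every $2$-hypertree (equivalently, an inclusion-minimal nonempty set of triples of the form $\{\sigma:\ |\partial\sigma\cap A|\text{ odd}\}$ for some set $A$ of pairs). Its size is the number of triples in it. -}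

module Defs where

open import Data.Nat using (ℕ; zero; suc; _+_; _*_; _%_)
open import Data.Fin using (Fin; _<_; _<?_; _≟_)
open import Data.Bool using (Bool; true; false; _∧_; _∨_; if_then_else_)
open import Data.List using (List; []; _∷_; concatMap; allFin; foldr)
open import Data.Product using (Σ; _×_; ∃; _,_)
open import Relation.Nullary using (¬_; yes; no)
open import Relation.Nullary.Decidable using (⌊_⌋)
open import Relation.Binary.PropositionalEquality using (_≡_)

record Triple (n : ℕ) : Set where
  constructor triple
  field
    a b c : Fin n
    a<b : a < b
    b<c : b < c

open Triple public

mkTriple : ∀ {n} → Fin n → Fin n → Fin n → List (Triple n)
mkTriple x y z with x <? y | y <? z
... | yes p | yes q = triple x y z p q ∷ []
... | _ | _ = []

allTriples : (n : ℕ) → List (Triple n)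
allTriples n =
  concatMap (λ x → concatMap (λ y → concatMap (λ z → mkTriple x y z) (allFin n)) (allFin n)) (allFin n)

TSet : ℕ → Set
TSet n = Triple n → Bool

count : ∀ {n} → (Triple n → Bool) → ℕ
count {n} P = foldr (λ σ k → if P σ then suc k else k) 0 (allTriples n)

size : ∀ {n} → TSet n → ℕ
size S = count S

_∈ᵗ_ : ∀ {n} → Fin n → Triple n → Bool
x ∈ᵗ σ = ⌊ x ≟ a σ ⌋ ∨ ⌊ x ≟ b σ ⌋ ∨ ⌊ x ≟ c σ ⌋

_⊆_ : ∀ {n} → TSet n → TSet n → Set
S ⊆ T = ∀ σ → S σ ≡ true → T σ ≡ true

-- Sum over 𝔽₂ of the columns of ∂₂ indexed by T is zero:
-- every pair {x,y} (x < y) lies in the boundary of an even number of triples of T.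
BoundaryZero : ∀ {n} → TSet n → Set
BoundaryZero {n} T =
  ∀ (x y : Fin n) → x < y → count (λ σ → T σ ∧ (x ∈ᵗ σ) ∧ (y ∈ᵗ σ)) % 2 ≡ 0

Empty : ∀ {n} → TSet n → Set
Empty S = ∀ σ → S σ ≡ false

-- Columns of S linearly independent over 𝔽₂: the only subset with zero sum is empty.
Acyclic : ∀ {n} → TSet n → Set
Acyclic S = ∀ T → T ⊆ S → BoundaryZero T → Empty T

insert : ∀ {n} → Triple n → TSet n → TSet n
insert σ S τ = (⌊ a σ ≟ a τ ⌋ ∧ ⌊ b σ ≟ b τ ⌋ ∧ ⌊ c σ ≟ c τ ⌋) ∨ S τ

Hypertree : ∀ {n} → TSet n → Set
Hypertree S = Acyclic S × (∀ σ → S σ ≡ false → ¬ Acyclic (insert σ S))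

Meets : ∀ {n} → TSet n → TSet n → Set
Meets C H = ∃ λ σ → C σ ≡ true × H σ ≡ true

MeetsAllHypertrees : ∀ {n} → TSet n → Set
MeetsAllHypertrees {n} C = ∀ (H : TSet n) → Hypertree H → Meets C H

_⊂_ : ∀ {n} → TSet n → TSet n → Set
C' ⊂ C = C' ⊆ C × ∃ λ σ → C σ ≡ true × C' σ ≡ false

Hypercut : ∀ {n} → TSet n → Set
Hypercut C = MeetsAllHypertrees C × (∀ C' → C' ⊂ C → ¬ MeetsAllHypertrees C')

IsMaxHypercutSize : ℕ → ℕ → Set
IsMaxHypercutSize n h =
  (∃ λ (C : TSet n) → Hypercut C × size C ≡ h) × (∀ (C : TSet n) → Hypercut C → size C Data.Nat.≤ h)

{-# OPTIONS --safe #-}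
-- A hypercut is an inclusion-minimal nonempty coboundary δg over 𝔽₂, so its complement is δh for the
-- complementary graph h, and |δh| is to be minimised. Switching h at vertex sets does not change δh.
-- With E = Σ deg, counting ordered triples gives 6 |δh| + 6 Σ deg² = 3 n E + 4 tr, tr the number of
-- ordered triangles. Minimality forbids nonempty parts P, Q, R of the vertex set all of whose transversal
-- triples are even: the transversal triples would be a coboundary inside the hypercut, hence all of it.
-- Thus h has no nonadjacent twins and at most two components, so at least n − 2 edges.
--
-- If |δh| is O(n²), some vertex link has O(n) edges; switch it until all degrees are at most
-- M = ⌊(n − 1) / 2⌋. As there are no twins, all but 2^k vertices have a neighbour outside a given set of
-- k vertices, which bounds the degree sum of the vertices of linear degree. Hence |δh| is too large
-- unless h has n − 2 + o(n) edges, one vertex c of degree close to M and all other degrees small. In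
-- that range the exact bound follows because at most one leaf hangs on each vertex and at most one
-- vertex is isolated, so nearly every vertex has exactly one neighbour other than c. Equality holds for
-- an isolated vertex together with a spider whose legs have length 2 (one of them shortened for odd n).

module Submission where

open import Defs
open import Data.Nat as ℕ using (ℕ; zero; suc; _+_; _*_; _∸_; _≤_; z≤n; s≤s; _%_; _^_; _/_; _≡ᵇ_)
open import Data.Nat.Properties hiding (_≟_; _<?_)
open import Data.Nat.DivMod using (m%n<n; m≡m%n+[m/n]*n; /-monoˡ-≤; m*n/n≡m)
open import Data.Fin as Fin using (Fin; zero; suc; _≟_; _<?_; toℕ; fromℕ<)
import Data.Fin.Properties as Finₚ
open import Data.Bool using (Bool; true; false; not; _∧_; _∨_; _xor_; if_then_else_)
open import Data.Bool.Properties as Boolₚ using (xor-∧-commutativeRing; ∧-distribʳ-xor; ∧-zeroʳ; xor-assoc; xor-comm; xor-same)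
open import Data.List as List using (List; []; _∷_; _++_; concatMap; allFin; tabulate; foldr; filter; length)
open import Data.Product using (Σ; _×_; ∃; _,_; proj₁; proj₂; map₂)
open import Data.Sum using (_⊎_; inj₁; inj₂)
open import Data.Empty using (⊥; ⊥-elim)
open import Function using (_∘_; id; case_of_)
open import Relation.Nullary using (¬_; yes; no; Dec)
open import Relation.Nullary.Decidable using (⌊_⌋)
open import Relation.Binary.PropositionalEquality
import Algebra.Properties.Semiring.Sum +-*-semiring as Sum
open Sum using (sum; sum-cong-≗; ∑-distrib-+; *-distribˡ-sum)
open import Data.List.Membership.Propositional using (_∈_; lose)
open import Data.List.Membership.Propositional.Properties using (∈-concatMap⁺; ∈-allFin; ∈-filter⁺; ∈-filter⁻)
open import Data.List.Relation.Unary.Any using (here; there)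
open import Algebra.Bundles using (CommutativeRing; CommutativeMonoid)
open import Algebra.Properties.CommutativeSemigroup (CommutativeMonoid.commutativeSemigroup (CommutativeRing.+-commutativeMonoid xor-∧-commutativeRing)) using () renaming (interchange to xor-interchange)
open import Data.Nat.Combinatorics using (_C_; nCk+nC[k+1]≡[n+1]C[k+1]; nC1≡n)
open import Data.Nat.Tactic.RingSolver using (solve-∀)
open import Relation.Binary using (tri<; tri≈; tri>)
open import Data.Bool.Solver using (module xor-∧-Solver)
open import Data.List.Properties using (length-++)

-- Solved for |δh|, the counting identity reads n e - Σ deg² + 4T, with e edges and T triangles. As
-- e is at least n - 2, only the squares push this below n², and switching caps every degree at
-- about n/2: a single vertex of that degree gives n² - n²/4, the leading term of the answer. The
-- danger is several vertices of linear degree. The twin bound makes their degrees together at most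
-- about n/2 plus the number of edges beyond n - 2, so a second one costs either maximum degree or
-- extra edges, at a price quadratic in n. The link is taken before switching because averaging
-- makes it sparse, and switching at vertices of large degree only lowers the number of edges, so
-- sparsity and the degree bound hold together. Fractions and subtraction are avoided: triples are
-- counted in all six orders, and inequalities are linear combinations of hypotheses checked by ring
-- identities. The constants 200, 12 and 7200 are chosen just generously enough for these
-- combinations.

𝟙 : Bool → ℕ
𝟙 true  = 1
𝟙 false = 0

infix 6 _==_ _<<_
_==_ _<<_ : ∀ {n} → Fin n → Fin n → Bool
x == y = ⌊ x ≟ y ⌋
x << y = ⌊ x <? y ⌋

==-refl : ∀ {n} (x : Fin n) → (x == x) ≡ true
==-refl x with x ≟ x
... | yes _ = refl
... | no ¬p = ⊥-elim (¬p refl)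

==⇒≡ : ∀ {n} {x y : Fin n} → (x == y) ≡ true → x ≡ y
==⇒≡ {x = x} {y} e with x ≟ y
... | yes p = p

≢⇒== : ∀ {n} {x y : Fin n} → x ≢ y → (x == y) ≡ false
≢⇒== {x = x} {y} x≢y with x ≟ y
... | yes p = ⊥-elim (x≢y p)
... | no _ = refl

-- Finite sums and counts of triples

opaque
  -- Opaque so that type checking does not unfold sums; `∑-zero` and `∑-suc` take the place of the
  -- computation rules.
  ∑ : ∀ {n} → (Fin n → ℕ) → ℕ
  ∑ = sum

  ∑-zero : (f : Fin 0 → ℕ) → ∑ f ≡ 0
  ∑-zero f = refl

  ∑-suc : ∀ {n} (f : Fin (suc n) → ℕ) → ∑ f ≡ f zero + ∑ (f ∘ suc)
  ∑-suc f = refl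

  ∑-cong : ∀ {n} {f g : Fin n → ℕ} → (∀ i → f i ≡ g i) → ∑ f ≡ ∑ g
  ∑-cong = sum-cong-≗

  ∑-+ : ∀ {n} {f g : Fin n → ℕ} → ∑ (λ i → f i + g i) ≡ ∑ f + ∑ g
  ∑-+ {f = f} {g} = ∑-distrib-+ f g

  ∑-comm : ∀ {m n} (f : Fin m → Fin n → ℕ) → ∑ (λ i → ∑ (f i)) ≡ ∑ (λ j → ∑ (λ i → f i j))
  ∑-comm = Sum.∑-comm

  ∑-* : ∀ {n} k {f : Fin n → ℕ} → ∑ (λ i → k * f i) ≡ k * ∑ f
  ∑-* k {f} = sym (*-distribˡ-sum k f)

  ∑-mono : ∀ {n} {f g : Fin n → ℕ} → (∀ i → f i ≤ g i) → ∑ f ≤ ∑ g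
  ∑-mono {zero}  _ = z≤n
  ∑-mono {suc n} p = +-mono-≤ (p zero) (∑-mono (p ∘ suc))

  ∑-const : ∀ n k → ∑ {n} (λ _ → k) ≡ n * k
  ∑-const zero    k = refl
  ∑-const (suc n) k = cong (k +_) (∑-const n k)

∑-0 : ∀ {n} {f : Fin n → ℕ} → (∀ i → f i ≡ 0) → ∑ f ≡ 0
∑-0 {n} p = trans (∑-cong p) (trans (∑-const n 0) (*-zeroʳ n))

∑-δ : ∀ {n} (x : Fin n) (f : Fin n → ℕ) → ∑ (λ y → 𝟙 (x == y) * f y) ≡ f x
∑-δ zero f = trans (∑-suc _) (trans (cong (f zero + 0 +_) (∑-0 (λ _ → refl))) (trans (+-identityʳ _) (+-identityʳ _)))
∑-δ (suc x) f = trans (∑-suc _) (trans (∑-cong (λ y → cong (λ b → 𝟙 b * f (suc y)) (lem y))) (∑-δ x (f ∘ suc)))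
  where
  lem : ∀ y → (suc x == suc y) ≡ (x == y)
  lem y with x ≟ y
  ... | yes _ = refl
  ... | no _ = refl

private
  tally : ∀ {A : Set} → (A → Bool) → List A → ℕ
  tally P = foldr (λ σ k → if P σ then suc k else k) 0

  tally-++ : ∀ {A : Set} (P : A → Bool) xs ys → tally P (xs ++ ys) ≡ tally P xs + tally P ys
  tally-++ P []       ys = refl
  tally-++ P (x ∷ xs) ys with P x
  ... | true  = cong suc (tally-++ P xs ys)
  ... | false = tally-++ P xs ys

  tally-concatMap : ∀ {A B : Set} {n} (P : B → Bool) (f : A → List B) (e : Fin n → A) →
    tally P (concatMap f (tabulate e)) ≡ ∑ (λ i → tally P (f (e i)))
  tally-concatMap {n = zero}  P f e = sym (∑-zero _)
  tally-concatMap {n = suc n} P f e =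
    trans (tally-++ P (f (e zero)) _)
      (trans (cong (tally P (f (e zero)) +_) (tally-concatMap P f (e ∘ suc))) (sym (∑-suc _)))

-- `mkTriple` yields its triple exactly when x < y < z, so sortedness becomes two indicator factors,
-- and counting becomes algebra of sums.
count-sum : ∀ {n} (p : Fin n → Fin n → Fin n → Bool) →
  count (λ σ → p (a σ) (b σ) (c σ)) ≡
  ∑ λ x → ∑ λ y → ∑ λ z → 𝟙 (x << y) * (𝟙 (y << z) * 𝟙 (p x y z))
count-sum {n} p =
  trans (tally-concatMap P (λ x → concatMap (λ y → concatMap (λ z → mkTriple x y z) (allFin n)) (allFin n)) id) (∑-cong λ x →
  trans (tally-concatMap P (λ y → concatMap (λ z → mkTriple x y z) (allFin n)) id) (∑-cong λ y →
  trans (tally-concatMap P (mkTriple x y) id) (∑-cong λ z → single x y z)))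
  where
  P : Triple n → Bool
  P σ = p (a σ) (b σ) (c σ)
  single : ∀ x y z → tally P (mkTriple x y z) ≡ 𝟙 (x << y) * (𝟙 (y << z) * 𝟙 (p x y z))
  single x y z with x <? y | y <? z
  ... | yes q | no  _ = refl
  ... | no  _ | yes _ = refl
  ... | no  _ | no  _ = refl
  ... | yes q | yes r with p x y z
  ... | true = refl
  ... | false = refl

-- Linear algebra over 𝔽₂: hypercuts as minimal coboundaries

odd : ℕ → Bool
odd zero    = false
odd (suc k) = not (odd k)

odd⇒%2 : ∀ k → odd k ≡ false → k % 2 ≡ 0
odd⇒%2 zero e = refl
odd⇒%2 (suc (suc k)) e = odd⇒%2 k (trans (sym (Boolₚ.not-involutive _)) e)

%2⇒odd : ∀ k → k % 2 ≡ 0 → odd k ≡ false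
%2⇒odd zero e = refl
%2⇒odd (suc (suc k)) e = trans (Boolₚ.not-involutive _) (%2⇒odd k e)

opaque
  ⨁ : ∀ {A : Set} → List A → (A → Bool) → Bool
  ⨁ xs f = foldr (λ x b → f x xor b) false xs

  ⨁-cong : ∀ {A : Set} (xs : List A) {f g : A → Bool} → (∀ x → f x ≡ g x) → ⨁ xs f ≡ ⨁ xs g
  ⨁-cong []       e = refl
  ⨁-cong (x ∷ xs) e = cong₂ _xor_ (e x) (⨁-cong xs e)

  ⨁-false : ∀ {A : Set} (xs : List A) {f : A → Bool} → (∀ x → f x ≡ false) → ⨁ xs f ≡ false
  ⨁-false []       e = refl
  ⨁-false (x ∷ xs) e rewrite e x = ⨁-false xs e

  ⨁-xor : ∀ {A : Set} (xs : List A) (f g : A → Bool) → ⨁ xs (λ x → f x xor g x) ≡ ⨁ xs f xor ⨁ xs g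
  ⨁-xor []       f g = refl
  ⨁-xor (x ∷ xs) f g = trans (cong ((f x xor g x) xor_) (⨁-xor xs f g)) (xor-interchange (f x) (g x) _ _)

  ⨁-∧ : ∀ {A : Set} (xs : List A) t (f : A → Bool) → ⨁ xs (λ x → t ∧ f x) ≡ t ∧ ⨁ xs f
  ⨁-∧ xs false f = ⨁-false xs (λ _ → refl)
  ⨁-∧ xs true  f = refl

  ⨁-comm : ∀ {A B : Set} (xs : List A) (ys : List B) (f : A → B → Bool) →
    ⨁ xs (λ x → ⨁ ys (f x)) ≡ ⨁ ys (λ y → ⨁ xs (λ x → f x y))
  ⨁-comm []       ys f = sym (⨁-false ys (λ _ → refl))
  ⨁-comm (x ∷ xs) ys f = trans (cong (⨁ ys (f x) xor_) (⨁-comm xs ys f)) (sym (⨁-xor ys (f x) _))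

  ⨁-++ : ∀ {A : Set} (xs ys : List A) f → ⨁ (xs ++ ys) f ≡ ⨁ xs f xor ⨁ ys f
  ⨁-++ []       ys f = refl
  ⨁-++ (x ∷ xs) ys f = trans (cong (f x xor_) (⨁-++ xs ys f)) (sym (xor-assoc (f x) _ _))

  ⨁-[] : ∀ {A : Set} (f : A → Bool) → ⨁ [] f ≡ false
  ⨁-[] f = refl

  ⨁-∷ : ∀ {A : Set} x xs (f : A → Bool) → ⨁ (x ∷ xs) f ≡ f x xor ⨁ xs f
  ⨁-∷ x xs f = refl


module _ {n : ℕ} where

  ⨁ᵗ : (Triple n → Bool) → Bool
  ⨁ᵗ = ⨁ (allTriples n)

  odd-count : (P : Triple n → Bool) → odd (count P) ≡ ⨁ᵗ P
  odd-count P = go (allTriples n)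
    where
    go : ∀ xs → odd (foldr (λ σ k → if P σ then suc k else k) 0 xs) ≡ ⨁ xs P
    go [] = sym (⨁-[] P)
    go (x ∷ xs) with P x | ⨁-∷ x xs P
    ... | true  | e = trans (cong not (go xs)) (sym e)
    ... | false | e = trans (go xs) (sym e)

  Pair : Set
  Pair = Σ (Fin n) λ x → Σ (Fin n) λ y → x Fin.< y

  inc : Triple n → Pair → Bool
  inc σ (x , y , _) = (x ∈ᵗ σ) ∧ (y ∈ᵗ σ)

  ∂ : TSet n → Pair → Bool
  ∂ T j = ⨁ᵗ (λ σ → T σ ∧ inc σ j)

  ∂-zero : ∀ T → BoundaryZero T → ∀ j → ∂ T j ≡ false
  ∂-zero T z j@(x , y , x<y) = trans (sym (odd-count (λ σ → T σ ∧ inc σ j))) (%2⇒odd (count (λ σ → T σ ∧ inc σ j)) (z x y x<y))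

  zero-∂ : ∀ T → (∀ j → ∂ T j ≡ false) → BoundaryZero T
  zero-∂ T z x y x<y = odd⇒%2 (count (λ σ → T σ ∧ inc σ (x , y , x<y))) (trans (odd-count (λ σ → T σ ∧ inc σ (x , y , x<y))) (z (x , y , x<y)))

  eqt : Triple n → Triple n → Bool
  eqt σ τ = (a σ == a τ) ∧ (b σ == b τ) ∧ (c σ == c τ)

  triple-≡ : ∀ {σ τ : Triple n} → a σ ≡ a τ → b σ ≡ b τ → c σ ≡ c τ → σ ≡ τ
  triple-≡ {triple x y z p q} {triple _ _ _ p' q'} refl refl refl =
    cong₂ (triple x y z) (Finₚ.<-irrelevant p p') (Finₚ.<-irrelevant q q')

  eqt⇒≡ : ∀ {σ τ} → eqt σ τ ≡ true → σ ≡ τ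
  eqt⇒≡ {σ} {τ} e with a σ ≟ a τ | b σ ≟ b τ | c σ ≟ c τ
  ... | yes p | yes q | yes r = triple-≡ p q r

  eqt-refl : ∀ σ → eqt σ σ ≡ true
  eqt-refl σ rewrite ==-refl (a σ) | ==-refl (b σ) | ==-refl (c σ) = refl

  -- This is where `allTriples` is seen to list each triple exactly once: the indicator is a product
  -- of three Kronecker deltas, summed one coordinate at a time.
  count-eqt : ∀ σ → count (eqt σ) ≡ 1
  count-eqt σ = trans (count-sum (λ x y z → (a σ == x) ∧ (b σ == y) ∧ (c σ == z)))
    (trans (∑-cong λ x → trans (∑-cong λ y → trans (∑-cong λ z → lem x y z) (∑-δ (c σ) _))
      (trans (∑-cong λ y → refl) (∑-δ (b σ) _))) (trans (∑-δ (a σ) _) fin))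
    where
    lem : ∀ x y z → 𝟙 (x << y) * (𝟙 (y << z) * 𝟙 ((a σ == x) ∧ (b σ == y) ∧ (c σ == z))) ≡
          𝟙 (c σ == z) * (𝟙 (b σ == y) * (𝟙 (a σ == x) * (𝟙 (x << y) * 𝟙 (y << z))))
    lem x y z with x << y | y << z | a σ == x | b σ == y | c σ == z
    ... | s | t | false | false | false = trans (cong (𝟙 s *_) (*-zeroʳ (𝟙 t))) (*-zeroʳ (𝟙 s))
    ... | s | t | false | false | true = trans (cong (𝟙 s *_) (*-zeroʳ (𝟙 t))) (*-zeroʳ (𝟙 s))
    ... | s | t | false | true | false = trans (cong (𝟙 s *_) (*-zeroʳ (𝟙 t))) (*-zeroʳ (𝟙 s))
    ... | s | t | false | true | true = trans (cong (𝟙 s *_) (*-zeroʳ (𝟙 t))) (*-zeroʳ (𝟙 s))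
    ... | s | t | true | false | false = trans (cong (𝟙 s *_) (*-zeroʳ (𝟙 t))) (*-zeroʳ (𝟙 s))
    ... | s | t | true | false | true = trans (cong (𝟙 s *_) (*-zeroʳ (𝟙 t))) (*-zeroʳ (𝟙 s))
    ... | s | t | true | true | false = trans (cong (𝟙 s *_) (*-zeroʳ (𝟙 t))) (*-zeroʳ (𝟙 s))
    ... | true | true | true | true | true = refl
    ... | true | false | true | true | true = refl
    ... | false | true | true | true | true = refl
    ... | false | false | true | true | true = refl
    fin : 𝟙 (a σ << b σ) * 𝟙 (b σ << c σ) ≡ 1
    fin with a σ <? b σ | b σ <? c σ
    ... | yes _ | yes _ = refl
    ... | yes _ | no p = ⊥-elim (p (b<c σ))
    ... | no p | _ = ⊥-elim (p (a<b σ))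

  ⨁-eqt : ∀ σ (f : Triple n → Bool) → ⨁ᵗ (λ τ → eqt σ τ ∧ f τ) ≡ f σ
  ⨁-eqt σ f = trans (⨁-cong (allTriples n) lem) (trans (⨁-∧ (allTriples n) (f σ) (eqt σ))
    (trans (cong (f σ ∧_) (trans (sym (odd-count (eqt σ))) (cong odd (count-eqt σ)))) (Boolₚ.∧-identityʳ _)))
    where
    lem : ∀ τ → eqt σ τ ∧ f τ ≡ f σ ∧ eqt σ τ
    lem τ with eqt σ τ in e
    ... | true  = trans (cong f (sym (eqt⇒≡ e))) (sym (Boolₚ.∧-identityʳ _))
    ... | false = sym (∧-zeroʳ _)

  ∈-allTriples : ∀ σ → σ ∈ allTriples n
  ∈-allTriples σ = ∈-concatMap⁺ _ (lose (∈-allFin (a σ)) (∈-concatMap⁺ _ (lose (∈-allFin (b σ))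
    (∈-concatMap⁺ _ (lose (∈-allFin (c σ)) mem)))))
    where
    mem : σ ∈ mkTriple (a σ) (b σ) (c σ)
    mem with a σ <? b σ | b σ <? c σ
    ... | yes p | yes q = here (triple-≡ refl refl refl)
    ... | yes _ | no p = ⊥-elim (p (b<c σ))
    ... | no p | _ = ⊥-elim (p (a<b σ))

  toggle : Triple n → TSet n → TSet n
  toggle v T τ = eqt v τ xor T τ

  ∂-toggle : ∀ v T j → ∂ (toggle v T) j ≡ inc v j xor ∂ T j
  ∂-toggle v T j = trans (⨁-cong (allTriples n) (λ σ → ∧-distribʳ-xor (inc σ j) (eqt v σ) (T σ)))
    (trans (⨁-xor (allTriples n) (λ σ → eqt v σ ∧ inc σ j) _) (cong (_xor ∂ T j) (⨁-eqt v (λ σ → inc σ j))))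

  -- Adjointness of boundary and coboundary: `⨁ A (inc σ)` is the parity of |∂σ ∩ A|, and the two
  -- sums are exchanged.
  pairing : ∀ (A : List Pair) T → ⨁ A (∂ T) ≡ ⨁ᵗ (λ σ → T σ ∧ ⨁ A (inc σ))
  pairing A T = trans (⨁-comm A (allTriples n) (λ j σ → T σ ∧ inc σ j))
    (⨁-cong (allTriples n) (λ σ → ⨁-∧ A (T σ) (inc σ)))

  InSpan : TSet n → (Pair → Bool) → Set
  InSpan F w = ∃ λ T → T ⊆ F × (∀ j → ∂ T j ≡ w j)

  Perp : List (Triple n) → List Pair → Set
  Perp L A = ∀ τ → τ ∈ L → ⨁ A (inc τ) ≡ false

  search : (w : Pair → Bool) → (∃ λ j → w j ≡ true) ⊎ (∀ j → w j ≡ false)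
  search w with Finₚ.any? (λ x → Finₚ.any? (λ y → dec x y))
    where
    dec : ∀ x y → Dec (∃ λ (p : x Fin.< y) → w (x , y , p) ≡ true)
    dec x y with x <? y
    ... | no ¬p = no (¬p ∘ proj₁)
    ... | yes p with w (x , y , p) in e
    ... | true = yes (p , e)
    ... | false = no λ (p' , e') → case trans (sym e) (trans (cong (λ r → w (x , y , r)) (Finₚ.<-irrelevant p p')) e') of λ ()
  ... | yes (x , y , p , e) = inj₁ ((x , y , p) , e)
  ... | no ¬e = inj₂ λ (x , y , p) → Boolₚ.¬-not (λ e → ¬e (x , y , p , e))

  ∧-true : ∀ {s t} → s ∧ t ≡ true → s ≡ true × t ≡ true
  ∧-true {true} {true} _ = refl , refl

  ⨁-Perp : ∀ {L A F T} → (∀ τ → F τ ≡ true → τ ∈ L) → Perp L A → T ⊆ F → ⨁ A (∂ T) ≡ false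
  ⨁-Perp {L} {A} {F} {T} F⊆L A⊥L T⊆F = trans (pairing A T) (⨁-false (allTriples n) lem)
    where
    lem : ∀ σ → T σ ∧ ⨁ A (inc σ) ≡ false
    lem σ with T σ in e
    ... | true  = A⊥L σ (F⊆L σ (T⊆F σ e))
    ... | false = refl

  insert-there : ∀ v (F : TSet n) {τ} → F τ ≡ true → insert v F τ ≡ true
  insert-there v F {τ} e = trans (cong (eqt v τ ∨_) e) (Boolₚ.∨-zeroʳ _)

  insert-inv : ∀ v (F : TSet n) {τ} → insert v F τ ≡ true → v ≡ τ ⊎ F τ ≡ true
  insert-inv v F {τ} e with eqt v τ in q
  ... | true  = inj₁ (eqt⇒≡ q)
  ... | false = inj₂ e

  toggle-⊆ : ∀ v {F T : TSet n} → T ⊆ F → toggle v T ⊆ insert v F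
  toggle-⊆ v {F} {T} T⊆F τ e with eqt v τ
  ... | true = refl
  ... | false = T⊆F τ e

  acyclic-insert : ∀ {F v} → Acyclic F → ¬ InSpan F (inc v) → Acyclic (insert v F)
  acyclic-insert {F} {v} acy ¬span T T⊆ bz with T v in e
  ... | true = ⊥-elim (¬span (toggle v T , sub , λ j → trans (∂-toggle v T j) (trans (cong (inc v j xor_) (∂-zero T bz j)) (Boolₚ.xor-identityʳ _))))
    where
    sub : toggle v T ⊆ F
    sub τ q with eqt v τ in e'
    ... | true = case trans (sym q) (cong not (trans (cong T (sym (eqt⇒≡ e'))) e)) of λ ()
    ... | false with insert-inv v F (T⊆ τ q)
    ... | inj₁ refl = case trans (sym e') (eqt-refl v) of λ ()
    ... | inj₂ r = r
  ... | false = acy T sub bz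
    where
    sub : T ⊆ F
    sub τ q with insert-inv v F (T⊆ τ q)
    ... | inj₁ refl = case trans (sym q) e of λ ()
    ... | inj₂ r = r

  -- Gaussian elimination in the form of an alternative: a vector `w` is either a sum of columns of
  -- the independent set `F` or detected by a list of pairs `A` orthogonal to all of `L`. The
  -- detecting lists are what later become coboundaries.
  basis : ∀ (L : List (Triple n)) → ∃ λ F → (∀ τ → F τ ≡ true → τ ∈ L) × Acyclic F ×
    (∀ w → InSpan F w ⊎ ∃ λ A → Perp L A × ⨁ A w ≡ true)
  basis [] = (λ _ → false) , (λ _ ()) , (λ T T⊆ _ σ → Boolₚ.¬-not (λ e → case T⊆ σ e of λ ())) , oracle
    where
    oracle : ∀ w → InSpan (λ _ → false) w ⊎ ∃ λ A → Perp [] A × ⨁ A w ≡ true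
    oracle w with search w
    ... | inj₁ (j , e) = inj₂ (j ∷ [] , (λ _ ()) , trans (trans (⨁-∷ j [] w) (trans (cong (w j xor_) (⨁-[] w)) (Boolₚ.xor-identityʳ _))) e)
    ... | inj₂ z = inj₁ ((λ _ → false) , (λ _ ()) , λ j → trans (⨁-false (allTriples n) (λ _ → refl)) (sym (z j)))
  basis (v ∷ L) with basis L
  ... | F , F⊆L , acy , oracle with oracle (inc v)
  ... | inj₁ (Tv , Tv⊆F , ∂Tv) = F , (λ τ → there ∘ F⊆L τ) , acy , oracle'
    where
    oracle' : ∀ w → InSpan F w ⊎ ∃ λ A → Perp (v ∷ L) A × ⨁ A w ≡ true
    oracle' w with oracle w
    ... | inj₁ s = inj₁ s
    ... | inj₂ (A , A⊥L , Aw) = inj₂ (A , perp , Aw)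
      where
      perp : Perp (v ∷ L) A
      perp τ (here refl) = trans (⨁-cong A (λ j → sym (∂Tv j))) (⨁-Perp F⊆L A⊥L Tv⊆F)
      perp τ (there m) = A⊥L τ m
  ... | inj₂ (A₀ , A₀⊥L , A₀v) = insert v F , sub , acyclic-insert {F} {v} acy ¬span , oracle'
    where
    sub : ∀ τ → insert v F τ ≡ true → τ ∈ v ∷ L
    sub τ e with insert-inv v F e
    ... | inj₁ refl = here refl
    ... | inj₂ r = there (F⊆L τ r)
    ¬span : ¬ InSpan F (inc v)
    ¬span (T , T⊆F , ∂T) = case trans (sym A₀v) (trans (⨁-cong A₀ (λ j → sym (∂T j))) (⨁-Perp F⊆L A₀⊥L T⊆F)) of λ ()
    extend : ∀ {A} → Perp L A → ⨁ A (inc v) ≡ false → Perp (v ∷ L) A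
    extend A⊥L e τ (here refl) = e
    extend A⊥L e τ (there m) = A⊥L τ m
    oracle' : ∀ w → InSpan (insert v F) w ⊎ ∃ λ A → Perp (v ∷ L) A × ⨁ A w ≡ true
    oracle' w with oracle w
    ... | inj₁ (T , T⊆F , ∂T) = inj₁ (T , (λ τ → insert-there v F ∘ T⊆F τ) , ∂T)
    ... | inj₂ (A , A⊥L , Aw) with ⨁ A (inc v) in Av
    ... | false = inj₂ (A , extend A⊥L Av , Aw)
    -- `A` detects both `w` and `v`, so `w + v` is tried. If some `B` detects that sum and also `v`,
    -- then `B` misses `w`, and the sum `A ++ B` kills `v` while still detecting `w`.
    ... | true with oracle (λ j → inc v j xor w j)
    ... | inj₁ (T , T⊆F , ∂T) = inj₁ (toggle v T , toggle-⊆ v {F} {T} T⊆F , λ j → trans (∂-toggle v T j) (trans (cong (inc v j xor_) (∂T j)) (cancel (inc v j) (w j))))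
      where
      cancel : ∀ s t → s xor (s xor t) ≡ t
      cancel s t = trans (sym (xor-assoc s s t)) (cong (_xor t) (xor-same s))
    ... | inj₂ (B , B⊥L , Bvw) with ⨁ B (inc v) in Bv | trans (sym (⨁-xor B (inc v) w)) Bvw
    ... | false | e = inj₂ (B , extend B⊥L Bv , e)
    ... | true  | e = inj₂ (A ++ B , extend (λ τ m → trans (⨁-++ A B (inc τ)) (cong₂ _xor_ (A⊥L τ m) (B⊥L τ m)))
        (trans (⨁-++ A B (inc v)) (cong₂ _xor_ Av Bv)) , trans (⨁-++ A B w) (trans (cong (_xor ⨁ B w) Aw) e))

  find : (P : Triple n → Bool) → (∃ λ σ → P σ ≡ true) ⊎ (∀ σ → P σ ≡ false)
  find P with go (allTriples n)
    where
    go : ∀ L → (∃ λ σ → P σ ≡ true) ⊎ (∀ σ → σ ∈ L → P σ ≡ false)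
    go [] = inj₂ λ _ ()
    go (σ ∷ L) with P σ in e | go L
    ... | true  | _ = inj₁ (σ , e)
    ... | false | inj₁ r = inj₁ r
    ... | false | inj₂ r = inj₂ λ { τ (here refl) → e ; τ (there m) → r τ m }
  ... | inj₁ r = inj₁ r
  ... | inj₂ r = inj₂ λ σ → r σ (∈-allTriples σ)

  -- Take a basis `F` of the triples outside `X`. If it spanned all columns, it would be a hypertree
  -- missing `X`. So some column escapes, and a list of pairs detecting it gives a nonempty
  -- coboundary that vanishes outside `X`.
  contains-cut : ∀ {X : TSet n} → MeetsAllHypertrees X →
    ∃ λ A → (∀ σ → ⨁ A (inc σ) ≡ true → X σ ≡ true) × ∃ λ σ → ⨁ A (inc σ) ≡ true
  contains-cut {X} meets with basis (filter (λ σ → X σ Boolₚ.≟ false) (allTriples n))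
  ... | F , F⊆L , acy , oracle = conclude (go (allTriples n))
    where
    L = filter (λ σ → X σ Boolₚ.≟ false) (allTriples n)
    Cut = ∃ λ A → (∀ σ → ⨁ A (inc σ) ≡ true → X σ ≡ true) × ∃ λ σ → ⨁ A (inc σ) ≡ true
    in-L : ∀ {σ} → X σ ≡ false → σ ∈ L
    in-L e = ∈-filter⁺ (λ σ → X σ Boolₚ.≟ false) (∈-allTriples _) e
    go : ∀ M → Cut ⊎ (∀ σ → σ ∈ M → InSpan F (inc σ))
    go [] = inj₂ λ _ ()
    go (σ ∷ M) with oracle (inc σ) | go M
    ... | inj₂ (A , A⊥L , e) | _ = inj₁ (A , (λ τ e' → Boolₚ.¬-not (λ z → case trans (sym (A⊥L τ (in-L z))) e' of λ ())) , σ , e)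
    ... | inj₁ _ | inj₁ r = inj₁ r
    ... | inj₁ s | inj₂ r = inj₂ λ { τ (here refl) → s ; τ (there m) → r τ m }
    conclude : Cut ⊎ (∀ σ → σ ∈ allTriples n → InSpan F (inc σ)) → Cut
    conclude (inj₁ r) = r
    conclude (inj₂ span) with meets F (acy , maximal)
      where
      maximal : ∀ σ → F σ ≡ false → ¬ Acyclic (insert σ F)
      maximal σ Fσ acy' with span σ (∈-allTriples σ)
      ... | T , T⊆F , ∂T = case trans (sym (acy' (toggle σ T) (toggle-⊆ σ {F} {T} T⊆F)
          (zero-∂ (toggle σ T) λ j → trans (∂-toggle σ T j) (trans (cong (inc σ j xor_) (∂T j)) (xor-same (inc σ j)))) σ))
          (cong₂ _xor_ (eqt-refl σ) (Boolₚ.¬-not (λ e → case trans (sym (T⊆F σ e)) Fσ of λ ()))) of λ ()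
    ... | σ , Cσ , Fσ = case trans (sym Cσ) (proj₂ (∈-filter⁻ (λ σ → X σ Boolₚ.≟ false) {xs = allTriples n} (F⊆L σ Fσ))) of λ ()

  -- The coboundary over 𝔽₂ of the graph `g`, which is read at increasing pairs only: any Boolean
  -- function of two vertices serves as a set of pairs.
  cob : (Fin n → Fin n → Bool) → TSet n
  cob g σ = g (a σ) (b σ) xor (g (b σ) (c σ) xor g (a σ) (c σ))

  private
    -- At most one of the three products is true, so on increasing pairs this agrees with `inc`;
    -- being additive, it can be summed against `g` term by term.
    side : Triple n → Fin n → Fin n → Bool
    side σ x y = ((x == a σ) ∧ (y == b σ)) xor (((x == b σ) ∧ (y == c σ)) xor ((x == a σ) ∧ (y == c σ)))

    inc-side : ∀ σ x y (x<y : x Fin.< y) → inc σ (x , y , x<y) ≡ side σ x y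
    inc-side (triple p q r p<q q<r) x y x<y with x ≟ p | x ≟ q | x ≟ r | y ≟ p | y ≟ q | y ≟ r
    ... | no _ | no _ | no _ | _ | _ | _ = refl
    ... | yes refl | yes refl | _ | _ | _ | _ = ⊥-elim (Finₚ.<-irrefl refl p<q)
    ... | yes refl | no _ | yes refl | _ | _ | _ = ⊥-elim (Finₚ.<-irrefl refl (Finₚ.<-trans p<q q<r))
    ... | no _ | yes refl | yes refl | _ | _ | _ = ⊥-elim (Finₚ.<-irrefl refl q<r)
    ... | no _ | no _ | yes refl | yes refl | _ | _ = ⊥-elim (Finₚ.<-asym (Finₚ.<-trans p<q q<r) x<y)
    ... | no _ | no _ | yes refl | no _ | yes refl | _ = ⊥-elim (Finₚ.<-asym q<r x<y)
    ... | no _ | no _ | yes refl | no _ | no _ | yes refl = ⊥-elim (Finₚ.<-irrefl refl x<y)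
    ... | no _ | no _ | yes refl | no _ | no _ | no _ = refl
    ... | yes refl | no _ | no _ | yes refl | _ | _ = ⊥-elim (Finₚ.<-irrefl refl x<y)
    ... | yes refl | no _ | no _ | no _ | yes refl | yes refl = ⊥-elim (Finₚ.<-irrefl refl q<r)
    ... | yes refl | no _ | no _ | no _ | yes refl | no _ = refl
    ... | yes refl | no _ | no _ | no _ | no _ | yes refl = refl
    ... | yes refl | no _ | no _ | no _ | no _ | no _ = refl
    ... | no _ | yes refl | no _ | yes refl | _ | _ = ⊥-elim (Finₚ.<-asym p<q x<y)
    ... | no _ | yes refl | no _ | no _ | yes refl | _ = ⊥-elim (Finₚ.<-irrefl refl x<y)
    ... | no _ | yes refl | no _ | no _ | no _ | yes refl = refl
    ... | no _ | yes refl | no _ | no _ | no _ | no _ = refl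

    side-≮ : ∀ σ x y → ¬ (x Fin.< y) → side σ x y ≡ false
    side-≮ (triple p q r p<q q<r) x y x≮y with x ≟ p | x ≟ q | y ≟ q | y ≟ r
    ... | yes refl | _ | yes refl | _ = ⊥-elim (x≮y p<q)
    ... | yes refl | _ | no _ | yes refl = ⊥-elim (x≮y (Finₚ.<-trans p<q q<r))
    ... | _ | yes refl | _ | yes refl = ⊥-elim (x≮y q<r)
    ... | yes _ | yes _ | no _ | no _ = refl
    ... | yes _ | no _ | no _ | no _ = refl
    ... | no _ | yes _ | _ | no _ = refl
    ... | no _ | no _ | _ | _ = refl

    side-∧ : ∀ σ x y t → side σ x y ∧ t ≡
      ((x == a σ) ∧ ((y == b σ) ∧ t)) xor (((x == b σ) ∧ ((y == c σ) ∧ t)) xor ((x == a σ) ∧ ((y == c σ) ∧ t)))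
    side-∧ σ x y t = trans (∧-distribʳ-xor t ((x == a σ) ∧ (y == b σ)) _)
      (cong₂ _xor_ (Boolₚ.∧-assoc (x == a σ) _ t) (trans (∧-distribʳ-xor t ((x == b σ) ∧ (y == c σ)) _)
        (cong₂ _xor_ (Boolₚ.∧-assoc (x == b σ) _ t) (Boolₚ.∧-assoc (x == a σ) _ t))))

  odd-∑ : ∀ {m} (f : Fin m → Bool) → odd (∑ (λ i → 𝟙 (f i))) ≡ ⨁ (allFin m) f
  odd-∑ f = go id
    where
    go : ∀ {k} (e : Fin k → _) → odd (∑ (λ i → 𝟙 (f (e i)))) ≡ ⨁ (tabulate e) f
    go {zero} e = trans (cong odd (∑-zero _)) (sym (⨁-[] f))
    go {suc k} e = trans (cong odd (∑-suc _)) (trans (step (f (e zero))) (trans (cong (f (e zero) xor_) (go (e ∘ suc))) (sym (⨁-∷ _ _ f))))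
      where
      step : ∀ t {m} → odd (𝟙 t + m) ≡ t xor odd m
      step true = refl
      step false = refl

  ⨁-δ : ∀ (u : Fin n) (f : Fin n → Bool) → ⨁ (allFin n) (λ x → (x == u) ∧ f x) ≡ f u
  ⨁-δ u f = trans (⨁-cong (allFin n) lem) (trans (⨁-∧ (allFin n) (f u) (u ==_))
    (trans (cong (f u ∧_) (trans (sym (odd-∑ (u ==_))) (cong odd (trans (∑-cong λ i → sym (*-identityʳ _)) (∑-δ u (λ _ → 1)))))) (Boolₚ.∧-identityʳ _)))
    where
    lem : ∀ x → (x == u) ∧ f x ≡ f u ∧ (u == x)
    lem x with x ≟ u | u ≟ x
    ... | yes refl | yes _ = sym (Boolₚ.∧-identityʳ _)
    ... | yes refl | no p = ⊥-elim (p refl)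
    ... | no p | yes refl = ⊥-elim (p refl)
    ... | no _ | no _ = sym (∧-zeroʳ _)

  cob-expand : ∀ g σ → cob g σ ≡ ⨁ (allFin n) (λ x → ⨁ (allFin n) (λ y → side σ x y ∧ g x y))
  cob-expand g σ = sym (trans (⨁-cong all λ x → trans (⨁-cong all λ y → side-∧ σ x y (g x y))
      (trans (⨁-xor all _ _) (cong₂ _xor_ (⨁-∧ all (x == a σ) _) (trans (⨁-xor all _ _) (cong₂ _xor_ (⨁-∧ all (x == b σ) _) (⨁-∧ all (x == a σ) _))))))
    (trans (⨁-xor all _ _) (cong₂ _xor_ (double (a σ) (b σ)) (trans (⨁-xor all _ _) (cong₂ _xor_ (double (b σ) (c σ)) (double (a σ) (c σ)))))))
    where
    all = allFin n
    double : ∀ u v → ⨁ all (λ x → (x == u) ∧ ⨁ all (λ y → (y == v) ∧ g x y)) ≡ g u v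
    double u v = trans (⨁-δ u _) (⨁-δ v _)

  -- Expanded over all pairs, the sum is a combination, with coefficients `g`, of entries of the
  -- boundary of `T`.
  cycle⊥cob : ∀ g T → BoundaryZero T → ⨁ᵗ (λ σ → T σ ∧ cob g σ) ≡ false
  cycle⊥cob g T bz = trans (⨁-cong (allTriples n) λ σ → trans (cong (T σ ∧_) (cob-expand g σ))
      (trans (sym (⨁-∧ all (T σ) _)) (⨁-cong all λ x → sym (⨁-∧ all (T σ) _))))
    (trans (⨁-comm (allTriples n) all _) (⨁-false all λ x → trans (⨁-comm (allTriples n) all _) (⨁-false all λ y →
      trans (⨁-cong (allTriples n) λ σ → rearr (T σ) (side σ x y) (g x y)) (trans (⨁-∧ (allTriples n) (g x y) _) (trans (cong (g x y ∧_) (lem x y)) (∧-zeroʳ _))))))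
    where
    all = allFin n
    rearr : ∀ s t u → s ∧ (t ∧ u) ≡ u ∧ (s ∧ t)
    rearr s t u = trans (sym (Boolₚ.∧-assoc s t u)) (Boolₚ.∧-comm (s ∧ t) u)
    lem : ∀ x y → ⨁ᵗ (λ σ → T σ ∧ side σ x y) ≡ false
    lem x y with x <? y
    ... | yes p = trans (⨁-cong (allTriples n) λ σ → cong (T σ ∧_) (sym (inc-side σ x y p))) (∂-zero T bz (x , y , p))
    ... | no ¬p = ⨁-false (allTriples n) λ σ → trans (cong (T σ ∧_) (side-≮ σ x y ¬p)) (∧-zeroʳ _)

  graph : List Pair → Fin n → Fin n → Bool
  graph A u v = ⨁ A (λ (x , y , _) → (x == u) ∧ (y == v))

  graph-cob : ∀ A σ → ⨁ A (inc σ) ≡ cob (graph A) σ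
  graph-cob A σ = trans (⨁-cong A λ (x , y , p) → inc-side σ x y p)
    (trans (⨁-xor A _ _) (cong (graph A (a σ) (b σ) xor_) (⨁-xor A _ _)))

  -- Suppose `H` misses the coboundary. A cycle through `σ₀` in `H` plus `σ₀` would meet the
  -- coboundary in `σ₀` alone, against `cycle⊥cob`. So adding `σ₀` keeps `H` acyclic, against
  -- maximality.
  cob-meets : ∀ g → (∃ λ σ → cob g σ ≡ true) → MeetsAllHypertrees (cob g)
  cob-meets g (σ₀ , e₀) H (acy , maximal) with find (λ σ → cob g σ ∧ H σ)
  ... | inj₁ (σ , e) = σ , ∧-true e
  ... | inj₂ disj = ⊥-elim (maximal σ₀ (trans (sym (cong (_∧ H σ₀) e₀)) (disj σ₀)) acy')
    where
    acy' : Acyclic (insert σ₀ H)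
    acy' T T⊆ bz with T σ₀ in e
    ... | false = acy T sub bz
      where
      sub : T ⊆ H
      sub τ q with insert-inv σ₀ H (T⊆ τ q)
      ... | inj₁ refl = case trans (sym q) e of λ ()
      ... | inj₂ r = r
    ... | true = case trans (sym (cycle⊥cob g T bz)) (trans (⨁-cong (allTriples n) lem) (trans (sym (odd-count (eqt σ₀))) (cong odd (count-eqt σ₀)))) of λ ()
      where
      lem : ∀ τ → T τ ∧ cob g τ ≡ eqt σ₀ τ
      lem τ with eqt σ₀ τ in q
      ... | true rewrite sym (eqt⇒≡ {σ₀} {τ} q) = trans (cong (_∧ cob g σ₀) e) e₀
      ... | false with T τ in q'
      ... | false = refl
      ... | true with insert-inv σ₀ H (T⊆ τ q')
      ... | inj₁ refl = case trans (sym q) (eqt-refl σ₀) of λ ()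
      ... | inj₂ r = trans (sym (Boolₚ.∧-identityʳ _)) (trans (cong (cob g τ ∧_) (sym r)) (disj τ))

  hypercut-cob : ∀ {X : TSet n} → Hypercut X → ∃ λ g → ∀ σ → X σ ≡ cob g σ
  hypercut-cob {X} (meets , minimal) with contains-cut meets
  ... | A , sub , σ , e = graph A , eq
    where
    eq : ∀ σ → X σ ≡ cob (graph A) σ
    eq τ with X τ in p | cob (graph A) τ in q
    ... | true  | true  = refl
    ... | false | false = refl
    ... | false | true = trans (sym p) (sub τ (trans (graph-cob A τ) q))
    ... | true | false = ⊥-elim (minimal (cob (graph A)) ((λ ρ r → sub ρ (trans (graph-cob A ρ) r)) , τ , p , q)
                          (cob-meets (graph A) (σ , trans (sym (graph-cob A σ)) e)))

  hypercut-minimal : ∀ {X : TSet n} → Hypercut X → ∀ g → cob g ⊆ X → (∃ λ σ → cob g σ ≡ true) → X ⊆ cob g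
  hypercut-minimal {X} (_ , minimal) g sub ne σ Cσ with cob g σ in e
  ... | true = refl
  ... | false = ⊥-elim (minimal (cob g) (sub , σ , Cσ , e) (cob-meets g ne))

  -- A smaller set meeting all hypertrees would contain a nonempty coboundary by `contains-cut`, so
  -- minimality among coboundaries suffices.
  cob-hypercut : ∀ g → (∃ λ σ → cob g σ ≡ true) →
    (∀ g' → cob g' ⊆ cob g → (∃ λ σ → cob g' σ ≡ true) → cob g ⊆ cob g') → Hypercut (cob g)
  cob-hypercut g ne min = cob-meets g ne , λ { C' (C'⊆ , σ , e , e') meets' → absurd C'⊆ σ e e' (contains-cut meets') }
    where
    absurd : ∀ {C'} → C' ⊆ cob g → ∀ σ → cob g σ ≡ true → C' σ ≡ false →
      (∃ λ A → (∀ σ → ⨁ A (inc σ) ≡ true → C' σ ≡ true) × ∃ λ σ → ⨁ A (inc σ) ≡ true) → ⊥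
    absurd C'⊆ σ e e' (A , sub , τ , q) = case trans (sym e') (sub σ (trans (graph-cob A σ)
      (min (graph A) (λ ρ r → C'⊆ ρ (sub ρ (trans (graph-cob A ρ) r))) (τ , trans (sym (graph-cob A τ)) q) σ e))) of λ ()

-- Counting triples by ordered sums

∑³ : ∀ {n} → (Fin n → Fin n → Fin n → ℕ) → ℕ
∑³ f = ∑ λ x → ∑ λ y → ∑ λ z → f x y z

module _ {n : ℕ} where

  ∑³-cong : {f g : Fin n → Fin n → Fin n → ℕ} → (∀ x y z → f x y z ≡ g x y z) → ∑³ f ≡ ∑³ g
  ∑³-cong e = ∑-cong λ x → ∑-cong λ y → ∑-cong λ z → e x y z

  ∑³-mono : {f g : Fin n → Fin n → Fin n → ℕ} → (∀ x y z → f x y z ≤ g x y z) → ∑³ f ≤ ∑³ g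
  ∑³-mono e = ∑-mono λ x → ∑-mono λ y → ∑-mono λ z → e x y z

  ∑³-+ : {f g : Fin n → Fin n → Fin n → ℕ} → ∑³ (λ x y z → f x y z + g x y z) ≡ ∑³ f + ∑³ g
  ∑³-+ = trans (∑-cong λ x → trans (∑-cong λ y → ∑-+) ∑-+) ∑-+

  ∑³-* : ∀ k {f : Fin n → Fin n → Fin n → ℕ} → ∑³ (λ x y z → k * f x y z) ≡ k * ∑³ f
  ∑³-* k = trans (∑-cong λ x → trans (∑-cong λ y → ∑-* k) (∑-* k)) (∑-* k)

  ∑³-swap₁₂ : (f : Fin n → Fin n → Fin n → ℕ) → ∑³ (λ x y z → f y x z) ≡ ∑³ f
  ∑³-swap₁₂ f = sym (∑-comm λ x y → ∑ (f x y))

  ∑³-swap₂₃ : (f : Fin n → Fin n → Fin n → ℕ) → ∑³ (λ x y z → f x z y) ≡ ∑³ f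
  ∑³-swap₂₃ f = ∑-cong λ x → sym (∑-comm (f x))

  private
    <<-flip : ∀ {x y : Fin n} → x ≢ y → (y << x) ≡ not (x << y)
    <<-flip {x} {y} x≢y with x <? y | y <? x
    ... | yes p | yes q = ⊥-elim (Finₚ.<-asym p q)
    ... | yes _ | no _ = refl
    ... | no _ | yes _ = refl
    ... | no p | no q with Finₚ.<-cmp x y
    ... | tri< r _ _ = ⊥-elim (p r)
    ... | tri≈ _ r _ = ⊥-elim (x≢y r)
    ... | tri> _ _ r = ⊥-elim (q r)

    <<-trans : ∀ {x y z : Fin n} → (x << y) ≡ true → (y << z) ≡ true → (x << z) ≡ true
    <<-trans {x} {y} {z} p q with x <? y | y <? z | x <? z
    ... | yes r | yes s | yes _ = refl
    ... | yes r | yes s | no t = ⊥-elim (t (Finₚ.<-trans r s))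

  module _ (p : Fin n → Fin n → Fin n → Bool)
           (p₁₂ : ∀ x y z → p y x z ≡ p x y z) (p₂₃ : ∀ x y z → p x z y ≡ p x y z) (p-irr : ∀ x z → p x x z ≡ false) where

    private
      s : Fin n → Fin n → Fin n → ℕ
      s x y z = 𝟙 (x << y) * (𝟙 (y << z) * 𝟙 (p x y z))

      -- Three distinct vertices are sorted in exactly one of the six orders; when two coincide,
      -- `p-irr` and symmetry make both sides vanish.
      split : ∀ x y z → 𝟙 (p x y z) ≡ s x y z + s x z y + (s y x z + s y z x) + (s z x y + s z y x)
      split x y z rewrite p₂₃ x y z | p₁₂ x y z | trans (p₂₃ y x z) (p₁₂ x y z)
                        | trans (p₁₂ x z y) (p₂₃ x y z) | trans (p₂₃ z x y) (trans (p₁₂ x z y) (p₂₃ x y z))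
        with p x y z in e
      ... | false = sym (trans (cong₂ _+_ (cong₂ _+_ (cong₂ _+_ (zz (x << y) (y << z)) (zz (x << z) (z << y))) (cong₂ _+_ (zz (y << x) (x << z)) (zz (y << z) (z << x)))) (cong₂ _+_ (zz (z << x) (x << y)) (zz (z << y) (y << x)))) refl)
        where
        zz : ∀ t u → 𝟙 t * (𝟙 u * 0) ≡ 0
        zz t u = trans (cong (𝟙 t *_) (*-zeroʳ (𝟙 u))) (*-zeroʳ (𝟙 t))
      ... | true rewrite <<-flip {x} {y} (λ { refl → case trans (sym e) (p-irr x z) of λ () })
                       | <<-flip {y} {z} (λ { refl → case trans (sym e) (trans (sym (p₁₂ x y y)) (trans (sym (p₂₃ y x y)) (p-irr y x))) of λ () })
                       | <<-flip {x} {z} (λ { refl → case trans (sym e) (trans (sym (p₂₃ x y x)) (p-irr x y)) of λ () })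
        with x << y in xy | y << z in yz | x << z in xz
      ... | true | true | true = refl
      ... | true | true | false = case trans (sym (<<-trans {x} {y} {z} xy yz)) xz of λ ()
      ... | true | false | true = refl
      ... | true | false | false = refl
      ... | false | true | true = refl
      ... | false | true | false = refl
      ... | false | false | false = refl
      ... | false | false | true = case trans (sym (<<-trans {x} {z} {y} xz zy)) xy of λ ()
        where
        zy : (z << y) ≡ true
        zy = trans (<<-flip {y} {z} (λ { refl → case trans (sym e) (trans (sym (p₁₂ x y y)) (trans (sym (p₂₃ y x y)) (p-irr y x))) of λ () })) (cong not yz)

    six-count : 6 * count (λ σ → p (a σ) (b σ) (c σ)) ≡ ∑³ (λ x y z → 𝟙 (p x y z))
    six-count = sym (trans (∑³-cong split) (trans ∑³-+ (trans (cong₂ _+_ (trans ∑³-+ (cong₂ _+_ (trans ∑³-+ (cong₂ _+_ (refl {x = ∑³ s}) e₂)) (trans ∑³-+ (cong₂ _+_ e₃ e₄)))) (trans ∑³-+ (cong₂ _+_ e₅ e₆)))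
      (trans (six (∑³ s)) (cong (6 *_) (sym (count-sum p)))))))
      where
      e₂ : ∑³ (λ x y z → s x z y) ≡ ∑³ s
      e₂ = ∑³-swap₂₃ s
      e₃ : ∑³ (λ x y z → s y x z) ≡ ∑³ s
      e₃ = ∑³-swap₁₂ s
      e₄ : ∑³ (λ x y z → s y z x) ≡ ∑³ s
      e₄ = trans (∑³-swap₁₂ (λ x y z → s x z y)) e₂
      e₅ : ∑³ (λ x y z → s z x y) ≡ ∑³ s
      e₅ = trans (∑³-swap₂₃ (λ x y z → s y x z)) e₃
      e₆ : ∑³ (λ x y z → s z y x) ≡ ∑³ s
      e₆ = trans (∑³-swap₁₂ (λ x y z → s z x y)) e₅
      six : ∀ k → k + k + (k + k) + (k + k) ≡ 6 * k
      six = solve-∀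

  count-not : (P : TSet n) → count P + count (not ∘ P) ≡ count {n} (λ _ → true)
  count-not P = go (allTriples n)
    where
    go : ∀ xs → foldr (λ σ k → if P σ then suc k else k) 0 xs + foldr (λ σ k → if not (P σ) then suc k else k) 0 xs ≡ foldr (λ σ k → suc k) 0 xs
    go [] = refl
    go (σ ∷ xs) with P σ
    ... | true  = cong suc (go xs)
    ... | false = trans (+-suc _ _) (cong suc (go xs))

  count-cong : {P Q : TSet n} → (∀ σ → P σ ≡ Q σ) → count P ≡ count Q
  count-cong {P} {Q} e = go (allTriples n)
    where
    go : ∀ xs → foldr (λ σ k → if P σ then suc k else k) 0 xs ≡ foldr (λ σ k → if Q σ then suc k else k) 0 xs
    go [] = refl
    go (σ ∷ xs) rewrite e σ | go xs = refl

  ∑-δ1 : ∀ (x : Fin n) → ∑ (λ y → 𝟙 (x == y)) ≡ 1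
  ∑-δ1 x = trans (∑-cong λ y → sym (*-identityʳ _)) (∑-δ x (λ _ → 1))

  ==-sym : ∀ (x y : Fin n) → (x == y) ≡ (y == x)
  ==-sym x y with x ≟ y | y ≟ x
  ... | yes _ | yes _ = refl
  ... | yes p | no q = ⊥-elim (q (sym p))
  ... | no p | yes q = ⊥-elim (p (sym q))
  ... | no _ | no _ = refl

  private
    distinct : Fin n → Fin n → Fin n → Bool
    distinct x y z = not (x == y) ∧ (not (y == z) ∧ not (x == z))

    -- Inclusion and exclusion: two of the equalities imply the third, so when all hold they are
    -- counted twice too often.
    d-count : ∀ x y z → 𝟙 (distinct x y z) + (𝟙 (x == y) + (𝟙 (y == z) + 𝟙 (x == z))) ≡ 1 + 2 * (𝟙 (x == y) * 𝟙 (y == z))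
    d-count x y z with x ≟ y | y ≟ z | x ≟ z
    ... | yes _ | yes _ | yes _ = refl
    ... | yes p | yes q | no r = ⊥-elim (r (trans p q))
    ... | yes p | no q | yes r = ⊥-elim (q (trans (sym p) r))
    ... | yes _ | no _ | no _ = refl
    ... | no p | yes q | yes r = ⊥-elim (p (trans r (sym q)))
    ... | no _ | yes _ | no _ = refl
    ... | no _ | no _ | yes _ = refl
    ... | no _ | no _ | no _ = refl

  -- The polynomial is n (n - 1) (n - 2) with its negative term moved to the left; `six-C3` brings
  -- the binomial coefficient to the same form.
  six-triples : 6 * count {n} (λ _ → true) + 3 * (n * n) ≡ n * (n * n) + 2 * n
  six-triples = trans (cong (_+ 3 * (n * n)) (trans (cong (6 *_) (count-cong λ σ → sym (dist-true σ)))
      (six-count distinct d₁₂ d₂₃ d-irr))) (trans (cong (∑³ (λ x y z → 𝟙 (distinct x y z)) +_) three)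
      (trans (sym ∑³-+) (trans (∑³-cong d-count) (trans ∑³-+ (cong₂ _+_ cube (trans (∑³-* 2) (cong (2 *_) diag)))))))
    where
    d₁₂ : ∀ x y z → distinct y x z ≡ distinct x y z
    d₁₂ x y z rewrite ==-sym y x = cong (not (x == y) ∧_) (Boolₚ.∧-comm (not (x == z)) _)
    d₂₃ : ∀ x y z → distinct x z y ≡ distinct x y z
    d₂₃ x y z rewrite ==-sym z y with x == y | y == z | x == z
    ... | true | true | true = refl
    ... | true | true | false = refl
    ... | true | false | true = refl
    ... | true | false | false = refl
    ... | false | true | true = refl
    ... | false | true | false = refl
    ... | false | false | true = refl
    ... | false | false | false = refl
    d-irr : ∀ x z → distinct x x z ≡ false
    d-irr x z rewrite ==-refl x = refl
    dist-true : ∀ σ → distinct (a σ) (b σ) (c σ) ≡ true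
    dist-true σ with a σ ≟ b σ | b σ ≟ c σ | a σ ≟ c σ
    ... | yes p | _ | _ = ⊥-elim (Finₚ.<-irrefl p (a<b σ))
    ... | no _ | yes p | _ = ⊥-elim (Finₚ.<-irrefl p (b<c σ))
    ... | no _ | no _ | yes p = ⊥-elim (Finₚ.<-irrefl p (Finₚ.<-trans (a<b σ) (b<c σ)))
    ... | no _ | no _ | no _ = refl
    cube : ∑³ {n} (λ _ _ _ → 1) ≡ n * (n * n)
    cube = trans (∑-cong λ x → trans (∑-cong λ y → trans (∑-const n 1) (*-identityʳ n)) (∑-const n n)) (∑-const n (n * n))
    diag : ∑³ {n} (λ x y z → 𝟙 (x == y) * 𝟙 (y == z)) ≡ n
    diag = trans (∑-cong λ x → trans (∑-cong λ y → trans (∑-* (𝟙 (x == y))) (cong (𝟙 (x == y) *_) (∑-δ1 y))) (∑-δ x (λ _ → 1))) (trans (∑-const n 1) (*-identityʳ n))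
    xz : ∑³ {n} (λ x y z → 𝟙 (x == z)) ≡ n * n
    xz = trans (∑-cong λ x → trans (∑-cong λ y → ∑-δ1 x) (trans (∑-const n 1) (*-identityʳ n))) (∑-const n n)
    yz : ∑³ {n} (λ x y z → 𝟙 (y == z)) ≡ n * n
    yz = trans (∑-cong λ x → trans (∑-cong λ y → ∑-δ1 y) (trans (∑-const n 1) (*-identityʳ n))) (∑-const n n)
    xy : ∑³ {n} (λ x y z → 𝟙 (x == y)) ≡ n * n
    xy = trans (sym (∑³-swap₂₃ (λ x y z → 𝟙 (x == y)))) xz
    three : 3 * (n * n) ≡ ∑³ (λ x y z → 𝟙 (x == y) + (𝟙 (y == z) + 𝟙 (x == z)))
    three = sym (trans ∑³-+ (cong₂ _+_ xy (trans ∑³-+ (cong₂ _+_ yz (trans xz (sym (+-identityʳ _)))))))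

six-C3 : ∀ n → 6 * (n C 3) + 3 * (n * n) ≡ n * (n * n) + 2 * n
six-C3 zero = refl
six-C3 (suc n) = +-cancelʳ-≡ (3 * n) _ _ (begin
  6 * (suc n C 3) + 3 * (suc n * suc n) + 3 * n ≡⟨ cong (λ k → 6 * k + 3 * (suc n * suc n) + 3 * n) (sym (nCk+nC[k+1]≡[n+1]C[k+1] n 2)) ⟩
  6 * (n C 2 + n C 3) + 3 * (suc n * suc n) + 3 * n ≡⟨ e₁ n (n C 2) (n C 3) ⟩
  (6 * (n C 3) + 3 * (n * n)) + 3 * (2 * (n C 2) + n) + (6 * n + 3) ≡⟨ cong₂ (λ u v → u + 3 * v + (6 * n + 3)) (six-C3 n) (two-C2 n) ⟩
  n * (n * n) + 2 * n + 3 * (n * n) + (6 * n + 3) ≡⟨ e₂ n ⟩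
  suc n * (suc n * suc n) + 2 * suc n + 3 * n ∎)
  where
  open ≡-Reasoning
  two-C2 : ∀ n → 2 * (n C 2) + n ≡ n * n
  two-C2 zero = refl
  two-C2 (suc n) = begin
    2 * (suc n C 2) + suc n ≡⟨ cong (λ k → 2 * k + suc n) (sym (nCk+nC[k+1]≡[n+1]C[k+1] n 1)) ⟩
    2 * (n C 1 + n C 2) + suc n ≡⟨ cong (λ k → 2 * (k + n C 2) + suc n) (nC1≡n n) ⟩
    2 * (n + n C 2) + suc n ≡⟨ e₀ n (n C 2) ⟩
    (2 * (n C 2) + n) + (2 * n + 1) ≡⟨ cong (_+ (2 * n + 1)) (two-C2 n) ⟩
    n * n + (2 * n + 1) ≡⟨ e₃ n ⟩
    suc n * suc n ∎
    where
    e₀ : ∀ n k → 2 * (n + k) + suc n ≡ (2 * k + n) + (2 * n + 1)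
    e₀ = solve-∀
    e₃ : ∀ n → n * n + (2 * n + 1) ≡ suc n * suc n
    e₃ = solve-∀
  e₁ : ∀ n u v → 6 * (u + v) + 3 * (suc n * suc n) + 3 * n ≡ (6 * v + 3 * (n * n)) + 3 * (2 * u + n) + (6 * n + 3)
  e₁ = solve-∀
  e₂ : ∀ n → n * (n * n) + 2 * n + 3 * (n * n) + (6 * n + 3) ≡ suc n * (suc n * suc n) + 2 * suc n + 3 * n
  e₂ = solve-∀

count-triples : ∀ n → count {n} (λ _ → true) ≡ n C 3
count-triples n = *-cancelˡ-≡ _ _ 6 (+-cancelʳ-≡ (3 * (n * n)) _ _ (trans (six-triples {n}) (sym (six-C3 n))))

-- Graphs up to switching

record Graph (n : ℕ) : Set where
  field
    adj    : Fin n → Fin n → Bool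
    symm   : ∀ x y → adj x y ≡ adj y x
    irrefl : ∀ x → adj x x ≡ false

  -- The two-graph of `adj`: its coboundary as a symmetric function of ordered triples, and an
  -- invariant of switching.
  odd³ : Fin n → Fin n → Fin n → Bool
  odd³ x y z = adj x y xor (adj y z xor adj x z)

  deg : Fin n → ℕ
  deg x = ∑ λ y → 𝟙 (adj x y)

  ends : ℕ
  ends = ∑ deg

  squares : ℕ
  squares = ∑ λ x → deg x * deg x

  triangles : ℕ
  triangles = ∑³ λ x y z → 𝟙 (adj x y) * (𝟙 (adj y z) * 𝟙 (adj x z))

  odds : ℕ
  odds = ∑³ λ x y z → 𝟙 (odd³ x y z)

  odds-formula : odds + 6 * squares ≡ 3 * (n * ends) + 4 * triangles
  odds-formula = begin
    odds + 6 * squares ≡⟨ cong (odds +_) (trans (e₁ squares) (cong (2 *_) (sym (trans ∑³-+ (cong₂ _+_ (xy-yz) (trans ∑³-+ (cong₂ _+_ yz-xz xy-xz))))))) ⟩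
    odds + 2 * ∑³ _ ≡⟨ cong (odds +_) (sym (∑³-* 2)) ⟩
    odds + ∑³ _ ≡⟨ sym ∑³-+ ⟩
    ∑³ _ ≡⟨ ∑³-cong (λ x y z → pointwise (adj x y) (adj y z) (adj x z)) ⟩
    ∑³ _ ≡⟨ trans ∑³-+ (cong₂ _+_ (trans ∑³-+ (cong₂ _+_ xy (trans ∑³-+ (cong₂ _+_ yz xz)))) (∑³-* 4)) ⟩
    n * ends + (n * ends + n * ends) + 4 * triangles ≡⟨ cong (_+ 4 * triangles) (e₂ (n * ends)) ⟩
    3 * (n * ends) + 4 * triangles ∎
    where
    open ≡-Reasoning
    e₁ : ∀ k → 6 * k ≡ 2 * (k + (k + k))
    e₁ = solve-∀
    e₂ : ∀ k → k + (k + k) ≡ 3 * k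
    e₂ = solve-∀
    -- Over the integers, p xor q xor r = p + q + r - 2 (pq + qr + pr) + 4 pqr. Each of the products
    -- of two sums to `squares`.
    pointwise : ∀ p q r → 𝟙 (p xor (q xor r)) + 2 * (𝟙 p * 𝟙 q + (𝟙 q * 𝟙 r + 𝟙 p * 𝟙 r)) ≡ 𝟙 p + (𝟙 q + 𝟙 r) + 4 * (𝟙 p * (𝟙 q * 𝟙 r))
    pointwise false false false = refl
    pointwise false false true = refl
    pointwise false true false = refl
    pointwise false true true = refl
    pointwise true false false = refl
    pointwise true false true = refl
    pointwise true true false = refl
    pointwise true true true = refl
    xy-xz : ∑³ (λ x y z → 𝟙 (adj x y) * 𝟙 (adj x z)) ≡ squares
    xy-xz = ∑-cong λ x → trans (∑-cong λ y → trans (∑-* (𝟙 (adj x y))) (*-comm (𝟙 (adj x y)) (deg x))) (∑-* (deg x))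
    xy-yz : ∑³ (λ x y z → 𝟙 (adj x y) * 𝟙 (adj y z)) ≡ squares
    xy-yz = trans (∑³-cong λ x y z → cong (λ t → 𝟙 t * 𝟙 (adj y z)) (symm x y)) (trans (∑³-swap₁₂ (λ x y z → 𝟙 (adj x y) * 𝟙 (adj x z))) xy-xz)
    yz-xz : ∑³ (λ x y z → 𝟙 (adj y z) * 𝟙 (adj x z)) ≡ squares
    yz-xz = trans (∑³-cong λ x y z → trans (*-comm (𝟙 (adj y z)) _) (cong (λ t → 𝟙 (adj x z) * 𝟙 t) (symm y z)))
              (trans (∑³-swap₂₃ (λ x y z → 𝟙 (adj x y) * 𝟙 (adj y z))) xy-yz)
    yz : ∑³ (λ x y z → 𝟙 (adj y z)) ≡ n * ends
    yz = ∑-const n ends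
    xz : ∑³ (λ x y z → 𝟙 (adj x z)) ≡ n * ends
    xz = trans (sym (∑³-swap₁₂ (λ x y z → 𝟙 (adj x z)))) yz
    xy : ∑³ (λ x y z → 𝟙 (adj x y)) ≡ n * ends
    xy = trans (sym (∑³-swap₂₃ (λ x y z → 𝟙 (adj x y)))) xz

  odd³₁₂ : ∀ x y z → odd³ y x z ≡ odd³ x y z
  odd³₁₂ x y z rewrite symm y x = cong (adj x y xor_) (Boolₚ.xor-comm (adj x z) (adj y z))

  odd³₂₃ : ∀ x y z → odd³ x z y ≡ odd³ x y z
  odd³₂₃ x y z rewrite symm z y = solve 3 (λ p q r → r :+ (q :+ p) := p :+ (q :+ r)) refl (adj x y) (adj y z) (adj x z)
    where open xor-∧-Solver

  odd³-irrefl : ∀ x z → odd³ x x z ≡ false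
  odd³-irrefl x z rewrite irrefl x = Boolₚ.xor-same (adj x z)

  six-odds : 6 * count (λ σ → odd³ (a σ) (b σ) (c σ)) ≡ odds
  six-odds = six-count odd³ odd³₁₂ odd³₂₃ odd³-irrefl

  -- The member of the switching class in which `v` is isolated.
  link : Fin n → Graph n
  link v = record { adj = odd³ v ; symm = λ x y → sym (odd³₂₃ v x y) ; irrefl = λ x → trans (odd³₁₂ x v x) (trans (odd³₂₃ x x v) (odd³-irrefl x v)) }

  switch : Fin n → Graph n
  switch u = record
    { adj = λ x y → adj x y xor ((x == u) xor (y == u))
    ; symm = λ x y → cong₂ _xor_ (symm x y) (Boolₚ.xor-comm (x == u) (y == u))
    ; irrefl = λ x → cong₂ _xor_ (irrefl x) (Boolₚ.xor-same (x == u)) }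

open Graph

module _ {n : ℕ} where

  _≈³_ : Graph n → Graph n → Set
  G ≈³ H = ∀ x y z → odd³ G x y z ≡ odd³ H x y z

  link-≈³ : ∀ (G : Graph n) v → link G v ≈³ G
  link-≈³ G v x y z = solve 6 (λ vx vy vz xy yz xz → (vx :+ (xy :+ vy)) :+ ((vy :+ (yz :+ vz)) :+ (vx :+ (xz :+ vz))) := xy :+ (yz :+ xz)) refl
    (adj G v x) (adj G v y) (adj G v z) (adj G x y) (adj G y z) (adj G x z)
    where open xor-∧-Solver

  switch-≈³ : ∀ (G : Graph n) u → switch G u ≈³ G
  switch-≈³ G u x y z = solve 6 (λ p q r s t w → (p :+ (s :+ t)) :+ ((q :+ (t :+ w)) :+ (r :+ (s :+ w))) := p :+ (q :+ r)) refl
    (adj G x y) (adj G y z) (adj G x z) (x == u) (y == u) (z == u)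
    where open xor-∧-Solver

  -- The n - 1 pairs at `u` are complemented, so its degree d becomes n - 1 - d, and each pair
  -- counts twice in `ends`.
  switch-ends : ∀ (G : Graph n) u → ends (switch G u) + 4 * deg G u + 2 ≡ ends G + 2 * n
  switch-ends G u = begin
    ends (switch G u) + 4 * deg G u + 2 ≡⟨ e₁ (ends (switch G u)) (deg G u) ⟩
    ends (switch G u) + (2 * deg G u + 2 * deg G u + 2 * 1) ≡⟨ cong (ends (switch G u) +_) (cong₂ _+_ (cong₂ _+_ (cong (2 *_) (sym r₁)) (cong (2 *_) (sym r₂))) (cong (2 *_) (sym r₃))) ⟩
    ends (switch G u) + (2 * ∑² f₁ + 2 * ∑² f₂ + 2 * ∑² f₃) ≡⟨ cong (ends (switch G u) +_) (sym (trans ∑²-+ (cong₂ _+_ (trans ∑²-+ (cong₂ _+_ (∑²-* 2) (∑²-* 2))) (∑²-* 2)))) ⟩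
    ends (switch G u) + ∑² (λ x y → 2 * f₁ x y + 2 * f₂ x y + 2 * f₃ x y) ≡⟨ sym ∑²-+ ⟩
    ∑² _ ≡⟨ (∑-cong λ x → ∑-cong λ y → pointwise x y) ⟩
    ∑² _ ≡⟨ trans ∑²-+ (cong₂ _+_ refl (trans ∑²-+ (cong₂ _+_ s₁ s₂))) ⟩
    ends G + (n + n) ≡⟨ cong (ends G +_) (cong (n +_) (sym (+-identityʳ n))) ⟩
    ends G + 2 * n ∎
    where
    open ≡-Reasoning
    f₁ f₂ f₃ : Fin n → Fin n → ℕ
    f₁ x y = 𝟙 (u == x) * 𝟙 (adj G x y)
    f₂ x y = 𝟙 (u == y) * 𝟙 (adj G x y)
    f₃ x y = 𝟙 (u == x) * 𝟙 (u == y)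
    ∑² : (Fin n → Fin n → ℕ) → ℕ
    ∑² f = ∑ λ x → ∑ (f x)
    ∑²-+ : ∀ {f g : Fin n → Fin n → ℕ} → ∑² (λ x y → f x y + g x y) ≡ ∑² f + ∑² g
    ∑²-+ = trans (∑-cong λ x → ∑-+) ∑-+
    ∑²-* : ∀ k {f : Fin n → Fin n → ℕ} → ∑² (λ x y → k * f x y) ≡ k * ∑² f
    ∑²-* k = trans (∑-cong λ x → ∑-* k) (∑-* k)
    e₁ : ∀ e d → e + 4 * d + 2 ≡ e + (2 * d + 2 * d + 2 * 1)
    e₁ = solve-∀
    r₁ : ∑² f₁ ≡ deg G u
    r₁ = trans (∑-cong λ x → ∑-* (𝟙 (u == x))) (∑-δ u (deg G))
    r₂ : ∑² f₂ ≡ deg G u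
    r₂ = trans (∑-cong λ x → ∑-δ u (λ y → 𝟙 (adj G x y))) (∑-cong λ x → cong 𝟙 (symm G x u))
    r₃ : ∑² f₃ ≡ 1
    r₃ = trans (∑-cong λ x → trans (∑-* (𝟙 (u == x))) (cong (𝟙 (u == x) *_) (∑-δ1 u))) (∑-δ u (λ _ → 1))
    s₁ : ∑² (λ x y → 𝟙 (u == x)) ≡ n
    s₁ = trans (∑-comm _) (trans (∑-cong λ x → ∑-δ1 u) (trans (∑-const n 1) (*-identityʳ n)))
    s₂ : ∑² (λ x y → 𝟙 (u == y)) ≡ n
    s₂ = trans (∑-cong λ x → ∑-δ1 u) (trans (∑-const n 1) (*-identityʳ n))
    pointwise : ∀ x y → 𝟙 (adj G x y xor ((x == u) xor (y == u))) + (2 * (𝟙 (u == x) * 𝟙 (adj G x y)) + 2 * (𝟙 (u == y) * 𝟙 (adj G x y)) + 2 * (𝟙 (u == x) * 𝟙 (u == y)))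
              ≡ 𝟙 (adj G x y) + (𝟙 (u == x) + 𝟙 (u == y))
    pointwise x y rewrite ==-sym x u | ==-sym y u with u ≟ x | u ≟ y
    ... | yes refl | yes refl rewrite irrefl G u = refl
    ... | yes _ | no _ with adj G x y
    ... | true = refl
    ... | false = refl
    pointwise x y | no _ | yes _ with adj G x y
    ... | true = refl
    ... | false = refl
    pointwise x y | no _ | no _ with adj G x y
    ... | true = refl
    ... | false = refl

  -- Switching at a vertex of degree at least n / 2 decreases the number of edges.
  bounded-degrees : ∀ M → n ≤ 2 * M + 2 → ∀ (G : Graph n) → ∃ λ H → H ≈³ G × ends H ≤ ends G × (∀ x → deg H x ≤ M)
  bounded-degrees M n≤ G = go (ends G) G ≤-refl
    where
    go : ∀ k (G : Graph n) → ends G ≤ k → ∃ λ H → H ≈³ G × ends H ≤ ends G × (∀ x → deg H x ≤ M)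
    go k G E≤k with Finₚ.any? (λ x → suc M ≤? deg G x)
    ... | no none = G , (λ _ _ _ → refl) , ≤-refl , λ x → ≮⇒≥ (λ q → none (x , q))
    ... | yes (x , M<d) = next k E≤k
      where
      less : suc (ends (switch G x)) ≤ ends G
      less = +-cancelʳ-≤ (2 * n) _ _ (begin
        suc (ends (switch G x)) + 2 * n ≤⟨ +-monoʳ-≤ (suc (ends (switch G x))) (*-monoʳ-≤ 2 n≤) ⟩
        suc (ends (switch G x)) + 2 * (2 * M + 2) ≡⟨ e₁ (ends (switch G x)) M ⟩
        ends (switch G x) + 4 * suc M + 1 ≤⟨ +-mono-≤ (+-monoʳ-≤ (ends (switch G x)) (*-monoʳ-≤ 4 M<d)) (s≤s (z≤n {1})) ⟩
        ends (switch G x) + 4 * deg G x + 2 ≡⟨ switch-ends G x ⟩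
        ends G + 2 * n ∎)
        where
        open ≤-Reasoning
        e₁ : ∀ e M → suc e + 2 * (2 * M + 2) ≡ e + 4 * suc M + 1
        e₁ = solve-∀
      next : ∀ k → ends G ≤ k → ∃ λ H → H ≈³ G × ends H ≤ ends G × (∀ x → deg H x ≤ M)
      next zero q = case ≤-trans less q of λ ()
      next (suc k) q with go k (switch G x) (ℕ.s≤s⁻¹ (≤-trans less q))
      ... | H , H≈ , E≤ , d≤ = H , (λ x' y z → trans (H≈ x' y z) (switch-≈³ G x x' y z)) , ≤-trans E≤ (<⇒≤ less) , d≤

  complement : (Fin n → Fin n → Bool) → Graph n
  complement g = record { adj = ad ; symm = λ x y → Boolₚ.∨-comm ((x << y) ∧ _) _ ; irrefl = irr }
    where
    ad : Fin n → Fin n → Bool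
    ad x y = ((x << y) ∧ not (g x y)) ∨ ((y << x) ∧ not (g y x))
    irr : ∀ x → ad x x ≡ false
    irr x with x <? x
    ... | yes p = ⊥-elim (Finₚ.<-irrefl refl p)
    ... | no _ = refl

  complement-< : ∀ g {x y} → x Fin.< y → adj (complement g) x y ≡ not (g x y)
  complement-< g {x} {y} p with x <? y | y <? x
  ... | yes _ | yes r = ⊥-elim (Finₚ.<-asym p r)
  ... | yes _ | no _ = Boolₚ.∨-identityʳ _
  ... | no r | _ = ⊥-elim (r p)

  -- Three negations reverse a parity.
  complement-odd³ : ∀ g σ → odd³ (complement g) (a σ) (b σ) (c σ) ≡ not (cob g σ)
  complement-odd³ g (triple x y z p q) rewrite complement-< g p | complement-< g q | complement-< g (Finₚ.<-trans p q) =
    solve 3 (λ s t u → (con true :+ s) :+ ((con true :+ t) :+ (con true :+ u)) := con true :+ (s :+ (t :+ u))) refl (g x y) (g y z) (g x z)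
    where
    open xor-∧-Solver

argmin : ∀ {n} (f : Fin (suc n) → ℕ) → ∃ λ v → ∀ x → f v ≤ f x
argmin {zero} f = zero , λ { zero → ≤-refl }
argmin {suc n} f with argmin (f ∘ suc)
... | v , v≤ with ≤-total (f zero) (f (suc v))
... | inj₁ p = zero , λ { zero → ≤-refl ; (suc x) → ≤-trans p (v≤ x) }
... | inj₂ p = suc v , λ { zero → p ; (suc x) → v≤ x }

argmax : ∀ {n} (f : Fin (suc n) → ℕ) → ∃ λ v → ∀ x → f x ≤ f v
argmax {zero} f = zero , λ { zero → ≤-refl }
argmax {suc n} f with argmax (f ∘ suc)
... | v , v≤ with ≤-total (f zero) (f (suc v))
... | inj₂ p = zero , λ { zero → ≤-refl ; (suc x) → ≤-trans (v≤ x) p }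
... | inj₁ p = suc v , λ { zero → p ; (suc x) → v≤ x }

-- By definition `odds` is the sum of `ends` over all links, and the least summand is at most the
-- average.
sparse-link : ∀ {n} (G : Graph (suc n)) → ∃ λ v → suc n * ends (link G v) ≤ odds G
sparse-link {n} G with argmin (λ v → ends (link G v))
... | v , min = v , ≤-trans (≤-reflexive (sym (∑-const (suc n) (ends (link G v))))) (∑-mono min)

-- Twins and sparsity

𝟙≤1 : ∀ t → 𝟙 t ≤ 1
𝟙≤1 true  = ≤-refl
𝟙≤1 false = z≤n

𝟙*≤ : ∀ t k → 𝟙 t * k ≤ k
𝟙*≤ true  k = ≤-reflexive (+-identityʳ k)
𝟙*≤ false k = z≤n

length-concatMap : ∀ {A : Set} {m} (f : Fin m → List A) → length (concatMap f (allFin m)) ≡ ∑ (λ x → length (f x))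
length-concatMap {A} {m} f = go id
  where
  go : ∀ {k} (e : Fin k → Fin m) → length (concatMap f (tabulate e)) ≡ ∑ (λ x → length (f (e x)))
  go {zero} e = sym (∑-zero _)
  go {suc k} e = trans (length-++ (f (e zero))) (trans (cong (length (f (e zero)) +_) (go (e ∘ suc))) (sym (∑-suc _)))

guard : ∀ {A : Set} → Bool → A → List A
guard true  x = x ∷ []
guard false x = []

length-guard : ∀ {A : Set} t (x : A) → length (guard t x) ≡ 𝟙 t
length-guard true x = refl
length-guard false x = refl

∈-guard : ∀ {A : Set} {t} {x : A} → t ≡ true → x ∈ guard t x
∈-guard refl = here refl

module _ {n : ℕ} where

  term≤∑ : ∀ (f : Fin n → ℕ) x → f x ≤ ∑ f
  term≤∑ f x = ≤-trans (≤-reflexive (sym (∑-δ x f))) (∑-mono λ y → 𝟙*≤ (x == y) (f y))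

  two-terms≤∑ : ∀ (f : Fin n → ℕ) {x y} → x ≢ y → f x + f y ≤ ∑ f
  two-terms≤∑ f {x} {y} x≢y = ≤-trans (≤-reflexive (sym (trans ∑-+ (cong₂ _+_ (∑-δ x f) (∑-δ y f))))) (∑-mono pointwise)
    where
    pointwise : ∀ z → 𝟙 (x == z) * f z + 𝟙 (y == z) * f z ≤ f z
    pointwise z with x ≟ z | y ≟ z
    ... | yes p | yes q = ⊥-elim (x≢y (trans p (sym q)))
    ... | yes _ | no _ = ≤-reflexive (trans (+-identityʳ _) (+-identityʳ _))
    ... | no _ | yes _ = ≤-reflexive (+-identityʳ _)
    ... | no _ | no _ = z≤n

  # : (Fin n → Bool) → ℕ
  # P = ∑ λ x → 𝟙 (P x)

  pick : ∀ P → 1 ≤ # P → ∃ λ x → P x ≡ true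
  pick P 1≤ with Finₚ.any? (λ x → P x Boolₚ.≟ true)
  ... | yes r = r
  ... | no none = case ≤-trans 1≤ (≤-reflexive (∑-0 λ x → cong 𝟙 (Boolₚ.¬-not (λ e → none (x , e))))) of λ ()

  _∖_ : (Fin n → Bool) → Fin n → Fin n → Bool
  (P ∖ x) y = P y ∧ not (x == y)

  ∖-true : ∀ P x {y} → (P ∖ x) y ≡ true → P y ≡ true × x ≢ y
  ∖-true P x {y} e with P y | x ≟ y
  ... | true | no p = refl , p
  ∖-true P x {y} () | true  | yes _
  ∖-true P x {y} () | false | yes _
  ∖-true P x {y} () | false | no _

  #-∖ : ∀ P x → # P ≤ suc (# (P ∖ x))
  #-∖ P x = ≤-trans (∑-mono pointwise) (≤-reflexive (trans ∑-+ (cong (_+ # (P ∖ x)) (∑-δ1 x))))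
    where
    pointwise : ∀ y → 𝟙 (P y) ≤ 𝟙 (x == y) + 𝟙 (P y ∧ not (x == y))
    pointwise y with P y | x ≟ y
    ... | true | yes _ = ≤-refl
    ... | true | no _ = ≤-refl
    ... | false | yes _ = z≤n
    ... | false | no _ = z≤n

  pick-next : ∀ P x k → suc (suc k) ≤ # P → suc k ≤ # (P ∖ x)
  pick-next P x k h = ℕ.s≤s⁻¹ (≤-trans h (#-∖ P x))

  Three : (Fin n → Bool) → Set
  Three P = ∃ λ x → ∃ λ y → ∃ λ z → (P x ≡ true × P y ≡ true × P z ≡ true) × x ≢ y × y ≢ z × x ≢ z

  pick₃ : ∀ P → 3 ≤ # P → Three P
  pick₃ P three with pick P (≤-trans (s≤s z≤n) three)
  ... | x , Px with pick (P ∖ x) (pick-next P x 0 (≤-trans (s≤s (s≤s z≤n)) three))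
  ... | y , y∈ with ∖-true P x y∈ | pick ((P ∖ x) ∖ y) (pick-next (P ∖ x) y 0 (pick-next P x 1 three))
  ... | Py , x≢y | z , z∈ with ∖-true (P ∖ x) y z∈
  ... | z∈′ , y≢z with ∖-true P x z∈′
  ... | Pz , x≢z = x , y , z , (Px , Py , Pz) , x≢y , y≢z , x≢z

  #≤1 : ∀ P → (∀ x y → P x ≡ true → P y ≡ true → x ≢ y → ⊥) → # P ≤ 1
  #≤1 P uniq with # P ℕ.≤? 1
  ... | yes r = r
  ... | no r with pick P (≤-trans (s≤s z≤n) (≰⇒> r))
  ... | x , Px with pick (P ∖ x) (pick-next P x 0 (≰⇒> r))
  ... | y , Py = ⊥-elim (uniq x y Px (proj₁ (∖-true P x Py)) (proj₂ (∖-true P x Py)))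

  -- Vertices with pairwise distinct patterns of adjacency to S number at most 2 ^ |S|.
  #-patterns : ∀ (A : Fin n → Fin n → Bool) (S : List (Fin n)) P →
    (∀ x y → P x ≡ true → P y ≡ true → x ≢ y → (∀ s → s ∈ S → A x s ≡ A y s) → ⊥) → # P ≤ 2 ^ length S
  #-patterns A [] P sep = #≤1 P λ x y Px Py x≢y → sep x y Px Py x≢y λ _ ()
  #-patterns A (s ∷ S) P sep = ≤-trans (≤-trans (∑-mono pointwise) (≤-reflexive ∑-+))
    (≤-trans (+-mono-≤ (#-patterns A S P₁ sep₁) (#-patterns A S P₀ sep₀)) (≤-reflexive (cong (2 ^ length S +_) (sym (+-identityʳ _)))))
    where
    P₁ P₀ : Fin n → Bool
    P₁ x = P x ∧ A x s
    P₀ x = P x ∧ not (A x s)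
    pointwise : ∀ x → 𝟙 (P x) ≤ 𝟙 (P₁ x) + 𝟙 (P₀ x)
    pointwise x with P x | A x s
    ... | true | true = ≤-refl
    ... | true | false = ≤-refl
    ... | false | _ = z≤n
    true₁ : ∀ x → P₁ x ≡ true → P x ≡ true × A x s ≡ true
    true₁ x e with P x | A x s
    true₁ x e | true | true = refl , refl
    true₀ : ∀ x → P₀ x ≡ true → P x ≡ true × A x s ≡ false
    true₀ x e with P x | A x s
    true₀ x e | true | false = refl , refl
    sep₁ : ∀ x y → P₁ x ≡ true → P₁ y ≡ true → x ≢ y → (∀ t → t ∈ S → A x t ≡ A y t) → ⊥
    sep₁ x y e e' x≢y same with true₁ x e | true₁ y e'
    ... | Px , Ax | Py , Ay = sep x y Px Py x≢y λ { t (here refl) → trans Ax (sym Ay) ; t (there m) → same t m }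
    sep₀ : ∀ x y → P₀ x ≡ true → P₀ y ≡ true → x ≢ y → (∀ t → t ∈ S → A x t ≡ A y t) → ⊥
    sep₀ x y e e' x≢y same with true₀ x e | true₀ y e'
    ... | Px , Ax | Py , Ay = sep x y Px Py x≢y λ { t (here refl) → trans Ax (sym Ay) ; t (there m) → same t m }

  elements : (Fin n → Bool) → List (Fin n)
  elements P = concatMap (λ x → guard (P x) x) (allFin n)

  length-elements : ∀ P → length (elements P) ≡ # P
  length-elements P = trans (length-concatMap _) (∑-cong λ x → length-guard (P x) x)

  ∈-elements : ∀ P {x} → P x ≡ true → x ∈ elements P
  ∈-elements P {x} e = ∈-concatMap⁺ _ (lose (∈-allFin x) (∈-guard e))

  -- Each edge merges at most two classes of a labelling, so m edges leave at least n - m roots.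
  labelling : ∀ (L : List (Fin n × Fin n)) → ∃ λ (ℓ : Fin n → Fin n) →
    (∀ x → ℓ (ℓ x) ≡ ℓ x) × (∀ x y → (x , y) ∈ L → ℓ x ≡ ℓ y) × n ≤ length L + # (λ x → ℓ x == x)
  labelling [] = id , (λ _ → refl) , (λ _ _ ()) , ≤-reflexive (sym (trans (∑-cong λ x → cong 𝟙 (==-refl x)) (trans (∑-const n 1) (*-identityʳ n))))
  labelling ((u , v) ∷ L) with labelling L
  ... | ℓ , idem , const , bound with ℓ u ≟ ℓ v
  ... | yes same = ℓ , idem , (λ { x y (here refl) → same ; x y (there m) → const x y m }) , ≤-trans bound (n≤1+n _)
  ... | no differ = ℓ' , idem' , const' , ≤-trans bound (≤-trans (+-monoʳ-≤ (length L) roots) (≤-reflexive (+-suc _ _)))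
    where
    -- The class of `u` is merged into that of `v`; `ℓ u` is the only root lost.
    ℓ' : Fin n → Fin n
    ℓ' x = if ℓ x == ℓ u then ℓ v else ℓ x
    ℓ'-yes : ∀ {x} → ℓ x ≡ ℓ u → ℓ' x ≡ ℓ v
    ℓ'-yes {x} e with ℓ x ≟ ℓ u
    ... | yes _ = refl
    ... | no p = ⊥-elim (p e)
    ℓ'-no : ∀ {x} → ℓ x ≢ ℓ u → ℓ' x ≡ ℓ x
    ℓ'-no {x} e with ℓ x ≟ ℓ u
    ... | yes p = ⊥-elim (e p)
    ... | no _ = refl
    ℓ'-cong : ∀ {x y} → ℓ x ≡ ℓ y → ℓ' x ≡ ℓ' y
    ℓ'-cong e rewrite e = refl
    idem' : ∀ x → ℓ' (ℓ' x) ≡ ℓ' x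
    idem' x = by-cases (ℓ x ≟ ℓ u)
      where
      by-cases : Dec (ℓ x ≡ ℓ u) → ℓ' (ℓ' x) ≡ ℓ' x
      by-cases (yes e) = trans (cong ℓ' (ℓ'-yes e)) (trans (trans (ℓ'-no (λ q → differ (trans (sym q) (idem v)))) (idem v)) (sym (ℓ'-yes e)))
      by-cases (no e) = trans (cong ℓ' (ℓ'-no e)) (trans (trans (ℓ'-no (λ q → e (trans (sym (idem x)) q))) (idem x)) (sym (ℓ'-no e)))
    const' : ∀ x y → (x , y) ∈ (u , v) ∷ L → ℓ' x ≡ ℓ' y
    const' x y (here refl) = trans (ℓ'-yes refl) (sym (ℓ'-no (λ q → differ (sym q))))
    const' x y (there m) = ℓ'-cong (const x y m)
    roots : # (λ x → ℓ x == x) ≤ suc (# (λ x → ℓ' x == x))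
    roots = ≤-trans (∑-mono λ x → pointwise x (ℓ x ≟ x) (ℓ x ≟ ℓ u)) (≤-reflexive (trans ∑-+ (cong (_+ # (λ x → ℓ' x == x)) (∑-δ1 (ℓ u)))))
      where
      pointwise : ∀ x → Dec (ℓ x ≡ x) → Dec (ℓ x ≡ ℓ u) → 𝟙 (ℓ x == x) ≤ 𝟙 (ℓ u == x) + 𝟙 (ℓ' x == x)
      pointwise x (no p) _ = ≤-trans (≤-reflexive (cong 𝟙 (≢⇒== p))) z≤n
      pointwise x (yes p) (yes q) = ≤-trans (≤-trans (𝟙≤1 _) (≤-reflexive (sym (cong 𝟙 (trans (cong (_== x) (trans (sym q) p)) (==-refl x)))))) (m≤m+n _ _)
      pointwise x (yes p) (no q) = ≤-trans (≤-reflexive (cong (λ y → 𝟙 (y == x)) (sym (ℓ'-no q)))) (m≤n+m _ _)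

-- The third part is implicit: the vertices in neither `p` nor `q`.
NoTransversal : ∀ {n} → Graph n → Set
NoTransversal {n} G = ∀ (p q : Fin n → Bool) → (∀ x → p x ≡ true → q x ≡ true → ⊥) →
  (∃ λ x → p x ≡ true) → (∃ λ y → q y ≡ true) → (∃ λ z → p z ≡ false × q z ≡ false) →
  (∀ x y z → p x ≡ true → q y ≡ true → p z ≡ false → q z ≡ false → odd³ G x y z ≡ false) → ⊥

module _ {n : ℕ} (G : Graph n) where

  private
    h : Fin n → Fin n → Bool
    h = adj G
    d : Fin n → ℕ
    d = deg G

  edges : List (Fin n × Fin n)
  edges = concatMap (λ x → concatMap (λ y → guard ((x << y) ∧ h x y) (x , y)) (allFin n)) (allFin n)

  two-edges : 2 * length edges ≡ ends G
  two-edges = sym (trans (∑-cong λ x → trans (∑-cong (pointwise x)) ∑-+) (trans ∑-+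
    (trans (cong (half +_) (∑-comm (λ x y → 𝟙 ((y << x) ∧ h y x)))) (trans (cong (half +_) (sym (+-identityʳ half))) (cong (2 *_) (sym len))))))
    where
    half : ℕ
    half = ∑ λ x → ∑ λ y → 𝟙 ((x << y) ∧ h x y)
    len : length edges ≡ half
    len = trans (length-concatMap _) (∑-cong λ x → trans (length-concatMap _) (∑-cong λ y → length-guard _ (x , y)))
    pointwise : ∀ x y → 𝟙 (h x y) ≡ 𝟙 ((x << y) ∧ h x y) + 𝟙 ((y << x) ∧ h y x)
    pointwise x y rewrite symm G y x with x <? y | y <? x
    ... | yes p | yes q = ⊥-elim (Finₚ.<-asym p q)
    ... | yes _ | no _ = sym (+-identityʳ _)
    ... | no _ | yes _ = refl
    ... | no p | no q with Finₚ.<-cmp x y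
    ... | tri< r _ _ = ⊥-elim (p r)
    ... | tri≈ _ refl _ = cong 𝟙 (irrefl G x)
    ... | tri> _ _ r = ⊥-elim (q r)

  ∈-edges : ∀ {x y} → x Fin.< y → h x y ≡ true → (x , y) ∈ edges
  ∈-edges {x} {y} p e = ∈-concatMap⁺ _ (lose (∈-allFin x) (∈-concatMap⁺ _ (lose (∈-allFin y) (∈-guard lem))))
    where
    lem : (x << y) ∧ h x y ≡ true
    lem with x <? y
    ... | yes _ = e
    ... | no q = ⊥-elim (q p)

  adj-positive : ∀ {x y} → h x y ≡ true → 1 ≤ d x
  adj-positive {x} {y} e = ≤-trans (≤-reflexive (cong 𝟙 (sym e))) (term≤∑ (λ z → 𝟙 (h x z)) y)

  isolated : Fin n → Bool
  isolated x = ⌊ d x ℕ.≟ 0 ⌋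

  leaf : Fin n → Fin n → Bool
  leaf x w = h w x ∧ ⌊ d w ℕ.≟ 1 ⌋

  leaf-true : ∀ x {w} → leaf x w ≡ true → h w x ≡ true × d w ≡ 1
  leaf-true x {w} e with h w x | d w ℕ.≟ 1
  leaf-true x {w} e | true | yes p = refl , p

module _ {n : ℕ} (G : Graph n) (no-trans : NoTransversal G) (3≤n : 3 ≤ n) where

  private
    h : Fin n → Fin n → Bool
    h = adj G
    d : Fin n → ℕ
    d = deg G

  -- Take the parts {x}, {y} and the rest: a triple x, y, z lacks the edge xy and has both or
  -- neither of xz and yz, so it is even.
  no-twins : ∀ x y → x ≢ y → h x y ≡ false → (∀ z → h x z ≡ h y z) → ⊥
  no-twins x y x≢y hxy same = no-trans (x ==_) (y ==_) (λ z e e' → x≢y (trans (==⇒≡ e) (sym (==⇒≡ e')))) (x , ==-refl x) (y , ==-refl y) third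
    λ x' y' z e e' _ _ → cong₂ _xor_ (trans (sym (cong₂ h (==⇒≡ {x = x} e) (==⇒≡ {x = y} e'))) hxy)
      (trans (cong₂ (λ u v → h u z xor h v z) (sym (==⇒≡ {x = y} e')) (sym (==⇒≡ {x = x} e))) (trans (cong (h y z xor_) (same z)) (Boolₚ.xor-same (h y z))))
    where
    all-true : Fin n → Bool
    all-true _ = true
    #all : # all-true ≡ n
    #all = trans (∑-const n 1) (*-identityʳ n)
    third : ∃ λ z → (x == z) ≡ false × (y == z) ≡ false
    third with pick ((all-true ∖ x) ∖ y) (pick-next (all-true ∖ x) y 0 (pick-next all-true x 1 (≤-trans 3≤n (≤-reflexive (sym #all)))))
    ... | z , e with ∖-true (all-true ∖ x) y e
    ... | e' , y≢z = z , ≢⇒== (proj₂ (∖-true all-true x e')) , ≢⇒== y≢z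

  -- Three classes of a labelling that is constant along edges would violate NoTransversal.
  many-edges : n ≤ length (edges G) + 2
  many-edges with labelling (edges G)
  ... | ℓ , _ , const , bound with 3 ℕ.≤? # (λ x → ℓ x == x)
  ... | no r = ≤-trans bound (+-monoʳ-≤ (length (edges G)) (ℕ.s≤s⁻¹ (≰⇒> r)))
  ... | yes three = ⊥-elim (three-classes (pick₃ _ three))
    where
    clash : ∀ {z r} → (ℓ z == r) ≡ false → ℓ z ≡ r → ⊥
    clash {z} e refl = case trans (sym (==-refl (ℓ z))) e of λ ()
    apart : ∀ x y → ℓ x ≢ ℓ y → h x y ≡ false
    apart x y ℓ≢ with h x y in e
    ... | false = refl
    ... | true with Finₚ.<-cmp x y
    ... | tri< r _ _ = ⊥-elim (ℓ≢ (const x y (∈-edges G r e)))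
    ... | tri≈ _ refl _ = ⊥-elim (ℓ≢ refl)
    ... | tri> _ _ r = ⊥-elim (ℓ≢ (sym (const y x (∈-edges G r (trans (symm G y x) e)))))
    three-classes : ¬ Three (λ x → ℓ x == x)
    three-classes (r₁ , r₂ , r₃ , (e₁ , e₂ , e₃) , r₁≢r₂ , r₂≢r₃ , r₁≢r₃) =
      no-trans (λ x → ℓ x == r₁) (λ x → ℓ x == r₂)
        (λ x p q → r₁≢r₂ (trans (sym (==⇒≡ p)) (==⇒≡ q))) (r₁ , e₁) (r₂ , e₂)
        (r₃ , ≢⇒== (λ q → r₁≢r₃ (trans (sym q) (==⇒≡ e₃))) , ≢⇒== (λ q → r₂≢r₃ (trans (sym q) (==⇒≡ e₃))))
        λ x y z p q z₁ z₂ → cong₂ _xor_ (apart x y (λ s → r₁≢r₂ (trans (sym (==⇒≡ p)) (trans s (==⇒≡ q)))))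
          (cong₂ _xor_ (apart y z (λ s → clash z₂ (trans (sym s) (==⇒≡ q)))) (apart x z (λ s → clash z₁ (trans (sym s) (==⇒≡ p)))))

  -- Two isolated vertices are nonadjacent twins, and so are, in the next lemma, two leaves at the
  -- same vertex.
  #isolated≤1 : # (isolated G) ≤ 1
  #isolated≤1 = #≤1 (isolated G) λ x y e e' x≢y → no-twins x y x≢y (none x e y) λ z → trans (none x e z) (sym (none y e' z))
    where
    none : ∀ x → isolated G x ≡ true → ∀ z → h x z ≡ false
    none x e z with d x ℕ.≟ 0
    ... | yes p = Boolₚ.¬-not (λ q → case ≤-trans (adj-positive G q) (≤-reflexive p) of λ ())

  #leaf≤1 : ∀ x → # (leaf G x) ≤ 1
  #leaf≤1 x = #≤1 (leaf G x) λ w w' e e' w≢w' → no-twins w w' w≢w' (adj-leaf w w' e e') λ z → trans (only w e z) (sym (only w' e' z))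
    where
    only : ∀ w → leaf G x w ≡ true → ∀ z → h w z ≡ (x == z)
    only w e z with leaf-true G x e
    ... | hwx , dw with x ≟ z
    ... | yes refl = hwx
    ... | no x≢z = Boolₚ.¬-not λ q → case ≤-trans (≤-trans (≤-reflexive (cong₂ (λ s t → 𝟙 s + 𝟙 t) (sym hwx) (sym q))) (two-terms≤∑ (λ y → 𝟙 (h w y)) x≢z)) (≤-reflexive dw) of λ { (s≤s ()) }
    adj-leaf : ∀ w w' → leaf G x w ≡ true → leaf G x w' ≡ true → h w w' ≡ false
    adj-leaf w w' e e' = trans (only w e w') (≢⇒== λ { refl → case trans (sym (proj₁ (leaf-true G x e'))) (irrefl G x) of λ () })

  -- Outside S, all but 2 ^ |S| vertices have a neighbour outside S.
  high-degrees : ∀ (S : Fin n → Bool) k → # S ≤ k → 2 * ∑ (λ x → 𝟙 (S x) * d x) + n ≤ ends G + (k * k + k + 2 ^ k)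
  high-degrees S k #S≤k = begin
    2 * s + n ≤⟨ +-monoʳ-≤ (2 * s) n≤ ⟩
    2 * s + (k + 2 ^ k + outer) ≡⟨ e₁ s k (2 ^ k) outer ⟩
    s + s + (k + 2 ^ k + outer) ≤⟨ +-monoˡ-≤ _ (+-monoʳ-≤ s s≤) ⟩
    s + (k * k + cross) + (k + 2 ^ k + outer) ≡⟨ e₂ s k (2 ^ k) cross outer ⟩
    s + (cross + outer) + (k * k + k + 2 ^ k) ≡⟨ cong (_+ (k * k + k + 2 ^ k)) (sym ends-split) ⟩
    ends G + (k * k + k + 2 ^ k) ∎
    where
    open ≤-Reasoning
    -- `ends G` is s + cross + outer. At most k² of `s` runs inside `S` and the rest equals `cross`,
    -- while `outer` is at least n - k - 2^k.
    s cross outer : ℕ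
    out inn : Fin n → ℕ
    out x = ∑ λ y → 𝟙 (not (S y)) * 𝟙 (h x y)
    inn x = ∑ λ y → 𝟙 (S y) * 𝟙 (h x y)
    s = ∑ λ x → 𝟙 (S x) * d x
    cross = ∑ λ x → 𝟙 (not (S x)) * inn x
    outer = ∑ λ x → 𝟙 (not (S x)) * out x
    e₁ : ∀ s k t o → 2 * s + (k + t + o) ≡ s + s + (k + t + o)
    e₁ = solve-∀
    e₂ : ∀ s k t c o → s + (k * k + c) + (k + t + o) ≡ s + (c + o) + (k * k + k + t)
    e₂ = solve-∀
    d-split : ∀ x → d x ≡ inn x + out x
    d-split x = trans (∑-cong λ y → lem (S y) (𝟙 (h x y))) ∑-+
      where
      lem : ∀ t k → k ≡ 𝟙 t * k + 𝟙 (not t) * k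
      lem true k = sym (trans (+-identityʳ _) (+-identityʳ k))
      lem false k = sym (+-identityʳ k)
    ends-split : ends G ≡ s + (cross + outer)
    ends-split = trans (trans (∑-cong λ x → lem (S x) (d-split x)) ∑-+) (cong (s +_) ∑-+)
      where
      lem : ∀ t {k i o} → k ≡ i + o → k ≡ 𝟙 t * k + (𝟙 (not t) * i + 𝟙 (not t) * o)
      lem true {k} e = sym (trans (+-identityʳ _) (+-identityʳ k))
      lem false {i = i} {o} e = trans e (cong₂ _+_ (sym (+-identityʳ i)) (sym (+-identityʳ o)))
    cross-flip : ∑ (λ x → 𝟙 (S x) * out x) ≡ cross
    cross-flip = trans (∑-cong λ x → sym (∑-* (𝟙 (S x)))) (trans (∑-comm _) (∑-cong λ y →
      trans (∑-cong λ x → trans (cong (λ t → 𝟙 (S x) * (𝟙 (not (S y)) * 𝟙 t)) (symm G x y)) (e₃ (𝟙 (S x)) (𝟙 (not (S y))) (𝟙 (h y x)))) (∑-* (𝟙 (not (S y))))))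
      where
      e₃ : ∀ u v w → u * (v * w) ≡ v * (u * w)
      e₃ = solve-∀
    s≤ : s ≤ k * k + cross
    s≤ = begin
      s ≡⟨ trans (∑-cong λ x → trans (cong (𝟙 (S x) *_) (d-split x)) (*-distribˡ-+ (𝟙 (S x)) (inn x) (out x))) ∑-+ ⟩
      ∑ (λ x → 𝟙 (S x) * inn x) + ∑ (λ x → 𝟙 (S x) * out x) ≤⟨ +-mono-≤ (∑-mono λ x → ≤-trans (*-monoʳ-≤ (𝟙 (S x)) (inn≤ x)) (≤-reflexive (*-comm (𝟙 (S x)) k))) (≤-reflexive cross-flip) ⟩
      ∑ (λ x → k * 𝟙 (S x)) + cross ≡⟨ cong (_+ cross) (∑-* k) ⟩
      k * # S + cross ≤⟨ +-monoˡ-≤ cross (*-monoʳ-≤ k #S≤k) ⟩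
      k * k + cross ∎
      where
      inn≤ : ∀ x → inn x ≤ k
      inn≤ x = ≤-trans (∑-mono λ y → ≤-trans (≤-reflexive (*-comm (𝟙 (S y)) _)) (𝟙*≤ (h x y) _)) #S≤k
    -- Outside `S` and without neighbours outside `S`: such vertices are pairwise nonadjacent, so
    -- two with the same pattern on `S` would be twins.
    lonely : Fin n → Bool
    lonely x = not (S x) ∧ ⌊ out x ℕ.≟ 0 ⌋
    lonely-true : ∀ x → lonely x ≡ true → S x ≡ false × out x ≡ 0
    lonely-true x e with S x | out x ℕ.≟ 0
    lonely-true x e | false | yes p = refl , p
    lonely-none : ∀ x → lonely x ≡ true → ∀ z → S z ≡ false → h x z ≡ false
    lonely-none x e z Sz = Boolₚ.¬-not λ q → case ≤-trans (≤-trans (≤-reflexive (cong₂ (λ t u → 𝟙 (not t) * 𝟙 u) (sym Sz) (sym q))) (term≤∑ (λ y → 𝟙 (not (S y)) * 𝟙 (h x y)) z))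
                             (≤-reflexive (proj₂ (lonely-true x e))) of λ ()
    #lonely : # lonely ≤ 2 ^ k
    #lonely = ≤-trans (#-patterns h (elements S) lonely sep) (^-monoʳ-≤ 2 (≤-trans (≤-reflexive (length-elements S)) #S≤k))
      where
      sep : ∀ x y → lonely x ≡ true → lonely y ≡ true → x ≢ y → (∀ t → t ∈ elements S → h x t ≡ h y t) → ⊥
      sep x y e e' x≢y same = no-twins x y x≢y (lonely-none x e y (proj₁ (lonely-true y e'))) agree
        where
        agree : ∀ z → h x z ≡ h y z
        agree z with S z in Sz
        ... | true = same z (∈-elements S Sz)
        ... | false = trans (lonely-none x e z Sz) (sym (lonely-none y e' z Sz))
    n≤ : n ≤ k + 2 ^ k + outer
    n≤ = begin
      n ≡⟨ sym (trans (∑-const n 1) (*-identityʳ n)) ⟩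
      ∑ {n} (λ _ → 1) ≤⟨ ∑-mono pointwise ⟩
      ∑ (λ x → 𝟙 (S x) + 𝟙 (lonely x) + 𝟙 (not (S x)) * out x) ≡⟨ trans ∑-+ (cong (_+ outer) ∑-+) ⟩
      # S + # lonely + outer ≤⟨ +-monoˡ-≤ outer (+-mono-≤ #S≤k #lonely) ⟩
      k + 2 ^ k + outer ∎
      where
      pointwise : ∀ x → 1 ≤ 𝟙 (S x) + 𝟙 (lonely x) + 𝟙 (not (S x)) * out x
      pointwise x with S x | out x ℕ.≟ 0
      ... | true | _ = s≤s z≤n
      ... | false | yes _ = s≤s z≤n
      ... | false | no p = ≤-trans (n≢0⇒n>0 p) (≤-reflexive (sym (+-identityʳ (out x))))

-- The arithmetic of the lower bound

-- L ≤ R yields A ≤ B once A + R plus a nonnegative slack is B + L.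
from-sum : ∀ {A B L R} s → L ≤ R → A + R + s ≡ B + L → A ≤ B
from-sum {A} {B} {L} {R} s L≤R e = +-cancelʳ-≤ R A B (≤-trans (m≤m+n (A + R) s) (≤-trans (≤-reflexive e) (+-monoʳ-≤ B L≤R)))

infixr 5 _⊕_
_⊕_ : ∀ {i j k l} → i ≤ j → k ≤ l → i + k ≤ j + l
_⊕_ = +-mono-≤

order : ℕ → ℕ → ℕ
order M p = 2 * M + 1 + p

-- For n = order M p with p ≤ 1, M is the largest degree allowed by switching, and the f with
-- f + deficit M p = n² + 5 is the claimed minimal number of triples outside a hypercut.
deficit : ℕ → ℕ → ℕ
deficit M p = M * M + 3 * M + 3 * p + 3 * order M p

-- In the next lemmas dc is the maximal degree, q = M − dc, e = n − 2 + r the number of edges and sq the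
-- sum of the squared degrees; the conclusions say sq + f ≤ n e, up to the slack that triangles provide.
-- Here s is the degree sum over vertices of degree above t and x the degree of a second large vertex.
arith-two-hubs : ∀ p r q e dc s K t x sq → p ≤ 1 → e + 2 ≡ order (dc + q) p + r →
  2 * s + order (dc + q) p ≤ 2 * e + K → x + dc ≤ s → sq ≤ dc * s + t * (2 * e) →
  dc + q + 1 ≤ 12 * x + 2 → 200 * t ≤ dc + q → K ≤ t → 1 ≤ t →
  sq + (order (dc + q) p * order (dc + q) p + 5) ≤ order (dc + q) p * e + deficit (dc + q) p
arith-two-hubs p r q e dc s K t x sq p≤1 ee H1 H2 H3 H4 H5 H6 1≤t = *-cancelˡ-≤ 2 A6
  where
  M = dc + q
  n = order M p
  e≤ : e + 2 ≤ n + r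
  e≤ = ≤-reflexive ee
  8≤M : 8 ≤ M
  8≤M = ≤-trans (≤-trans (m≤m+n 8 192) (*-monoʳ-≤ 200 1≤t)) H5
  -- Halved, this bounds all large degrees together by about n/2 + r.
  A1 : 2 * s + 4 ≤ n + 2 * r + K
  A1 = from-sum 0 (H1 ⊕ *-monoʳ-≤ 2 e≤) (id₁ dc q p r e s K)
    where
    id₁ : ∀ dc q p r e s K → 2 * s + 4 + (2 * e + K + 2 * ((2 * (dc + q) + 1 + p) + r)) + 0 ≡ (2 * (dc + q) + 1 + p) + 2 * r + K + (2 * s + (2 * (dc + q) + 1 + p) + 2 * (e + 2))
    id₁ = solve-∀
  A2 : 2 * x + 2 ≤ 2 * q + 2 * r + K
  A2 = from-sum 0 (A1 ⊕ *-monoʳ-≤ 2 H2 ⊕ p≤1) (id₂ dc q p r s K x)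
    where
    id₂ : ∀ dc q p r s K x → 2 * x + 2 + ((2 * (dc + q) + 1 + p) + 2 * r + K + (2 * s + 1)) + 0 ≡ 2 * q + 2 * r + K + (2 * s + 4 + (2 * (x + dc) + p))
    id₂ = solve-∀
  -- By `A2` the second hub must fit into q + r + K/2, yet `x` is at least about M/12, which exceeds
  -- 16 t. So q + r outweighs the error terms below.
  A3 : K + 12 * t ≤ q + r
  A3 = *-cancelˡ-≤ 12 (from-sum (11 + 38 * t) (*-monoʳ-≤ 6 A2 ⊕ H4 ⊕ H5 ⊕ *-monoʳ-≤ 18 H6) (id₃ dc q r K x t))
    where
    id₃ : ∀ dc q r K x t → 12 * (K + 12 * t) + (6 * (2 * q + 2 * r + K) + (12 * x + 2 + (dc + q + 18 * t))) + (11 + 38 * t) ≡ 12 * (q + r) + (6 * (2 * x + 2) + (dc + q + 1 + (200 * t + 18 * K)))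
    id₃ = solve-∀
  A4 : 2 * s ≤ 2 * M + 2 * r + K
  A4 = from-sum 2 (A1 ⊕ p≤1) (id₄ dc q p r s K)
    where
    id₄ : ∀ dc q p r s K → 2 * s + ((2 * (dc + q) + 1 + p) + 2 * r + K + 1) + 2 ≡ 2 * (dc + q) + 2 * r + K + (2 * s + 4 + p)
    id₄ = solve-∀
  n≤3M : n ≤ 3 * M
  n≤3M = from-sum 0 (≤-trans (m≤m+n 2 6) 8≤M ⊕ p≤1) (id₅ dc q p)
    where
    id₅ : ∀ dc q p → (2 * (dc + q) + 1 + p) + (dc + q + 1) + 0 ≡ 3 * (dc + q) + (2 + p)
    id₅ = solve-∀
  4t≤M : 4 * t ≤ M
  4t≤M = ≤-trans (*-monoˡ-≤ t (m≤m+n 4 196)) H5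
  -- The errors, dc K from `A4` and 4 t e from the small degrees, are paid for by M (q + r) via `A3`
  -- and one further M r.
  A5 : 2 * sq + q * M ≤ 2 * (M * M) + 4 * (M * r)
  A5 = from-sum (K * q + 2 * (q * r))
    (*-monoʳ-≤ 2 H3 ⊕ *-monoʳ-≤ dc A4 ⊕ *-monoʳ-≤ (4 * t) (≤-trans (m≤m+n e 2) e≤) ⊕ *-monoʳ-≤ (4 * t) n≤3M ⊕ *-monoˡ-≤ r 4t≤M ⊕ *-monoʳ-≤ M A3)
    (id₆ dc q r e s K sq t n)
    where
    id₆ : ∀ dc q r e s K sq t n →
      2 * sq + q * (dc + q) + (2 * (dc * s + t * (2 * e)) + (dc * (2 * (dc + q) + 2 * r + K) + (4 * t * (n + r) + (4 * t * (3 * (dc + q)) + ((dc + q) * r + (dc + q) * (q + r)))))) + (K * q + 2 * (q * r))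
      ≡ 2 * ((dc + q) * (dc + q)) + 4 * ((dc + q) * r) + (2 * sq + (dc * (2 * s) + (4 * t * e + (4 * t * n + (4 * t * r + (dc + q) * (K + 12 * t))))))
    id₆ = solve-∀
  A6 : 2 * (sq + (n * n + 5)) ≤ 2 * (n * e + deficit M p)
  A6 = from-sum (9 * dc + dc * q + 8 * p + 2 * (p * r) + 9 * q + q * q + 2 * r)
    (A5 ⊕ *-monoʳ-≤ (2 * n) (≤-reflexive (sym ee)) ⊕ 8≤M) (id₇ dc q p r e sq)
    where
    id₇ : ∀ dc q p r e sq →
      2 * (sq + ((2 * (dc + q) + 1 + p) * (2 * (dc + q) + 1 + p) + 5)) + (2 * ((dc + q) * (dc + q)) + 4 * ((dc + q) * r) + (2 * (2 * (dc + q) + 1 + p) * (e + 2) + (dc + q))) + (9 * dc + dc * q + 8 * p + 2 * (p * r) + 9 * q + q * q + 2 * r)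
      ≡ 2 * ((2 * (dc + q) + 1 + p) * e + ((dc + q) * (dc + q) + 3 * (dc + q) + 3 * p + 3 * (2 * (dc + q) + 1 + p))) + (2 * sq + q * (dc + q) + (2 * (2 * (dc + q) + 1 + p) * ((2 * (dc + q) + 1 + p) + r) + 8))
    id₇ = solve-∀

-- Y sums, over the vertices other than the centre, the excess over 1 of the number of neighbours other
-- than the centre; I counts the vertices without such neighbours.
arith-one-hub : ∀ p r q e dc sq Y I → p ≤ 1 → e + 2 ≡ order (dc + q) p + r →
  order (dc + q) p + Y + dc + dc ≡ 1 + 2 * e + I → I ≤ 2 → 1 ≤ r + q → 6 ≤ dc + q →
  6 * sq + 6 * dc ≤ 6 * (dc * dc) + 12 * e + 12 * dc + (dc + q) * Y →
  sq + (order (dc + q) p * order (dc + q) p + 5) ≤ order (dc + q) p * e + deficit (dc + q) p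
arith-one-hub p r q e dc sq Y I p≤1 ee HY I≤2 1≤rq 6≤M HS = *-cancelˡ-≤ 6 B2
  where
  M = dc + q
  n = order M p
  -- `HY` amounts to Y = 2 (r + q) + p + I - 2, which is at most 2 (r + q) + 1.
  B1 : Y ≤ 3 * (r + q)
  B1 = from-sum 0 (≤-reflexive HY ⊕ I≤2 ⊕ *-monoʳ-≤ 2 (≤-reflexive ee) ⊕ p≤1 ⊕ 1≤rq) (id₁ dc q p r e Y I)
    where
    id₁ : ∀ dc q p r e Y I → Y + (1 + 2 * e + I + (2 + (2 * ((2 * (dc + q) + 1 + p) + r) + (1 + (r + q))))) + 0 ≡ 3 * (r + q) + ((2 * (dc + q) + 1 + p) + Y + dc + dc + (I + (2 * (e + 2) + (p + 1))))
    id₁ = solve-∀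
  B2 : 6 * (sq + (n * n + 5)) ≤ 6 * (n * e + deficit M p)
  B2 = from-sum (6 * (dc * q) + 6 * (dc * r) + 12 * p + 6 * (p * r) + 12 * q + 6 * (q * r))
    (HS ⊕ *-monoʳ-≤ M B1 ⊕ *-monoʳ-≤ (6 * n) (≤-reflexive (sym ee)) ⊕ *-monoʳ-≤ 12 (≤-reflexive ee) ⊕ *-monoʳ-≤ 3 (*-monoˡ-≤ (r + q) 6≤M) ⊕ *-monoʳ-≤ 12 1≤rq)
    (id₂ dc q p r e Y sq)
    where
    id₂ : ∀ dc q p r e Y sq →
      6 * (sq + ((2 * (dc + q) + 1 + p) * (2 * (dc + q) + 1 + p) + 5)) + (6 * (dc * dc) + 12 * e + 12 * dc + (dc + q) * Y + ((dc + q) * (3 * (r + q)) + (6 * (2 * (dc + q) + 1 + p) * (e + 2) + (12 * ((2 * (dc + q) + 1 + p) + r) + (3 * ((dc + q) * (r + q)) + 12 * (r + q))))))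
        + (6 * (dc * q) + 6 * (dc * r) + 12 * p + 6 * (p * r) + 12 * q + 6 * (q * r))
      ≡ 6 * ((2 * (dc + q) + 1 + p) * e + ((dc + q) * (dc + q) + 3 * (dc + q) + 3 * p + 3 * (2 * (dc + q) + 1 + p))) + (6 * sq + 6 * dc + ((dc + q) * Y + (6 * (2 * (dc + q) + 1 + p) * ((2 * (dc + q) + 1 + p) + r) + (12 * (e + 2) + (3 * (6 * (r + q)) + 12 * 1)))))
    id₂ = solve-∀

module _ (p e M sq Y I Z Lf : ℕ) (ee : e + 2 ≡ order M p) (HY : order M p + Y + M + M ≡ 1 + 2 * e + I)
         (I≤ : I ≤ Z + Lf) (Z≤1 : Z ≤ 1) where
  private
    n = order M p

  -- In this exact range `HY` reads Y + 2 = p + I.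
  arith-surplus : Y + 1 ≤ p + Lf
  arith-surplus = from-sum 0 (≤-reflexive HY ⊕ I≤ ⊕ *-monoʳ-≤ 2 (≤-reflexive ee) ⊕ Z≤1) (id₁ p e M Y I Z Lf)
    where
    id₁ : ∀ p e M Y I Z Lf → Y + 1 + (1 + 2 * e + I + (Z + Lf + (2 * (2 * M + 1 + p) + 1))) + 0 ≡ p + Lf + ((2 * M + 1 + p) + Y + M + M + (I + (2 * (e + 2) + Z)))
    id₁ = solve-∀

  arith-tight : sq + 2 * Lf + M ≤ M * M + 2 * e + 2 * M + 2 * Y → sq + (n * n + 5) ≤ n * e + deficit M p
  arith-tight HS = from-sum 0 (HS ⊕ *-monoʳ-≤ 2 arith-surplus ⊕ *-monoʳ-≤ 2 (≤-reflexive ee) ⊕ *-monoʳ-≤ n (≤-reflexive (sym ee))) (id₂ p e M sq Y Lf)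
    where
    id₂ : ∀ p e M sq Y Lf → sq + ((2 * M + 1 + p) * (2 * M + 1 + p) + 5) + (M * M + 2 * e + 2 * M + 2 * Y + (2 * (p + Lf) + (2 * (2 * M + 1 + p) + (2 * M + 1 + p) * (e + 2)))) + 0
      ≡ (2 * M + 1 + p) * e + (M * M + 3 * M + 3 * p + 3 * (2 * M + 1 + p)) + (sq + 2 * Lf + M + (2 * (Y + 1) + (2 * (e + 2) + (2 * M + 1 + p) * (2 * M + 1 + p))))
    id₂ = solve-∀

  -- The coefficient 4 of `Y`, in place of 2, costs at most 2, to be repaid by a triangle.
  arith-tight-△ : Lf ≤ 1 → p ≤ 1 → sq + 2 * Lf + M ≤ M * M + 2 * e + 2 * M + 4 * Y → sq + (n * n + 5) ≤ n * e + deficit M p + 2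
  arith-tight-△ Lf≤1 p≤1 HS = from-sum 0 (HS ⊕ *-monoʳ-≤ 4 arith-surplus ⊕ *-monoʳ-≤ 2 (≤-reflexive ee) ⊕ *-monoʳ-≤ n (≤-reflexive (sym ee)) ⊕ *-monoʳ-≤ 2 Lf≤1 ⊕ *-monoʳ-≤ 2 p≤1) (id₃ p e M sq Y Lf)
    where
    id₃ : ∀ p e M sq Y Lf → sq + ((2 * M + 1 + p) * (2 * M + 1 + p) + 5) + (M * M + 2 * e + 2 * M + 4 * Y + (4 * (p + Lf) + (2 * (2 * M + 1 + p) + ((2 * M + 1 + p) * (e + 2) + (2 + 2))))) + 0
      ≡ (2 * M + 1 + p) * e + (M * M + 3 * M + 3 * p + 3 * (2 * M + 1 + p)) + 2 + (sq + 2 * Lf + M + (4 * (Y + 1) + (2 * (e + 2) + ((2 * M + 1 + p) * (2 * M + 1 + p) + (2 * Lf + 2 * p)))))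
    id₃ = solve-∀

-- A defect `k` in the main inequality becomes 6k after multiplication by 6, and the term 4 tri of
-- the counting identity covers it.
arith-final : ∀ {f od sq n e T u tri} k → od + 6 * sq ≡ 3 * (n * u) + 4 * tri → 2 * e ≡ u → f + T ≡ n * n + 5 →
  sq + (n * n + 5) ≤ n * e + T + k → 3 * k ≤ 2 * tri → 6 * f ≤ od
arith-final {f} {od} {sq} {n} {e} {T} {_} {tri} k odds refl fT main tri≥ =
  from-sum 0 (+-mono-≤ (*-monoʳ-≤ 6 (≤-trans (≤-reflexive (cong (sq +_) fT)) main)) (+-mono-≤ (≤-reflexive (sym odds)) (*-monoʳ-≤ 2 tri≥))) (id₁ f od sq (n * e) T k tri (n * (2 * e)) (id₀ n e))
  where
  id₀ : ∀ n e → n * (2 * e) ≡ 2 * (n * e)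
  id₀ = solve-∀
  id₁ : ∀ f od sq w T k tri v → v ≡ 2 * w → 6 * f + (6 * (w + T + k) + (od + 6 * sq + 2 * (2 * tri))) + 0 ≡ od + (6 * (sq + (f + T)) + (3 * v + 4 * tri + 2 * (3 * k)))
  id₁ f od sq w T k tri _ refl = id₂ f od sq w T k tri
    where
    id₂ : ∀ f od sq w T k tri → 6 * f + (6 * (w + T + k) + (od + 6 * sq + 2 * (2 * tri))) + 0 ≡ od + (6 * (sq + (f + T)) + (3 * (2 * w) + 4 * tri + 2 * (3 * k)))
    id₂ = solve-∀

-- The lower bound for the complement of a hypercut

module _ {n : ℕ} (c : Fin n) where

  ∑′ : (Fin n → ℕ) → ℕ
  ∑′ f = ∑ λ x → 𝟙 (not (c == x)) * f x

  ∑′-split : ∀ f → ∑ f ≡ f c + ∑′ f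
  ∑′-split f = trans (∑-cong λ x → lem (c == x) (f x)) (trans ∑-+ (cong (_+ ∑′ f) (∑-δ c f)))
    where
    lem : ∀ t k → k ≡ 𝟙 t * k + 𝟙 (not t) * k
    lem true k = sym (trans (+-identityʳ _) (+-identityʳ k))
    lem false k = sym (+-identityʳ k)

  ∑′-+ : ∀ {f g} → ∑′ (λ x → f x + g x) ≡ ∑′ f + ∑′ g
  ∑′-+ {f} {g} = trans (∑-cong λ x → *-distribˡ-+ (𝟙 (not (c == x))) (f x) (g x)) ∑-+

  ∑′-* : ∀ k {f} → ∑′ (λ x → k * f x) ≡ k * ∑′ f
  ∑′-* k {f} = trans (∑-cong λ x → swap (𝟙 (not (c == x))) k (f x)) (∑-* k)
    where
    swap : ∀ a b c → a * (b * c) ≡ b * (a * c)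
    swap = solve-∀

  ∑′-mono : ∀ {f g : Fin n → ℕ} → (∀ x → c ≢ x → f x ≤ g x) → ∑′ f ≤ ∑′ g
  ∑′-mono {f} {g} le = ∑-mono pointwise
    where
    pointwise : ∀ x → 𝟙 (not (c == x)) * f x ≤ 𝟙 (not (c == x)) * g x
    pointwise x with c ≟ x
    ... | yes _ = z≤n
    ... | no p = +-monoˡ-≤ 0 (le x p)

  ∑′-cong : ∀ {f g : Fin n → ℕ} → (∀ x → c ≢ x → f x ≡ g x) → ∑′ f ≡ ∑′ g
  ∑′-cong e = ≤-antisym (∑′-mono λ x p → ≤-reflexive (e x p)) (∑′-mono λ x p → ≤-reflexive (sym (e x p)))

  ∑′-vanish : ∀ f → f c ≡ 0 → ∑′ f ≡ ∑ f
  ∑′-vanish f e = sym (trans (∑′-split f) (cong (_+ ∑′ f) e))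

module _ {n : ℕ} (G : Graph n) (no-trans : NoTransversal G) (3≤n : 3 ≤ n)
         (c : Fin n) (p M : ℕ) (p≤1 : p ≤ 1) (n≡ : n ≡ order M p)
         (max : ∀ x → deg G x ≤ deg G c) (d≤M : ∀ x → deg G x ≤ M) where

  private
    h : Fin n → Fin n → Bool
    h = adj G
    d : Fin n → ℕ
    d = deg G
    e q r : ℕ
    e = length (edges G)
    q = M ∸ d c
    r = e + 2 ∸ n

    M≡ : M ≡ d c + q
    M≡ = sym (m+[n∸m]≡n (d≤M c))
    ee : e + 2 ≡ order M p + r
    ee = trans (sym (m+[n∸m]≡n (many-edges G no-trans 3≤n))) (cong (_+ r) n≡)
    2e : 2 * e ≡ ends G
    2e = two-edges G

    Goal : ℕ → Set
    Goal k = squares G + (n * n + 5) ≤ n * e + deficit M p + k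

    weaken : squares G + (order M p * order M p + 5) ≤ order M p * e + deficit M p → Goal 0
    weaken g = ≤-trans (subst (λ n → squares G + (n * n + 5) ≤ n * e + deficit M p) (sym n≡) g) (≤-reflexive (sym (+-identityʳ _)))

    α y i : Fin n → ℕ
    α x = 𝟙 (h x c)
    -- Truncation gives 0 also when d x = α x. Exactly then x is isolated or a leaf at `c`, and
    -- `i x` restores the missing 1.
    y x = d x ∸ α x ∸ 1
    i x = 𝟙 (isolated G x) + 𝟙 (leaf G c x)
    Y I Z Lf : ℕ
    Y = ∑′ c y
    I = ∑′ c i
    Z = # (isolated G)
    Lf = # (leaf G c)

    Z≤1 : Z ≤ 1
    Z≤1 = #isolated≤1 G no-trans 3≤n
    Lf≤1 : Lf ≤ 1
    Lf≤1 = #leaf≤1 G no-trans 3≤n c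
    I≤ : I ≤ Z + Lf
    I≤ = ≤-trans (∑-mono λ x → 𝟙*≤ (not (c == x)) (i x)) (≤-reflexive ∑-+)

    ∑′α : ∑′ c α ≡ d c
    ∑′α = trans (∑′-vanish c α (cong 𝟙 (irrefl G c))) (∑-cong λ x → cong 𝟙 (symm G x c))
    ∑′d : d c + ∑′ c d ≡ 2 * e
    ∑′d = trans (sym (∑′-split c d)) (sym 2e)
    ∑′leaf : ∑′ c (λ x → 𝟙 (leaf G c x)) ≡ Lf
    ∑′leaf = ∑′-vanish c _ (cong (λ t → 𝟙 (t ∧ ⌊ d c ℕ.≟ 1 ⌋)) (irrefl G c))

    α≤d : ∀ x → α x ≤ d x
    α≤d x = term≤∑ (λ y → 𝟙 (h x y)) c

    -- The identity `1 + y x + α x ≡ d x + i x` is summed over the vertices other than `c`, where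
    -- the values of `α` add up to `d c`.
    HY : n + Y + d c + d c ≡ 1 + 2 * e + I
    HY = begin
      n + Y + d c + d c ≡⟨ cong (λ k → k + Y + d c + d c) (trans (sym (trans (∑-const n 1) (*-identityʳ n))) (∑′-split c (λ _ → 1))) ⟩
      1 + ∑′ c (λ _ → 1) + Y + d c + d c ≡⟨ cong (λ k → 1 + ∑′ c (λ _ → 1) + Y + k + d c) (sym ∑′α) ⟩
      1 + ∑′ c (λ _ → 1) + Y + ∑′ c α + d c ≡⟨ re₁ (∑′ c (λ _ → 1)) Y (∑′ c α) (d c) ⟩
      1 + (d c + (∑′ c (λ _ → 1) + Y + ∑′ c α)) ≡⟨ cong (λ k → 1 + (d c + k)) (sym (trans (∑′-+ c) (cong (_+ ∑′ c α) (∑′-+ c)))) ⟩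
      1 + (d c + ∑′ c (λ x → 1 + y x + α x)) ≡⟨ cong (λ k → 1 + (d c + k)) (trans (∑′-cong c λ x _ → pointwise x) (∑′-+ c)) ⟩
      1 + (d c + (∑′ c d + I)) ≡⟨ cong suc (trans (sym (+-assoc (d c) _ _)) (cong (_+ I) ∑′d)) ⟩
      1 + 2 * e + I ∎
      where
      open ≡-Reasoning
      re₁ : ∀ a b c d → 1 + a + b + c + d ≡ 1 + (d + (a + b + c))
      re₁ = solve-∀
      pointwise : ∀ x → 1 + y x + α x ≡ d x + i x
      pointwise x with d x | h x c | α≤d x
      ... | zero | false | _ = refl
      ... | zero | true | ()
      ... | suc zero | false | _ = refl
      ... | suc zero | true | _ = refl
      ... | suc (suc k) | false | _ = refl
      ... | suc (suc k) | true | _ = trans (+-comm (suc k) 1) (sym (+-identityʳ _))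

    squares-split : squares G ≡ d c * d c + ∑′ c (λ x → d x * d x)
    squares-split = ∑′-split c (λ x → d x * d x)

    two-hubs : ∀ k K t → K ≡ k * k + k + 2 ^ k → k ≡ 7200 → ends G ≤ 6 * n → 200 * t ≤ M → M ≤ 200 * t + 200 → K ≤ t → 1 ≤ t →
      ∀ x → c ≢ x → M + 1 ≤ 12 * d x + 2 → Goal 0
    two-hubs k K t refl k≡ E≤ t≤ ≤t K≤t 1≤t x c≢x big = weaken (subst (λ M → squares G + (order M p * order M p + 5) ≤ order M p * e + deficit M p) (sym M≡)
      (arith-two-hubs p r q e (d c) s K t (d x) (squares G) p≤1 (trans ee (cong (λ M → order M p + r) M≡)) H1 H2 H3
        (subst (λ M → M + 1 ≤ 12 * d x + 2) M≡ big) (subst (200 * t ≤_) M≡ t≤) K≤t 1≤t))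
      where
      S : Fin n → Bool
      S z = ⌊ suc t ℕ.≤? d z ⌋
      S-true : ∀ {z} → suc t ≤ d z → S z ≡ true
      S-true {z} le with suc t ℕ.≤? d z
      ... | yes _ = refl
      ... | no q = ⊥-elim (q le)
      s : ℕ
      s = ∑ λ z → 𝟙 (S z) * d z
      t<dx : suc t ≤ d x
      t<dx = *-cancelˡ-≤ 12 (from-sum 175 (big ⊕ t≤ ⊕ *-monoʳ-≤ 188 1≤t) (id₁ M (d x) t))
        where
        id₁ : ∀ M x t → 12 * suc t + (12 * x + 2 + (M + 188 * t)) + 175 ≡ 12 * x + (M + 1 + (200 * t + 188))
        id₁ = solve-∀
      -- Members of `S` have degree above t, so t |S| is at most the degree sum, and 6n ≤ 12 M + 12
      -- ≤ 4812 t; 7200 leaves room.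
      #S≤k : # S ≤ k
      #S≤k = *-cancelˡ-≤ t {{ℕ.>-nonZero 1≤t}} (begin
        t * # S ≡⟨ sym (∑-* t) ⟩
        ∑ (λ z → t * 𝟙 (S z)) ≤⟨ ∑-mono pointwise ⟩
        ends G ≤⟨ E≤ ⟩
        6 * n ≡⟨ cong (6 *_) n≡ ⟩
        6 * order M p ≤⟨ from-sum (2388 * t) (*-monoʳ-≤ 6 p≤1 ⊕ *-monoʳ-≤ 12 ≤t ⊕ *-monoʳ-≤ 2400 1≤t ⊕ *-monoʳ-≤ 12 1≤t) (id₂ M p t) ⟩
        t * 7200 ≡⟨ cong (t *_) (sym k≡) ⟩
        t * k ∎)
        where
        open ≤-Reasoning
        id₂ : ∀ M p t → 6 * (2 * M + 1 + p) + (6 + (12 * (200 * t + 200) + (2400 * t + 12 * t))) + 2388 * t ≡ t * 7200 + (6 * p + (12 * M + (2400 + 12)))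
        id₂ = solve-∀
        pointwise : ∀ z → t * 𝟙 (S z) ≤ d z
        pointwise z with suc t ℕ.≤? d z
        ... | yes le = ≤-trans (≤-reflexive (*-identityʳ t)) (<⇒≤ le)
        ... | no _ = ≤-trans (≤-reflexive (*-zeroʳ t)) z≤n
      H1 : 2 * s + order (d c + q) p ≤ 2 * e + K
      H1 = subst₂ _≤_ (cong (2 * s +_) (trans n≡ (cong (λ M → order M p) M≡))) (cong (_+ K) (sym 2e)) (high-degrees G no-trans 3≤n S k #S≤k)
      H2 : d x + d c ≤ s
      H2 = ≤-trans (≤-reflexive (sym (cong₂ _+_ (keep t<dx) (keep (≤-trans t<dx (max x)))))) (two-terms≤∑ (λ z → 𝟙 (S z) * d z) (c≢x ∘ sym))
        where
        keep : ∀ {z} → suc t ≤ d z → 𝟙 (S z) * d z ≡ d z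
        keep {z} le = trans (cong (λ b → 𝟙 b * d z) (S-true le)) (+-identityʳ (d z))
      H3 : squares G ≤ d c * s + t * (2 * e)
      H3 = ≤-trans (∑-mono pointwise) (≤-reflexive (trans ∑-+ (cong₂ _+_ (∑-* (d c)) (trans (∑-* t) (cong (t *_) (sym 2e))))))
        where
        pointwise : ∀ z → d z * d z ≤ d c * (𝟙 (S z) * d z) + t * d z
        pointwise z with suc t ℕ.≤? d z
        ... | yes _ = ≤-trans (*-mono-≤ (max z) (≤-reflexive (sym (+-identityʳ (d z))))) (m≤m+n _ _)
        ... | no q = ≤-trans (*-monoˡ-≤ (d z) (ℕ.s≤s⁻¹ (≰⇒> q))) (m≤n+m _ _)

    one-hub : (∀ x → c ≢ x → 12 * d x + 2 ≤ M) → 1 ≤ r + q → 6 ≤ M → Goal 0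
    one-hub small 1≤rq 6≤M = weaken (subst (λ M → squares G + (order M p * order M p + 5) ≤ order M p * e + deficit M p) (sym M≡)
      (arith-one-hub p r q e (d c) (squares G) Y I p≤1 (trans ee (cong (λ M → order M p + r) M≡))
        (trans (cong (λ k → k + Y + d c + d c) (sym (trans n≡ (cong (λ M → order M p) M≡)))) HY)
        (≤-trans I≤ (+-mono-≤ Z≤1 Lf≤1)) 1≤rq (subst (6 ≤_) M≡ 6≤M) (subst (λ M → 6 * squares G + 6 * d c ≤ 6 * (d c * d c) + 12 * e + 12 * d c + M * Y) M≡ HS)))
      where
      -- If y = 0, then d ≤ 1 + α and the first two terms suffice; beyond that, 12 d + 2 ≤ M lets
      -- `M * y x` dominate the growth of 6 d².
      pointwise : ∀ x → c ≢ x → 6 * (d x * d x) ≤ 6 * d x + 12 * α x + M * y x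
      pointwise x c≢x with d x | h x c | small x c≢x
      ... | zero | _ | _ = z≤n
      ... | suc zero | t | _ = ≤-trans (m≤m+n 6 (12 * 𝟙 t)) (m≤m+n (6 + 12 * 𝟙 t) (M * (1 ∸ 𝟙 t ∸ 1)))
      ... | suc (suc k) | false | sm = from-sum (6 * k * (1 + k) + 14 * (1 + k)) (*-monoˡ-≤ (1 + k) sm) (id₁ k M)
        where
        id₁ : ∀ k M → 6 * ((2 + k) * (2 + k)) + M * (1 + k) + (6 * k * (1 + k) + 14 * (1 + k)) ≡ 6 * (2 + k) + 0 + M * (1 + k) + (12 * (2 + k) + 2) * (1 + k)
        id₁ = solve-∀
      ... | suc (suc k) | true | sm = from-sum (6 * k * k + 8 * k) (*-monoˡ-≤ k sm) (id₁ k M)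
        where
        id₁ : ∀ k M → 6 * ((2 + k) * (2 + k)) + M * k + (6 * k * k + 8 * k) ≡ 6 * (2 + k) + 12 + M * k + (12 * (2 + k) + 2) * k
        id₁ = solve-∀
      sum-up : 6 * ∑′ c (λ x → d x * d x) ≤ 6 * ∑′ c d + 12 * d c + M * Y
      sum-up = ≤-trans (≤-reflexive (sym (∑′-* c 6))) (≤-trans (∑′-mono c pointwise)
        (≤-reflexive (trans (∑′-+ c) (cong₂ _+_ (trans (∑′-+ c) (cong₂ _+_ (∑′-* c 6) (trans (∑′-* c 12) (cong (12 *_) ∑′α)))) (∑′-* c M)))))
      HS : 6 * squares G + 6 * d c ≤ 6 * (d c * d c) + 12 * e + 12 * d c + M * Y
      HS = ≤-trans (≤-reflexive (cong (λ k → 6 * k + 6 * d c) squares-split))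
        (from-sum 0 (sum-up ⊕ *-monoʳ-≤ 6 (≤-reflexive ∑′d)) (id₂ (d c) (∑′ c (λ x → d x * d x)) (∑′ c d) e (M * Y)))
        where
        id₂ : ∀ a b w e v → 6 * (a * a + b) + 6 * a + (6 * w + 12 * a + v + 6 * (2 * e)) + 0 ≡ 6 * (a * a) + 12 * e + 12 * a + v + (6 * b + 6 * (a + w))
        id₂ = solve-∀

    module _ (r≡0 : r ≡ 0) (q≡0 : q ≡ 0) where

      d≡M : d c ≡ M
      d≡M = sym (trans M≡ (trans (cong (d c +_) q≡0) (+-identityʳ (d c))))
      ee₀ : e + 2 ≡ order M p
      ee₀ = trans ee (trans (cong (order M p +_) r≡0) (+-identityʳ _))
      HY₀ : order M p + Y + M + M ≡ 1 + 2 * e + I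
      HY₀ = trans (cong₂ (λ n m → n + Y + m + m) (sym n≡) (sym d≡M)) HY

      -- So at most one vertex other than `c` has two neighbours besides `c`, and none has three.
      Y≤1 : Y ≤ 1
      Y≤1 = +-cancelʳ-≤ 1 Y 1 (≤-trans (arith-surplus p e M 0 Y I Z Lf ee₀ HY₀ I≤ Z≤1) (+-mono-≤ p≤1 Lf≤1))
      y-term : ∀ x → c ≢ x → 𝟙 (not (c == x)) * y x ≡ y x
      y-term x c≢x = trans (cong (λ t → 𝟙 (not t) * y x) (≢⇒== c≢x)) (+-identityʳ (y x))
      y≤Y : ∀ x → c ≢ x → y x ≤ Y
      y≤Y x c≢x = ≤-trans (≤-reflexive (sym (y-term x c≢x))) (term≤∑ (λ x → 𝟙 (not (c == x)) * y x) x)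
      y≤1 : ∀ x → c ≢ x → y x ≤ 1
      y≤1 x c≢x = ≤-trans (y≤Y x c≢x) Y≤1

      sum-up : ∀ k → (∀ x → c ≢ x → d x * d x + 2 * 𝟙 (leaf G c x) ≤ d x + 2 * α x + k * y x) →
        squares G + 2 * Lf + M ≤ M * M + 2 * e + 2 * M + k * Y
      sum-up k pointwise = ≤-trans (≤-reflexive (trans (cong (λ u → u + 2 * Lf + M) squares-split) (cong₂ (λ m l → m * m + ∑′ c (λ x → d x * d x) + 2 * l + M) d≡M (sym ∑′leaf))))
        (from-sum 0 (summed ⊕ ≤-reflexive (trans (cong (_+ ∑′ c d) (sym d≡M)) ∑′d)) (id₁ M (∑′ c (λ x → d x * d x)) (∑′ c (λ x → 𝟙 (leaf G c x))) (∑′ c d) e (k * Y)))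
        where
        summed : ∑′ c (λ x → d x * d x) + 2 * ∑′ c (λ x → 𝟙 (leaf G c x)) ≤ ∑′ c d + 2 * M + k * Y
        summed = ≤-trans (≤-reflexive (sym (trans (∑′-+ c) (cong (∑′ c (λ x → d x * d x) +_) (∑′-* c 2)))))
          (≤-trans (∑′-mono c pointwise) (≤-reflexive (trans (∑′-+ c) (cong₂ _+_ (trans (∑′-+ c) (cong (∑′ c d +_) (trans (∑′-* c 2) (cong (2 *_) (trans ∑′α d≡M))))) (∑′-* c k)))))
        id₁ : ∀ m s l w e v → m * m + s + 2 * l + m + (w + 2 * m + v + 2 * e) + 0 ≡ m * m + 2 * e + 2 * m + v + (s + 2 * l + (m + w))
        id₁ = solve-∀

      -- As y ≤ 1, every degree away from `c` is at most 2 + α. The pointwise inequality fails only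
      -- for degree 3 next to `c`, which `low` excludes.
      tight : (∀ x → c ≢ x → h x c ≡ true → d x ≤ 2) → Goal 0
      tight low = weaken (arith-tight p e M (squares G) Y I Z Lf ee₀ HY₀ I≤ Z≤1 (sum-up 2 pointwise))
        where
        pointwise : ∀ x → c ≢ x → d x * d x + 2 * 𝟙 (leaf G c x) ≤ d x + 2 * α x + 2 * y x
        pointwise x c≢x with d x | h x c | y≤1 x c≢x | low x c≢x
        ... | 0 | true | _ | _ = z≤n
        ... | 0 | false | _ | _ = z≤n
        ... | 1 | true | _ | _ = ≤-refl
        ... | 1 | false | _ | _ = ≤-refl
        ... | 2 | true | _ | _ = ≤-refl
        ... | 2 | false | _ | _ = ≤-refl
        ... | suc (suc (suc k)) | true | _ | l = case l refl of λ { (s≤s (s≤s ())) }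
        ... | suc (suc (suc k)) | false | s≤s () | _

      -- The excess at `x` uses up the whole of `Y`, so a neighbour of `x` other than `c` and not
      -- adjacent to `c` is a leaf. At most one leaf hangs at `x`; together with `c` this accounts
      -- for only two neighbours, so another one closes a triangle with `c`.
      tight-△ : ∀ x → c ≢ x → h x c ≡ true → 3 ≤ d x → Goal 2 × (3 ≤ triangles G)
      tight-△ x c≢x hxc 3≤d = subst (λ n → squares G + (n * n + 5) ≤ n * e + deficit M p + 2) (sym n≡)
          (arith-tight-△ p e M (squares G) Y I Z Lf ee₀ HY₀ I≤ Z≤1 Lf≤1 p≤1 (sum-up 4 pointwise)) , three
        where
        pointwise : ∀ x → c ≢ x → d x * d x + 2 * 𝟙 (leaf G c x) ≤ d x + 2 * α x + 4 * y x
        pointwise x c≢x with d x | h x c | y≤1 x c≢x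
        ... | 0 | true | _ = z≤n
        ... | 0 | false | _ = z≤n
        ... | 1 | true | _ = ≤-refl
        ... | 1 | false | _ = ≤-refl
        ... | 2 | true | _ = ≤-refl
        ... | 2 | false | _ = m≤m+n 4 2
        ... | 3 | true | _ = ≤-refl
        ... | 3 | false | s≤s ()
        ... | suc (suc (suc (suc k))) | true | s≤s ()
        ... | suc (suc (suc (suc k))) | false | s≤s ()
        1≤yx : 1 ≤ y x
        1≤yx = subst (λ t → 1 ≤ d x ∸ 𝟙 t ∸ 1) (sym hxc) (∸-monoˡ-≤ 1 (∸-monoˡ-≤ 1 3≤d))
        third : ∃ λ w → c ≢ w × h x w ≡ true × h w c ≡ true
        third with Finₚ.any? (λ w → dec w)
          where
          dec : ∀ w → Dec (c ≢ w × h x w ≡ true × h w c ≡ true)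
          dec w with c ≟ w | h x w Boolₚ.≟ true | h w c Boolₚ.≟ true
          ... | no s | yes t | yes u = yes (s , t , u)
          ... | yes s | _ | _ = no λ v → proj₁ v s
          ... | _ | no t | _ = no λ v → t (proj₁ (proj₂ v))
          ... | _ | _ | no u = no λ v → u (proj₂ (proj₂ v))
        ... | yes r = r
        ... | no none = case ≤-trans 3≤d (≤-trans (∑-mono few) (≤-trans (≤-reflexive ∑-+) (+-mono-≤ (≤-reflexive (∑-δ1 c)) (#leaf≤1 G no-trans 3≤n x)))) of λ { (s≤s (s≤s ())) }
          where
          one : ∀ w → c ≢ w → h x w ≡ true → leaf G x w ≡ true
          one w c≢w hxw = cong₂ _∧_ (trans (symm G w x) hxw) (lem (d w) (h w c) refl refl)
            where
            x≢w : x ≢ w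
            x≢w refl = case trans (sym hxw) (irrefl G x) of λ ()
            both : y x + y w ≤ 1
            both = ≤-trans (≤-reflexive (sym (cong₂ _+_ (y-term x c≢x) (y-term w c≢w)))) (≤-trans (two-terms≤∑ (λ x → 𝟙 (not (c == x)) * y x) x≢w) Y≤1)
            yw≡0 : y w ≡ 0
            yw≡0 = n≤0⇒n≡0 (ℕ.s≤s⁻¹ (≤-trans (+-monoˡ-≤ (y w) 1≤yx) both))
            lem : ∀ k t → d w ≡ k → h w c ≡ t → ⌊ d w ℕ.≟ 1 ⌋ ≡ true
            lem k true _ e = ⊥-elim (none (w , c≢w , hxw , e))
            lem zero false dw _ = case ≤-trans (adj-positive G (trans (symm G w x) hxw)) (≤-reflexive dw) of λ ()
            lem (suc zero) false dw _ rewrite dw = refl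
            lem (suc (suc k)) false dw e = case trans (sym yw≡0) (cong₂ (λ u t → u ∸ 𝟙 t ∸ 1) dw e) of λ ()
          few : ∀ w → 𝟙 (h x w) ≤ 𝟙 (c == w) + 𝟙 (leaf G x w)
          few w = by-cases (h x w Boolₚ.≟ true) (c ≟ w)
            where
            by-cases : Dec (h x w ≡ true) → Dec (c ≡ w) → 𝟙 (h x w) ≤ 𝟙 (c == w) + 𝟙 (leaf G x w)
            by-cases (no t) _ = ≤-trans (≤-reflexive (cong 𝟙 (Boolₚ.¬-not t))) z≤n
            by-cases (yes t) (yes refl) = ≤-trans (≤-trans (𝟙≤1 _) (≤-reflexive (cong 𝟙 (sym (==-refl c))))) (m≤m+n _ _)
            by-cases (yes t) (no s) = ≤-trans (≤-trans (𝟙≤1 _) (≤-reflexive (cong 𝟙 (sym (one w s t))))) (m≤n+m _ _)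
        three : 3 ≤ triangles G
        three with third
        -- Three orders of the triangle suffice; their first vertices differ, so their indicators do
        -- not overlap.
        ... | w , c≢w , hxw , hwc = ≤-trans (≤-reflexive (sym (trans ∑³-+ (cong₂ _+_ (unit c x w) (trans ∑³-+ (cong₂ _+_ (unit x w c) (unit w c x))))))) (∑³-mono point)
          where
          x≢w : x ≢ w
          x≢w refl = case trans (sym hxw) (irrefl G x) of λ ()
          t : Fin n → Fin n → Fin n → ℕ
          t u v z = 𝟙 (h u v) * (𝟙 (h v z) * 𝟙 (h u z))
          at : Fin n → Fin n → Fin n → Fin n → Fin n → Fin n → ℕ
          at u v z u' v' z' = 𝟙 (u == u') * (𝟙 (v == v') * 𝟙 (z == z'))
          unit : ∀ u v z → ∑³ (at u v z) ≡ 1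
          unit u v z = trans (∑-cong λ u' → trans (∑-cong λ v' → trans (∑-* (𝟙 (u == u'))) (cong (𝟙 (u == u') *_) (trans (∑-* (𝟙 (v == v'))) (trans (cong (𝟙 (v == v') *_) (∑-δ1 z)) (*-identityʳ _)))))
            (trans (∑-* (𝟙 (u == u'))) (trans (cong (𝟙 (u == u') *_) (∑-δ1 v)) (*-identityʳ _)))) (∑-δ1 u)
          at≤ : ∀ {u v z} → h u v ≡ true → h v z ≡ true → h u z ≡ true → ∀ u' v' z' → at u v z u' v' z' ≤ 𝟙 (u == u') * t u' v' z'
          at≤ {u} {v} {z} huv hvz huz u' v' z' with u ≟ u' | v ≟ v' | z ≟ z'
          ... | no _ | _ | _ = z≤n
          ... | yes _ | no _ | _ = z≤n
          ... | yes _ | yes _ | no _ = z≤n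
          ... | yes refl | yes refl | yes refl rewrite huv | hvz | huz = ≤-refl
          flip : ∀ {u v} → h u v ≡ true → h v u ≡ true
          flip {u} {v} e = trans (symm G v u) e
          point : ∀ u v z → at c x w u v z + (at x w c u v z + at w c x u v z) ≤ t u v z
          point u v z = ≤-trans (+-mono-≤ (at≤ (flip hxc) hxw (flip hwc) u v z) (+-mono-≤ (at≤ hxw hwc hxc u v z) (at≤ hwc (flip hxc) (flip hxw) u v z))) disjoint
            where
            disjoint : 𝟙 (c == u) * t u v z + (𝟙 (x == u) * t u v z + 𝟙 (w == u) * t u v z) ≤ t u v z
            disjoint with c ≟ u | x ≟ u | w ≟ u
            ... | yes s | yes s' | _ = ⊥-elim (c≢x (trans s (sym s')))
            ... | yes s | _ | yes s' = ⊥-elim (c≢w (trans s (sym s')))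
            ... | _ | yes s | yes s' = ⊥-elim (x≢w (trans s (sym s')))
            ... | yes _ | no _ | no _ = ≤-reflexive (trans (+-identityʳ _) (+-identityʳ _))
            ... | no _ | yes _ | no _ = ≤-reflexive (trans (+-identityʳ _) (+-identityʳ _))
            ... | no _ | no _ | yes _ = ≤-reflexive (+-identityʳ _)
            ... | no _ | no _ | no _ = z≤n

  private
    finish : ∀ k f → f + deficit M p ≡ n * n + 5 → Goal k → 3 * k ≤ 2 * triangles G → 6 * f ≤ odds G
    finish k f f≡ = arith-final {f} {odds G} {squares G} {n} {e} {deficit M p} {ends G} {triangles G} k (odds-formula G) 2e f≡

  -- Three regimes: a second vertex of degree at least about M/12; none, but surplus edges or
  -- maximum degree below M; and the exact one, n - 2 edges and maximum degree M, where only a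
  -- neighbour of `c` of degree 3 calls for a triangle.
  odds-bound : ∀ k K t f → K ≡ k * k + k + 2 ^ k → k ≡ 7200 → ends G ≤ 6 * n → 200 * t ≤ M → M ≤ 200 * t + 200 → K ≤ t → 1 ≤ t →
    f + deficit M p ≡ n * n + 5 → 6 * f ≤ odds G
  odds-bound k K t f K≡ k≡ E≤ t≤ ≤t K≤t 1≤t f≡ with Finₚ.any? (λ x → dec x)
    where
    dec : ∀ x → Dec (c ≢ x × M + 1 ≤ 12 * d x + 2)
    dec x with c ≟ x | M + 1 ℕ.≤? 12 * d x + 2
    ... | no s | yes l = yes (s , l)
    ... | yes s | _ = no λ v → proj₁ v s
    ... | _ | no l = no (l ∘ proj₂)
  ... | yes (x , c≢x , big) = finish 0 f f≡ (two-hubs k K t K≡ k≡ E≤ t≤ ≤t K≤t 1≤t x c≢x big) z≤n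
  ... | no none with 1 ℕ.≤? r + q
  ... | yes 1≤rq = finish 0 f f≡ (one-hub small 1≤rq (≤-trans (≤-trans (m≤m+n 6 194) (*-monoʳ-≤ 200 1≤t)) t≤)) z≤n
    where
    small : ∀ x → c ≢ x → 12 * d x + 2 ≤ M
    small x c≢x = ≮⇒≥ λ l → none (x , c≢x , ≤-trans (≤-reflexive (+-comm M 1)) l)
  ... | no rq≡0 with Finₚ.any? (λ x → dec x)
    where
    dec : ∀ x → Dec (c ≢ x × h x c ≡ true × 3 ≤ d x)
    dec x with c ≟ x | h x c Boolₚ.≟ true | 3 ℕ.≤? d x
    ... | no s | yes t | yes l = yes (s , t , l)
    ... | yes s | _ | _ = no λ v → proj₁ v s
    ... | _ | no t | _ = no λ v → t (proj₁ (proj₂ v))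
    ... | _ | _ | no l = no λ v → l (proj₂ (proj₂ v))
  ... | yes (x , c≢x , hxc , 3≤d) = finish 2 f f≡ (proj₁ triangle) (*-monoʳ-≤ 2 (proj₂ triangle))
    where
    zero-sum : r + q ≡ 0
    zero-sum = n≤0⇒n≡0 (ℕ.s≤s⁻¹ (≰⇒> rq≡0))
    triangle : Goal 2 × 3 ≤ triangles G
    triangle = tight-△ (m+n≡0⇒m≡0 r zero-sum) (m+n≡0⇒n≡0 r zero-sum) x c≢x hxc 3≤d
  ... | no none′ = finish 0 f f≡ (tight (m+n≡0⇒m≡0 r zero-sum) (m+n≡0⇒n≡0 r zero-sum) low) z≤n
    where
    zero-sum : r + q ≡ 0
    zero-sum = n≤0⇒n≡0 (ℕ.s≤s⁻¹ (≰⇒> rq≡0))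
    low : ∀ x → c ≢ x → h x c ≡ true → d x ≤ 2
    low x c≢x hxc = ≮⇒≥ λ l → none′ (x , c≢x , hxc , l)

-- Minimality of a hypercut excludes even transversals

Symmetric³ : ∀ {n} → (Fin n → Fin n → Fin n → Bool) → Set
Symmetric³ P = (∀ x y z → P y x z ≡ P x y z) × (∀ x y z → P x z y ≡ P x y z)

-- Carries symmetric statements between arbitrary distinct vertices and the sorted triples on which
-- cuts are defined.
sort : ∀ {n} {x y z : Fin n} → x ≢ y → y ≢ z → x ≢ z →
  ∃ λ σ → ∀ P → Symmetric³ P → P (a σ) (b σ) (c σ) ≡ P x y z
sort {x = x} {y} {z} x≢y y≢z x≢z with Finₚ.<-cmp x y | Finₚ.<-cmp y z | Finₚ.<-cmp x z
... | tri≈ _ e _ | _ | _ = ⊥-elim (x≢y e)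
... | _ | tri≈ _ e _ | _ = ⊥-elim (y≢z e)
... | _ | _ | tri≈ _ e _ = ⊥-elim (x≢z e)
... | tri< p _ _ | tri< q _ _ | _ = triple x y z p q , λ P _ → refl
... | tri< p _ _ | tri> _ _ q | tri< r _ _ = triple x z y r q , λ P (s , t) → t x y z
... | tri< p _ _ | tri> _ _ q | tri> _ _ r = triple z x y r p , λ P (s , t) → trans (s x z y) (t x y z)
... | tri> _ _ p | tri< q _ _ | tri< r _ _ = triple y x z p r , λ P (s , t) → s x y z
... | tri> _ _ p | tri< q _ _ | tri> _ _ r = triple y z x q r , λ P (s , t) → trans (t y x z) (s x y z)
... | tri> _ _ p | tri> _ _ q | _ = triple z y x q p , λ P (s , t) → trans (s y z x) (trans (t y x z) (s x y z))

odd³-symmetric : ∀ {n} (G : Graph n) → Symmetric³ (odd³ G)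
odd³-symmetric G = odd³₁₂ G , odd³₂₃ G

data Class : Set where
  inP inQ inO : Class

isP isQ isO : Class → Bool
isP inP = true
isP _   = false
isQ inQ = true
isQ _   = false
isO inO = true
isO _   = false

class-sum : ∀ k → 𝟙 (isP k) + 𝟙 (isQ k) + 𝟙 (isO k) ≡ 1
class-sum inP = refl
class-sum inQ = refl
class-sum inO = refl

module _ {n : ℕ} (X : TSet n) (hypercut : Hypercut X) (G H : Graph n) (G≈H : H ≈³ G)
         (G-C : ∀ σ → odd³ G (a σ) (b σ) (c σ) ≡ not (X σ))
         (v : Fin n) (few : ends (link G v) ≤ 6 * n) (large : 28 ≤ n) where

  module _ (p q : Fin n → Bool) (disjoint : ∀ x → p x ≡ true → q x ≡ true → ⊥)
           (even : ∀ x y z → p x ≡ true → q y ≡ true → p z ≡ false → q z ≡ false → odd³ H x y z ≡ false) where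
    private
      -- The complete bipartite graph between `p` and `q`: its odd triples are those with one vertex
      -- in each of the three parts.
      Γ : Graph n
      Γ = record { adj = λ x y → (p x ∧ q y) ∨ (q x ∧ p y)
                 ; symm = λ x y → trans (Boolₚ.∨-comm (p x ∧ q y) _) (cong₂ _∨_ (Boolₚ.∧-comm (q x) _) (Boolₚ.∧-comm (p x) _))
                 ; irrefl = irr }
        where
        irr : ∀ x → (p x ∧ q x) ∨ (q x ∧ p x) ≡ false
        irr x with p x in e | q x in e'
        ... | true | true = ⊥-elim (disjoint x e e')
        ... | true | false = refl
        ... | false | true = refl
        ... | false | false = refl

      _∈ᶜ_ : Fin n → Class → Set
      x ∈ᶜ k = p x ≡ isP k × q x ≡ isQ k

      classify : ∀ x → ∃ λ k → x ∈ᶜ k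
      classify x with p x in e | q x in e'
      ... | true | true = ⊥-elim (disjoint x e e')
      ... | true | false = inP , refl , refl
      ... | false | true = inQ , refl , refl
      ... | false | false = inO , refl , refl

      joined : Class → Class → Bool
      joined i j = (isP i ∧ isQ j) ∨ (isQ i ∧ isP j)

      joined³ : Class → Class → Class → Bool
      joined³ i j k = joined i j xor (joined j k xor joined i k)

      Γ-joined : ∀ {x y i j} → x ∈ᶜ i → y ∈ᶜ j → adj Γ x y ≡ joined i j
      Γ-joined (px , qx) (py , qy) = cong₂ _∨_ (cong₂ _∧_ px qy) (cong₂ _∧_ qx py)

      Γ-joined³ : ∀ {x y z i j k} → x ∈ᶜ i → y ∈ᶜ j → z ∈ᶜ k → odd³ Γ x y z ≡ joined³ i j k
      Γ-joined³ x∈ y∈ z∈ = cong₂ _xor_ (Γ-joined x∈ y∈) (cong₂ _xor_ (Γ-joined y∈ z∈) (Γ-joined x∈ z∈))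

      transversal-even : ∀ x y z i j k → x ∈ᶜ i → y ∈ᶜ j → z ∈ᶜ k → joined³ i j k ≡ true → odd³ H x y z ≡ false
      transversal-even x y z inP inP inP _ _ _ ()
      transversal-even x y z inP inP inQ _ _ _ ()
      transversal-even x y z inP inP inO _ _ _ ()
      transversal-even x y z inP inQ inP _ _ _ ()
      transversal-even x y z inP inQ inQ _ _ _ ()
      transversal-even x y z inP inQ inO (px , qx) (py , qy) (pz , qz) _ = even x y z px qy pz qz
      transversal-even x y z inP inO inP _ _ _ ()
      transversal-even x y z inP inO inQ (px , qx) (py , qy) (pz , qz) _ = trans (sym (odd³₂₃ H x y z)) (even x z y px qz py qy)
      transversal-even x y z inP inO inO _ _ _ ()
      transversal-even x y z inQ inP inP _ _ _ ()
      transversal-even x y z inQ inP inQ _ _ _ ()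
      transversal-even x y z inQ inP inO (px , qx) (py , qy) (pz , qz) _ = trans (sym (odd³₁₂ H x y z)) (even y x z py qx pz qz)
      transversal-even x y z inQ inQ inP _ _ _ ()
      transversal-even x y z inQ inQ inQ _ _ _ ()
      transversal-even x y z inQ inQ inO _ _ _ ()
      transversal-even x y z inQ inO inP (px , qx) (py , qy) (pz , qz) _ = trans (sym (odd³₂₃ H x y z)) (trans (sym (odd³₁₂ H x z y)) (even z x y pz qx py qy))
      transversal-even x y z inQ inO inQ _ _ _ ()
      transversal-even x y z inQ inO inO _ _ _ ()
      transversal-even x y z inO inP inP _ _ _ ()
      transversal-even x y z inO inP inQ (px , qx) (py , qy) (pz , qz) _ = trans (sym (odd³₁₂ H x y z)) (trans (sym (odd³₂₃ H y x z)) (even y z x py qz px qx))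
      transversal-even x y z inO inP inO _ _ _ ()
      transversal-even x y z inO inQ inP (px , qx) (py , qy) (pz , qz) _ = trans (sym (odd³₂₃ H x y z)) (trans (sym (odd³₁₂ H x z y)) (trans (sym (odd³₂₃ H z x y)) (even z y x pz qy px qx)))
      transversal-even x y z inO inQ inQ _ _ _ ()
      transversal-even x y z inO inQ inO _ _ _ ()
      transversal-even x y z inO inO inP _ _ _ ()
      transversal-even x y z inO inO inQ _ _ _ ()
      transversal-even x y z inO inO inO _ _ _ ()

      Γ⊆C : cob (adj Γ) ⊆ X
      Γ⊆C σ e with classify (a σ) | classify (b σ) | classify (c σ)
      ... | i , x∈ | j , y∈ | k , z∈ = trans (sym (Boolₚ.not-involutive (X σ))) (cong not (trans (sym (G-C σ)) (trans (sym (G≈H _ _ _))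
        (transversal-even (a σ) (b σ) (c σ) i j k x∈ y∈ z∈ (trans (sym (Γ-joined³ x∈ y∈ z∈)) e)))))

      odd-elsewhere : X ⊆ cob (adj Γ) → ∀ {x y z} → x ≢ y → y ≢ z → x ≢ z → odd³ Γ x y z ≡ false → odd³ G x y z ≡ true
      odd-elsewhere C⊆Γ x≢y y≢z x≢z e with sort x≢y y≢z x≢z
      ... | σ , sorted = trans (sym (sorted (odd³ G) (odd³-symmetric G))) (trans (G-C σ) (cong not (Boolₚ.¬-not λ Cσ →
        case trans (sym (C⊆Γ σ Cσ)) (trans (sorted (odd³ Γ) (odd³-symmetric Γ)) e) of λ ())))

      r : Fin n → Bool
      r x = not (p x) ∧ not (q x)

      r-class : ∀ {x k} → x ∈ᶜ k → r x ≡ isO k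
      r-class {k = inP} (px , qx) rewrite px = refl
      r-class {k = inQ} (px , qx) rewrite px | qx = refl
      r-class {k = inO} (px , qx) rewrite px | qx = refl

      two-products : ∀ s t → 2 * (s * t) ≤ s * s + t * t
      two-products s t with ≤-total s t
      ... | inj₁ s≤t = subst (λ t → 2 * (s * t) ≤ s * s + t * t) (m+[n∸m]≡n s≤t)
                         (from-sum {L = 0} {R = 0} ((t ∸ s) * (t ∸ s)) z≤n (id₁ s (t ∸ s)))
        where
        id₁ : ∀ s k → 2 * (s * (s + k)) + 0 + k * k ≡ s * s + (s + k) * (s + k) + 0
        id₁ = solve-∀
      ... | inj₂ t≤s = subst (λ s → 2 * (s * t) ≤ s * s + t * t) (m+[n∸m]≡n t≤s)
                         (from-sum {L = 0} {R = 0} ((s ∸ t) * (s ∸ t)) z≤n (id₁ t (s ∸ t)))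
        where
        id₁ : ∀ t k → 2 * ((t + k) * t) + 0 + k * k ≡ (t + k) * (t + k) + t * t + 0
        id₁ = solve-∀

      same : Fin n → Fin n → ℕ
      same y z = 𝟙 (p y) * 𝟙 (p z) + 𝟙 (q y) * 𝟙 (q z) + 𝟙 (r y) * 𝟙 (r z)

      ∑∑-product : ∀ (f : Fin n → ℕ) → ∑ (λ y → ∑ λ z → f y * f z) ≡ ∑ f * ∑ f
      ∑∑-product f = trans (∑-cong λ y → trans (∑-* (f y)) (*-comm (f y) (∑ f))) (∑-* (∑ f))

      -- Convexity for three parts: at least a third of the ordered pairs lie within a part.
      square≤ : n * n ≤ 3 * ∑ (λ y → ∑ (same y))
      square≤ = subst₂ _≤_ (cong₂ _*_ total total) (cong (3 *_) (sym sum-same))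
          (from-sum 0 (two-products (# p) (# q) ⊕ two-products (# p) (# r) ⊕ two-products (# q) (# r)) (id₁ (# p) (# q) (# r)))
        where
        id₁ : ∀ u v w → (u + v + w) * (u + v + w) + (u * u + v * v + (u * u + w * w + (v * v + w * w))) + 0
          ≡ 3 * (u * u + v * v + w * w) + (2 * (u * v) + (2 * (u * w) + 2 * (v * w)))
        id₁ = solve-∀
        total : # p + # q + # r ≡ n
        total = trans (trans (cong (_+ # r) (sym ∑-+)) (sym ∑-+)) (trans (∑-cong one) (trans (∑-const n 1) (*-identityʳ n)))
          where
          one : ∀ x → 𝟙 (p x) + 𝟙 (q x) + 𝟙 (r x) ≡ 1
          one x with classify x
          ... | k , px , qx = trans (cong₂ _+_ (cong₂ (λ s t → 𝟙 s + 𝟙 t) px qx) (cong 𝟙 (r-class {x} {k} (px , qx)))) (class-sum k)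
        sum-same : ∑ (λ y → ∑ (same y)) ≡ # p * # p + # q * # q + # r * # r
        sum-same = trans (∑-cong λ y → trans ∑-+ (cong (_+ ∑ (λ z → 𝟙 (r y) * 𝟙 (r z))) ∑-+)) (trans ∑-+ (cong₂ _+_ (trans ∑-+ (cong₂ _+_ (∑∑-product (𝟙 ∘ p)) (∑∑-product (𝟙 ∘ q)))) (∑∑-product (𝟙 ∘ r))))

    -- Minimality makes `X` the set of transversal triples. For y and z in one part, the triple v,
    -- y, z is then outside `X`, so yz is an edge of the link of `v` unless two of the three
    -- vertices coincide. A third of n² pairs does not fit into 6n ends and 3n degenerate pairs.
    transversals-impossible : (∃ λ x → p x ≡ true) → (∃ λ y → q y ≡ true) → (∃ λ z → p z ≡ false × q z ≡ false) → ⊥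
    transversals-impossible (x , px) (y , qy) (z , pz , qz) = case *-cancelʳ-≤ n 27 n {{ℕ.>-nonZero (≤-trans (s≤s z≤n) large)}} n*n≤ of λ n≤27 → <⇒≱ large n≤27
      where
      x≢y : x ≢ y
      x≢y refl = disjoint x px qy
      y≢z : y ≢ z
      y≢z refl = case trans (sym qy) qz of λ ()
      x≢z : x ≢ z
      x≢z refl = case trans (sym px) pz of λ ()
      C⊆Γ : X ⊆ cob (adj Γ)
      C⊆Γ with sort x≢y y≢z x≢z
      ... | σ , sorted = hypercut-minimal hypercut (adj Γ) Γ⊆C (σ , trans (sorted (odd³ Γ) (odd³-symmetric Γ)) Γ-odd)
        where
        Γ-odd : odd³ Γ x y z ≡ true
        Γ-odd rewrite px | qy | pz | qz | Boolₚ.¬-not (disjoint x px) | Boolₚ.¬-not (λ py → disjoint y py qy) = refl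
      pointwise : ∀ y z → same y z ≤ 𝟙 (odd³ G v y z) + (𝟙 (y == z) + (𝟙 (v == y) + 𝟙 (v == z)))
      pointwise y z with classify v | classify y | classify z
      ... | i , v∈ | j , py , qy | k , pz , qz = ≤-trans (≤-reflexive same-product) (by-class j k (py , qy) (pz , qz))
        where
        product : Class → Class → ℕ
        product j k = 𝟙 (isP j) * 𝟙 (isP k) + 𝟙 (isQ j) * 𝟙 (isQ k) + 𝟙 (isO j) * 𝟙 (isO k)
        same-product : same y z ≡ product j k
        same-product = cong₂ _+_ (cong₂ _+_ (cong₂ (λ s t → 𝟙 s * 𝟙 t) py pz) (cong₂ (λ s t → 𝟙 s * 𝟙 t) qy qz))
          (cong₂ (λ s t → 𝟙 s * 𝟙 t) (r-class {y} {j} (py , qy)) (r-class {z} {k} (pz , qz)))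
        rhs : ℕ
        rhs = 𝟙 (odd³ G v y z) + (𝟙 (y == z) + (𝟙 (v == y) + 𝟙 (v == z)))
        positive : ∀ {t} → t ≡ true → 1 ≤ 𝟙 t
        positive refl = ≤-refl
        equal : ∀ j → y ∈ᶜ j → z ∈ᶜ j → 1 ≤ rhs
        equal j y∈ z∈ = cases (y ≟ z) (v ≟ y) (v ≟ z)
          where
          odd-Γ : odd³ Γ v y z ≡ false
          odd-Γ = trans (Γ-joined³ v∈ y∈ z∈) (cancel i j)
            where
            cancel : ∀ i j → joined³ i j j ≡ false
            cancel inP inP = refl
            cancel inP inQ = refl
            cancel inP inO = refl
            cancel inQ inP = refl
            cancel inQ inQ = refl
            cancel inQ inO = refl
            cancel inO inP = refl
            cancel inO inQ = refl
            cancel inO inO = refl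
          cases : Dec (y ≡ z) → Dec (v ≡ y) → Dec (v ≡ z) → 1 ≤ rhs
          cases (yes e) _ _ = ≤-trans (positive (trans (cong (y ==_) (sym e)) (==-refl y))) (≤-trans (m≤m+n _ _) (m≤n+m _ (𝟙 (odd³ G v y z))))
          cases (no _) (yes e) _ = ≤-trans (positive (trans (cong (v ==_) (sym e)) (==-refl v))) (≤-trans (m≤m+n _ _) (≤-trans (m≤n+m _ (𝟙 (y == z))) (m≤n+m _ (𝟙 (odd³ G v y z)))))
          cases (no _) (no _) (yes e) = ≤-trans (positive (trans (cong (v ==_) (sym e)) (==-refl v))) (≤-trans (m≤n+m _ (𝟙 (v == y))) (≤-trans (m≤n+m _ (𝟙 (y == z))) (m≤n+m _ (𝟙 (odd³ G v y z)))))
          cases (no y≢z) (no v≢y) (no v≢z) = ≤-trans (positive (odd-elsewhere C⊆Γ v≢y y≢z v≢z odd-Γ)) (m≤m+n _ _)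
        by-class : ∀ j k → y ∈ᶜ j → z ∈ᶜ k → product j k ≤ rhs
        by-class inP inP y∈ z∈ = equal inP y∈ z∈
        by-class inQ inQ y∈ z∈ = equal inQ y∈ z∈
        by-class inO inO y∈ z∈ = equal inO y∈ z∈
        by-class inP inQ _ _ = z≤n
        by-class inP inO _ _ = z≤n
        by-class inQ inP _ _ = z≤n
        by-class inQ inO _ _ = z≤n
        by-class inO inP _ _ = z≤n
        by-class inO inQ _ _ = z≤n
      n*n≤ : n * n ≤ 27 * n
      n*n≤ = ≤-trans square≤ (≤-trans (*-monoʳ-≤ 3 (≤-trans (∑-mono λ y → ∑-mono (pointwise y)) (≤-reflexive sums)))
          (≤-trans (*-monoʳ-≤ 3 (+-monoˡ-≤ (n + (n + n)) few)) (≤-reflexive (id₁ n))))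
        where
        id₁ : ∀ n → 3 * (6 * n + (n + (n + n))) ≡ 27 * n
        id₁ = solve-∀
        n×1 : ∑ {n} (λ _ → 1) ≡ n
        n×1 = trans (∑-const n 1) (*-identityʳ n)
        sums : ∑ (λ y → ∑ λ z → 𝟙 (odd³ G v y z) + (𝟙 (y == z) + (𝟙 (v == y) + 𝟙 (v == z)))) ≡ ends (link G v) + (n + (n + n))
        sums = trans (∑-cong λ y → trans ∑-+ (cong (deg (link G v) y +_) (trans ∑-+ (cong₂ _+_ (∑-δ1 y) (trans ∑-+ (cong₂ _+_ (∑-const n (𝟙 (v == y))) (∑-δ1 v)))))))
          (trans ∑-+ (cong (ends (link G v) +_) (trans ∑-+ (cong₂ _+_ n×1 (trans ∑-+ (cong₂ _+_ (trans (∑-* n) (trans (cong (n *_) (∑-δ1 v)) (*-identityʳ n))) n×1))))))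

-- κ bounds the number of vertices of degree above M / 200; it is opaque so that 2 ^ κ is never evaluated.
opaque
  κ : ℕ
  κ = 7200

  κ≡ : κ ≡ 7200
  κ≡ = refl

K : ℕ
K = κ * κ + κ + 2 ^ κ

-- Makes t = M / 200 at least K + 1, hence positive and at least K.
threshold : ℕ
threshold = (K + 1) * 200

-- In the nontrivial case fewer than `f` triples are missed. As f ≤ n², some link then has at most
-- 6n ends, and `odds-bound` applies to its switched form, which has the same odd triples.
lower-bound : ∀ n M p → suc n ≡ order M p → p ≤ 1 → threshold ≤ M → (X : TSet (suc n)) → Hypercut X →
  ∀ f → f + deficit M p ≡ suc n * suc n + 5 → f ≤ count (not ∘ X)
lower-bound n M p n≡ p≤1 large X hypercut f f≡ with f ℕ.≤? count (not ∘ X)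
... | yes le = le
... | no f≰ with hypercut-cob hypercut
... | g , C≡ with sparse-link (complement g)
... | v , sparse with bounded-degrees M n≤ (link (complement g) v)
  where
  n≤ : suc n ≤ 2 * M + 2
  n≤ = ≤-trans (≤-reflexive n≡) (≤-trans (+-monoʳ-≤ (2 * M + 1) p≤1) (≤-reflexive (+-assoc (2 * M) 1 1)))
... | H , H≈ , E≤ , d≤M with argmax (deg H)
... | w , max = *-cancelˡ-≤ 6 (≤-trans
    (odds-bound H no-trans (≤-trans (m≤m+n 3 25) 28≤n) w p M p≤1 n≡ max d≤M κ K t f refl κ≡ (≤-trans E≤ few) t≤ ≤t K≤t 1≤t f≡)
    (≤-reflexive (trans (sym same-odds) (sym six-D))))
  where
  G : Graph (suc n)
  G = complement g
  t : ℕ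
  t = M / 200
  M-split : M ≡ M % 200 + t * 200
  M-split = m≡m%n+[m/n]*n M 200
  K+1≤t : K + 1 ≤ t
  K+1≤t = subst (_≤ t) (m*n/n≡m (K + 1) 200) (/-monoˡ-≤ 200 large)
  K≤t : K ≤ t
  K≤t = ≤-trans (m≤m+n K 1) K+1≤t
  1≤t : 1 ≤ t
  1≤t = ≤-trans (m≤n+m 1 K) K+1≤t
  t≤ : 200 * t ≤ M
  t≤ = ≤-trans (≤-reflexive (*-comm 200 t)) (≤-trans (m≤n+m (t * 200) (M % 200)) (≤-reflexive (sym M-split)))
  ≤t : M ≤ 200 * t + 200
  ≤t = ≤-trans (≤-reflexive (trans M-split (+-comm (M % 200) _))) (+-mono-≤ (≤-reflexive (*-comm t 200)) (<⇒≤ (m%n<n M 200)))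
  28≤n : 28 ≤ suc n
  28≤n = ≤-trans (≤-trans (≤-trans (m≤m+n 28 172) (*-monoʳ-≤ 200 1≤t)) t≤) (≤-trans (m≤m+n M (M + 1 + p)) (≤-reflexive (trans (id₁ M p) (sym n≡))))
    where
    id₁ : ∀ M p → M + (M + 1 + p) ≡ 2 * M + 1 + p
    id₁ = solve-∀
  G-C : ∀ σ → odd³ G (a σ) (b σ) (c σ) ≡ not (X σ)
  G-C σ = trans (complement-odd³ g σ) (cong not (sym (C≡ σ)))
  H≈G : H ≈³ G
  H≈G x y z = trans (H≈ x y z) (link-≈³ G v x y z)
  six-D : 6 * count (not ∘ X) ≡ odds G
  six-D = trans (cong (6 *_) (count-cong λ σ → sym (G-C σ))) (six-odds G)
  same-odds : odds G ≡ odds H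
  same-odds = ∑³-cong λ x y z → cong 𝟙 (sym (H≈G x y z))
  f≤ : f ≤ suc n * suc n
  f≤ = +-cancelʳ-≤ 5 f _ (≤-trans (+-monoʳ-≤ f (≤-trans (≤-trans (m≤m+n 5 79) (*-monoʳ-≤ 3 28≤n)) (≤-trans (≤-reflexive (cong (3 *_) n≡)) (m≤n+m (3 * order M p) (M * M + 3 * M + 3 * p))))) (≤-reflexive f≡))
  few : ends (link G v) ≤ 6 * suc n
  few = *-cancelˡ-≤ (suc n) (≤-trans sparse (≤-trans (≤-reflexive (sym six-D)) (≤-trans (*-monoʳ-≤ 6 (≤-trans (<⇒≤ (≰⇒> f≰)) f≤)) (≤-reflexive (id₁ (suc n))))))
    where
    id₁ : ∀ n → 6 * (n * n) ≡ n * (6 * n)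
    id₁ = solve-∀
  no-trans : NoTransversal H
  no-trans p q disjoint x y z even = transversals-impossible X hypercut G H H≈G G-C v few 28≤n p q disjoint even x y z

-- The extremal hypercut

-- The extremal graph: an isolated vertex, and a centre from which s legs of length 2 emanate,
-- together with one leg of length 1 when the flag is set. (false , i) and (true , i) are the
-- inner and outer vertices of leg i.
data Vertex : Set where
  isolate centre : Vertex
  leg            : Bool × ℕ → Vertex

spider : Vertex → Vertex → Bool
spider centre          (leg (false , _)) = true
spider (leg (false , _)) centre          = true
spider (leg (false , i)) (leg (true , j))  = i ≡ᵇ j
spider (leg (true , i))  (leg (false , j)) = j ≡ᵇ i
spider _ _ = false

spider-symm : ∀ x y → spider x y ≡ spider y x
spider-symm isolate isolate = refl
spider-symm isolate centre = refl
spider-symm isolate (leg (false , _)) = refl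
spider-symm isolate (leg (true , _)) = refl
spider-symm centre isolate = refl
spider-symm centre centre = refl
spider-symm centre (leg (false , _)) = refl
spider-symm centre (leg (true , _)) = refl
spider-symm (leg (false , _)) isolate = refl
spider-symm (leg (true , _)) isolate = refl
spider-symm (leg (false , _)) centre = refl
spider-symm (leg (true , _)) centre = refl
spider-symm (leg (false , _)) (leg (false , _)) = refl
spider-symm (leg (false , _)) (leg (true , _)) = refl
spider-symm (leg (true , _)) (leg (false , _)) = refl
spider-symm (leg (true , _)) (leg (true , _)) = refl

spider-irrefl : ∀ x → spider x x ≡ false
spider-irrefl isolate = refl
spider-irrefl centre = refl
spider-irrefl (leg (false , _)) = refl
spider-irrefl (leg (true , _)) = refl

spider-triangle : ∀ x y z → 𝟙 (spider x y) * (𝟙 (spider y z) * 𝟙 (spider x z)) ≡ 0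
spider-triangle isolate _ _ = refl
spider-triangle centre isolate _ = refl
spider-triangle centre centre _ = refl
spider-triangle centre (leg (true , _)) _ = refl
spider-triangle centre (leg (false , _)) isolate = refl
spider-triangle centre (leg (false , _)) centre = refl
spider-triangle centre (leg (false , _)) (leg (false , _)) = refl
spider-triangle centre (leg (false , i)) (leg (true , j)) = cong (_+ 0) (*-zeroʳ (𝟙 (i ≡ᵇ j)))
spider-triangle (leg (false , _)) isolate _ = refl
spider-triangle (leg (false , _)) centre isolate = refl
spider-triangle (leg (false , _)) centre centre = refl
spider-triangle (leg (false , _)) centre (leg (false , _)) = refl
spider-triangle (leg (false , _)) centre (leg (true , _)) = refl
spider-triangle (leg (false , _)) (leg (false , _)) _ = refl
spider-triangle (leg (false , i)) (leg (true , j)) isolate = *-zeroʳ (𝟙 (i ≡ᵇ j))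
spider-triangle (leg (false , i)) (leg (true , j)) centre = *-zeroʳ (𝟙 (i ≡ᵇ j))
spider-triangle (leg (false , i)) (leg (true , j)) (leg (false , k)) = trans (cong (𝟙 (i ≡ᵇ j) *_) (*-zeroʳ (𝟙 (k ≡ᵇ j)))) (*-zeroʳ (𝟙 (i ≡ᵇ j)))
spider-triangle (leg (false , i)) (leg (true , j)) (leg (true , k)) = *-zeroʳ (𝟙 (i ≡ᵇ j))
spider-triangle (leg (true , _)) isolate _ = refl
spider-triangle (leg (true , _)) centre _ = refl
spider-triangle (leg (true , _)) (leg (true , _)) _ = refl
spider-triangle (leg (true , i)) (leg (false , j)) isolate = *-zeroʳ (𝟙 (j ≡ᵇ i))
spider-triangle (leg (true , i)) (leg (false , j)) centre = *-zeroʳ (𝟙 (j ≡ᵇ i))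
spider-triangle (leg (true , i)) (leg (false , j)) (leg (false , k)) = *-zeroʳ (𝟙 (j ≡ᵇ i))
spider-triangle (leg (true , i)) (leg (false , j)) (leg (true , k)) = trans (cong (𝟙 (j ≡ᵇ i) *_) (*-zeroʳ (𝟙 (j ≡ᵇ k)))) (*-zeroʳ (𝟙 (j ≡ᵇ i)))

-- Inner vertices get even and outer vertices odd numbers, so a range of odd length ends in exactly
-- one leg of length 1.
position : Bool × ℕ → ℕ
position (b , zero)  = 𝟙 b
position (b , suc i) = 2 + position (b , i)

at : ℕ → Bool × ℕ
at 0 = false , 0
at 1 = true , 0
at (suc (suc k)) = map₂ suc (at k)

position-at : ∀ k → position (at k) ≡ k
position-at 0 = refl
position-at 1 = refl
position-at (suc (suc k)) = cong (2 +_) (position-at k)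

at-position : ∀ b i → at (position (b , i)) ≡ (b , i)
at-position false zero = refl
at-position true  zero = refl
at-position b (suc i) = cong (map₂ suc) (at-position b i)

position-outer : ∀ i → position (true , i) ≡ suc (position (false , i))
position-outer zero = refl
position-outer (suc i) = cong (2 +_) (position-outer i)

position-next : ∀ {i j} → i ℕ.< j → 2 + position (false , i) ≤ position (false , j)
position-next {zero} {suc j} _ = s≤s (s≤s z≤n)
position-next {suc i} {suc j} (s≤s i<j) = s≤s (s≤s (position-next i<j))

encode : Vertex → ℕ
encode isolate = 0
encode centre = 1
encode (leg l) = 2 + position l

decode : ℕ → Vertex
decode 0 = isolate
decode 1 = centre
decode (suc (suc k)) = leg (at k)

encode-decode : ∀ k → encode (decode k) ≡ k
encode-decode 0 = refl
encode-decode 1 = refl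
encode-decode (suc (suc k)) = cong (2 +_) (position-at k)

decode-encode : ∀ x → decode (encode x) ≡ x
decode-encode isolate = refl
decode-encode centre = refl
decode-encode (leg (b , i)) = cong leg (at-position b i)

span : ℕ → Bool → ℕ
span zero    ε = 𝟙 ε
span (suc s) ε = 2 + span s ε

leg-sum : ℕ → Bool → (Bool × ℕ → ℕ) → ℕ
leg-sum zero    ε F = 𝟙 ε * F (false , 0)
leg-sum (suc s) ε F = F (false , 0) + (F (true , 0) + leg-sum s ε (F ∘ map₂ suc))

∑-legs : ∀ s ε F → ∑ {span s ε} (λ x → F (at (toℕ x))) ≡ leg-sum s ε F
∑-legs zero false F = ∑-zero _
∑-legs zero true F = trans (∑-suc _) (cong (F (false , 0) +_) (∑-zero _))
∑-legs (suc s) ε F = trans (∑-suc _) (cong (F (false , 0) +_) (trans (∑-suc _) (cong (F (true , 0) +_) (∑-legs s ε (F ∘ map₂ suc)))))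

∑-vertices : ∀ s ε F → ∑ {2 + span s ε} (λ x → F (decode (toℕ x))) ≡ F isolate + (F centre + leg-sum s ε (F ∘ leg))
∑-vertices s ε F = trans (∑-suc _) (cong (F isolate +_) (trans (∑-suc _) (cong (F centre +_) (∑-legs s ε (F ∘ leg)))))

leg-sum-const : ∀ s ε F {α β γ} → (∀ i → i ℕ.< s → F (false , i) ≡ α) → (∀ i → i ℕ.< s → F (true , i) ≡ β) → F (false , s) ≡ γ →
  leg-sum s ε F ≡ s * (α + β) + 𝟙 ε * γ
leg-sum-const zero ε F _ _ refl = refl
leg-sum-const (suc s) ε F {α} {β} {γ} fα fβ fγ = begin
  F (false , 0) + (F (true , 0) + leg-sum s ε (F ∘ map₂ suc)) ≡⟨ cong₂ _+_ (fα 0 (s≤s z≤n)) (cong₂ _+_ (fβ 0 (s≤s z≤n)) (leg-sum-const s ε (F ∘ map₂ suc) (λ i → fα (suc i) ∘ s≤s) (λ i → fβ (suc i) ∘ s≤s) fγ)) ⟩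
  α + (β + (s * (α + β) + 𝟙 ε * γ)) ≡⟨ id₁ α β s (𝟙 ε * γ) ⟩
  suc s * (α + β) + 𝟙 ε * γ ∎
  where
  open ≡-Reasoning
  id₁ : ∀ α β s v → α + (β + (s * (α + β) + v)) ≡ suc s * (α + β) + v
  id₁ = solve-∀

leg-sum-zero : ∀ s ε F → (∀ l → F l ≡ 0) → leg-sum s ε F ≡ 0
leg-sum-zero s ε F z = trans (leg-sum-const s ε F (λ i _ → z _) (λ i _ → z _) (z _)) (cong₂ _+_ (*-zeroʳ s) (*-zeroʳ (𝟙 ε)))

leg-sum-outer : ∀ s ε i F → i ℕ.< s → (∀ j → F (false , j) ≡ 0) → (∀ j → F (true , j) ≡ 𝟙 (i ≡ᵇ j)) → leg-sum s ε F ≡ 1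
leg-sum-outer (suc s) ε zero F _ z δ = cong₂ _+_ (z 0) (cong₂ _+_ (δ 0) (leg-sum-zero s ε (F ∘ map₂ suc) λ { (false , j) → z (suc j) ; (true , j) → δ (suc j) }))
leg-sum-outer (suc s) ε (suc i) F (s≤s i<s) z δ = cong₂ _+_ (z 0) (cong₂ _+_ (δ 0) (leg-sum-outer s ε i (F ∘ map₂ suc) i<s (z ∘ suc) (δ ∘ suc)))

leg-sum-inner : ∀ s ε i F → i ℕ.< s → (∀ j → F (true , j) ≡ 0) → (∀ j → F (false , j) ≡ 𝟙 (j ≡ᵇ i)) → leg-sum s ε F ≡ 1
leg-sum-inner (suc s) ε zero F _ z δ = cong₂ _+_ (δ 0) (cong₂ _+_ (z 0) (leg-sum-zero s ε (F ∘ map₂ suc) λ { (false , j) → δ (suc j) ; (true , j) → z (suc j) }))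
leg-sum-inner (suc s) ε (suc i) F (s≤s i<s) z δ = cong₂ _+_ (δ 0) (cong₂ _+_ (z 0) (leg-sum-inner s ε i (F ∘ map₂ suc) i<s (z ∘ suc) (δ ∘ suc)))

<⇒≡ᵇ-false : ∀ {i j} → i ℕ.< j → (j ≡ᵇ i) ≡ false
<⇒≡ᵇ-false {zero} {suc j} _ = refl
<⇒≡ᵇ-false {suc i} {suc j} (s≤s p) = <⇒≡ᵇ-false p

module _ (s : ℕ) (ε : Bool) where

  private
    L n : ℕ
    L = span s ε
    n = 2 + L

    vertex : Fin n → Vertex
    vertex x = decode (toℕ x)

  spider-graph : Graph n
  spider-graph = record
    { adj = λ x y → spider (vertex x) (vertex y) ; symm = λ x y → spider-symm (vertex x) (vertex y) ; irrefl = λ x → spider-irrefl (vertex x) }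

  private
    H : Graph n
    H = spider-graph
    valency : Vertex → ℕ
    valency x = ∑ {n} λ y → 𝟙 (spider x (vertex y))

    valency-isolate : valency isolate ≡ 0
    valency-isolate = ∑-0 λ _ → refl

    valency-centre : valency centre ≡ s + 𝟙 ε
    valency-centre = trans (∑-vertices s ε (𝟙 ∘ spider centre)) (trans (leg-sum-const s ε _ (λ _ _ → refl) (λ _ _ → refl) refl)
      (cong₂ _+_ (*-identityʳ s) (*-identityʳ (𝟙 ε))))

    valency-outer : ∀ i → i ℕ.< s → valency (leg (true , i)) ≡ 1
    valency-outer i i<s = trans (∑-vertices s ε (𝟙 ∘ spider (leg (true , i)))) (leg-sum-inner s ε i _ i<s (λ _ → refl) (λ _ → refl))

    valency-inner : ∀ i → i ℕ.< s → valency (leg (false , i)) ≡ 2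
    valency-inner i i<s = trans (∑-vertices s ε (𝟙 ∘ spider (leg (false , i)))) (cong suc (leg-sum-outer s ε i _ i<s (λ _ → refl) (λ _ → refl)))

    valency-last : valency (leg (false , s)) ≡ 1
    valency-last = trans (∑-vertices s ε (𝟙 ∘ spider (leg (false , s)))) (cong suc (trans (leg-sum-const s ε _ (λ _ _ → refl) (λ i i<s → cong 𝟙 (<⇒≡ᵇ-false i<s)) refl)
      (cong₂ _+_ (*-zeroʳ s) (*-zeroʳ (𝟙 ε)))))

    ends-H : ends H ≡ s + 𝟙 ε + (s * 3 + 𝟙 ε * 1)
    ends-H = trans (∑-vertices s ε valency) (cong₂ _+_ valency-isolate (cong₂ _+_ valency-centre (leg-sum-const s ε _ valency-inner valency-outer valency-last)))

    squares-H : squares H ≡ (s + 𝟙 ε) * (s + 𝟙 ε) + (s * 5 + 𝟙 ε * 1)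
    squares-H = trans (∑-vertices s ε (λ x → valency x * valency x)) (cong₂ _+_ (square valency-isolate) (cong₂ _+_ (square valency-centre)
        (leg-sum-const s ε _ (λ i → square ∘ valency-inner i) (λ i → square ∘ valency-outer i) (square valency-last))))
      where
      square : ∀ {i j} → i ≡ j → i * i ≡ j * j
      square refl = refl

    triangles-H : triangles H ≡ 0
    triangles-H = trans (∑³-cong λ x y z → spider-triangle (vertex x) (vertex y) (vertex z)) (∑-0 λ _ → ∑-0 λ _ → ∑-0 λ _ → refl)

  big-cut : TSet n
  big-cut = cob (λ x y → not (adj H x y))

  private
    big-cut-odd³ : ∀ σ → odd³ H (a σ) (b σ) (c σ) ≡ not (big-cut σ)
    big-cut-odd³ σ = lem (adj H (a σ) (b σ)) (adj H (b σ) (c σ)) (adj H (a σ) (c σ))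
      where
      lem : ∀ p q r → p xor (q xor r) ≡ not (not p xor (not q xor not r))
      lem false false false = refl
      lem false false true = refl
      lem false true false = refl
      lem false true true = refl
      lem true false false = refl
      lem true false true = refl
      lem true true false = refl
      lem true true true = refl

  missed : ℕ
  missed = count (not ∘ big-cut)

  -- The counting identity divided by 6, for a graph with 2s + ε edges and no triangles.
  missed-formula : missed + ((s + 𝟙 ε) * (s + 𝟙 ε) + (s * 5 + 𝟙 ε)) ≡ n * (2 * s + 𝟙 ε)
  missed-formula = *-cancelˡ-≡ _ _ 6 (begin
    6 * (missed + ((s + 𝟙 ε) * (s + 𝟙 ε) + (s * 5 + 𝟙 ε))) ≡⟨ id₁ missed (s + 𝟙 ε) (s * 5) (𝟙 ε) ⟩
    6 * missed + 6 * ((s + 𝟙 ε) * (s + 𝟙 ε) + (s * 5 + 𝟙 ε * 1)) ≡⟨ cong₂ (λ u v → u + 6 * v) (trans (cong (6 *_) (count-cong λ σ → sym (big-cut-odd³ σ))) (six-odds H)) (sym squares-H) ⟩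
    odds H + 6 * squares H ≡⟨ odds-formula H ⟩
    3 * (n * ends H) + 4 * triangles H ≡⟨ cong₂ (λ u v → 3 * (n * u) + 4 * v) ends-H triangles-H ⟩
    3 * (n * (s + 𝟙 ε + (s * 3 + 𝟙 ε * 1))) + 0 ≡⟨ id₂ n s (𝟙 ε) ⟩
    6 * (n * (2 * s + 𝟙 ε)) ∎)
    where
    open ≡-Reasoning
    id₁ : ∀ m t u v → 6 * (m + (t * t + (u + v))) ≡ 6 * m + 6 * (t * t + (u + v * 1))
    id₁ = solve-∀
    id₂ : ∀ n s e → 3 * (n * (s + e + (s * 3 + e * 1))) + 0 ≡ 6 * (n * (2 * s + e))
    id₂ = solve-∀

-- Minimality of the spider's cut

≢⇒≡ᵇ-false : ∀ {i j} → i ≢ j → (i ≡ᵇ j) ≡ false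
≢⇒≡ᵇ-false {zero} {zero} p = ⊥-elim (p refl)
≢⇒≡ᵇ-false {zero} {suc j} p = refl
≢⇒≡ᵇ-false {suc i} {zero} p = refl
≢⇒≡ᵇ-false {suc i} {suc j} p = ≢⇒≡ᵇ-false (p ∘ cong suc)

≡ᵇ-refl : ∀ i → (i ≡ᵇ i) ≡ true
≡ᵇ-refl zero = refl
≡ᵇ-refl (suc i) = ≡ᵇ-refl i

odd³-repeat : ∀ {n} (G : Graph n) x y z → x ≡ y ⊎ y ≡ z ⊎ x ≡ z → odd³ G x y z ≡ false
odd³-repeat G x y z (inj₁ refl) = odd³-irrefl G x z
odd³-repeat G x y z (inj₂ (inj₁ refl)) = trans (sym (odd³₁₂ G x y y)) (trans (sym (odd³₂₃ G y x y)) (odd³-irrefl G y x))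
odd³-repeat G x y z (inj₂ (inj₂ refl)) = trans (sym (odd³₂₃ G x y x)) (odd³-irrefl G x y)

module _ (s : ℕ) (ε : Bool) (1≤s : 1 ≤ s) where

  private
    n : ℕ
    n = 2 + span s ε

    vertex : Fin n → Vertex
    vertex x = decode (toℕ x)

    H : Graph n
    H = spider-graph s ε

    -- A record so that `w` can be inferred from a proof; the inequality alone only exhibits
    -- `encode w`.
    record In (w : Vertex) : Set where
      constructor inside
      field inside< : encode w ℕ.< n

    point : Vertex → Fin n
    point w with encode w ℕ.<? n
    ... | yes p = fromℕ< p
    ... | no _ = zero

    vertex-point : ∀ w → In w → vertex (point w) ≡ w
    vertex-point w (inside i) with encode w ℕ.<? n
    ... | yes p = trans (cong decode (Finₚ.toℕ-fromℕ< p)) (decode-encode w)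
    ... | no q = ⊥-elim (q i)

    point-vertex : ∀ x → point (vertex x) ≡ x
    point-vertex x with encode (vertex x) ℕ.<? n
    ... | yes p = Finₚ.toℕ-injective (trans (Finₚ.toℕ-fromℕ< p) (encode-decode (toℕ x)))
    ... | no q = ⊥-elim (q (≤-trans (s≤s (≤-reflexive (encode-decode (toℕ x)))) (Finₚ.toℕ<n x)))

    in-vertex : ∀ x → In (vertex x)
    in-vertex x = inside (≤-trans (s≤s (≤-reflexive (encode-decode (toℕ x)))) (Finₚ.toℕ<n x))

    inner outer : ℕ → Vertex
    inner i = leg (false , i)
    outer i = leg (true , i)

    in-isolate : In isolate
    in-isolate = inside (s≤s z≤n)

    in-centre : In centre
    in-centre = inside (s≤s (s≤s z≤n))

    in-inner : ∀ i → In (outer i) → In (inner i)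
    in-inner i (inside p) = inside (≤-trans (s≤s (s≤s (s≤s (≤-trans (n≤1+n _) (≤-reflexive (sym (position-outer i))))))) p)

    in-outer : ∀ {i j} → i ℕ.< j → In (inner j) → In (outer i)
    in-outer {i} i<j (inside p) = inside (≤-trans (s≤s (s≤s (s≤s (≤-trans (≤-reflexive (position-outer i)) (≤-trans (n≤1+n _) (position-next i<j)))))) p)

    in-outer-0 : In (outer 0)
    in-outer-0 = inside (s≤s (s≤s (long 1≤s)))
      where
      long : ∀ {s} → 1 ≤ s → 2 ≤ span s ε
      long {suc s} _ = s≤s (s≤s z≤n)

  -- `U` represents a coboundary inside the cut, normalised so that vertex 0, the isolate of the
  -- spider, is isolated in `U` as well.
  module _ (U : Graph n) (U₀ : ∀ x → adj U zero x ≡ false) (U-even : ∀ x y z → odd³ H x y z ≡ true → odd³ U x y z ≡ false) where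

    private
      u : Vertex → Vertex → Bool
      u w w' = adj U (point w) (point w')

      u-symm : ∀ w w' → u w w' ≡ u w' w
      u-symm w w' = symm U (point w) (point w')

      H-point : ∀ {w w'} → In w → In w' → adj H (point w) (point w') ≡ spider w w'
      H-point {w} {w'} i i' = cong₂ spider (vertex-point w i) (vertex-point w' i')

      -- The isolate and an edge of the spider form a triple that is odd in `H`, hence even in `U`;
      -- by `U₀` its parity is the value of `U` at that edge.
      u-edge : ∀ {w w'} → In w → In w' → spider w w' ≡ true → u w w' ≡ false
      u-edge {w} {w'} i i' e = trans (sym (trans (cong₂ (λ s t → s xor (u w w' xor t)) (U₀ (point w)) (U₀ (point w'))) (Boolₚ.xor-identityʳ _)))
        (U-even zero (point w) (point w') (trans (Boolₚ.xor-identityʳ _) (trans (H-point i i') e)))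

      -- x has no neighbour on the edge a b, so the triple x a b lies outside the cut.
      u-slide : ∀ {x a b} → In x → In a → In b → spider a b ≡ true → spider x a ≡ false → spider x b ≡ false → u x a ≡ u x b
      u-slide {x} {a} {b} ix ia ib ab xa xb = xor-false (trans (cong (λ t → u x a xor (t xor u x b)) (sym (u-edge ia ib ab)))
          (U-even (point x) (point a) (point b) (cong₂ _xor_ (trans (H-point ix ia) xa) (cong₂ _xor_ (trans (H-point ia ib) ab) (trans (H-point ix ib) xb)))))
        where
        xor-false : ∀ {s t} → s xor t ≡ false → s ≡ t
        xor-false {true} {true} _ = refl
        xor-false {false} {false} _ = refl

      t : Bool
      t = u (outer 0) centre

      outer-inner : ∀ {i j} → i ≢ j → In (outer i) → In (inner j) → u (outer i) centre ≡ u (outer i) (inner j)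
      outer-inner i≢j p q = u-slide p in-centre q refl refl (≢⇒≡ᵇ-false (i≢j ∘ sym))

      outer-outer : ∀ {i j} → i ≢ j → In (outer i) → In (outer j) → u (outer i) (inner j) ≡ u (outer i) (outer j)
      outer-outer {i} {j} i≢j p q = u-slide p (in-inner j q) q (≡ᵇ-refl j) (≢⇒≡ᵇ-false (i≢j ∘ sym)) refl

      -- Slide from the centre along leg 0 to `outer 0`, exchange the two ends, and slide back along
      -- leg i to the centre.
      outer-centre : ∀ i → In (outer i) → u (outer i) centre ≡ t
      outer-centre zero p = refl
      outer-centre (suc i) p = trans (outer-inner (λ ()) p (in-inner 0 in-outer-0)) (trans (outer-outer (λ ()) p in-outer-0) (trans (u-symm (outer (suc i)) (outer 0))
        (trans (sym (outer-outer (λ ()) in-outer-0 p)) (sym (outer-inner (λ ()) in-outer-0 (in-inner (suc i) p))))))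

      inner-inner : ∀ {i j} → i ≢ j → In (outer i) → In (inner j) → u (inner i) (inner j) ≡ t
      inner-inner {i} {j} i≢j p q = trans (u-symm (inner i) (inner j)) (trans (sym (u-slide q p (in-inner i p) (≡ᵇ-refl i) (≢⇒≡ᵇ-false (i≢j ∘ sym)) refl))
        (trans (u-symm (inner j) (outer i)) (trans (sym (outer-inner i≢j p q)) (outer-centre i p))))

      -- Slides connect all non-edges of the spider away from the isolate, so the value at one of
      -- them decides the rest.
      non-edge : ∀ w w' → w ≢ w' → w ≢ isolate → w' ≢ isolate → In w → In w' → spider w w' ≡ false → u w w' ≡ t
      non-edge isolate _ _ i _ _ _ _ = ⊥-elim (i refl)
      non-edge centre isolate _ _ i _ _ _ = ⊥-elim (i refl)
      non-edge (leg _) isolate _ _ i _ _ _ = ⊥-elim (i refl)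
      non-edge centre centre w≢ _ _ _ _ _ = ⊥-elim (w≢ refl)
      non-edge centre (leg (true , i)) _ _ _ _ p _ = trans (u-symm centre (outer i)) (outer-centre i p)
      non-edge (leg (true , i)) centre _ _ _ p _ _ = outer-centre i p
      non-edge (leg (true , i)) (leg (true , j)) w≢ _ _ p q _ = trans (sym (outer-outer i≢j p q)) (trans (sym (outer-inner i≢j p (in-inner j q))) (outer-centre i p))
        where
        i≢j : i ≢ j
        i≢j refl = w≢ refl
      non-edge (leg (true , i)) (leg (false , j)) _ _ _ p q e = trans (sym (outer-inner i≢j p q)) (outer-centre i p)
        where
        i≢j : i ≢ j
        i≢j refl = case trans (sym (≡ᵇ-refl i)) e of λ ()
      non-edge (leg (false , i)) (leg (true , j)) _ _ _ p q e = trans (u-symm (inner i) (outer j)) (trans (sym (outer-inner j≢i q p)) (outer-centre j q))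
        where
        j≢i : j ≢ i
        j≢i refl = case trans (sym (≡ᵇ-refl i)) e of λ ()
      -- Only the last leg can lack its outer vertex, so the leg of smaller index has one to slide
      -- through.
      non-edge (leg (false , i)) (leg (false , j)) w≢ _ _ p q _ with <-cmp i j
      ... | tri< i<j i≢j _ = inner-inner i≢j (in-outer i<j q) q
      ... | tri≈ _ refl _ = ⊥-elim (w≢ refl)
      ... | tri> _ i≢j j<i = trans (u-symm (inner i) (inner j)) (inner-inner (i≢j ∘ sym) (in-outer j<i p) p)

      U-adj : ∀ {x y} → x ≢ y → vertex x ≢ isolate → vertex y ≢ isolate → adj U x y ≡ t ∧ not (adj H x y)
      U-adj {x} {y} x≢y ix iy = trans (sym (cong₂ (adj U) (point-vertex x) (point-vertex y))) (by-edge (adj H x y) refl)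
        where
        by-edge : ∀ e → adj H x y ≡ e → u (vertex x) (vertex y) ≡ t ∧ not e
        by-edge true e = trans (u-edge (in-vertex x) (in-vertex y) e) (sym (Boolₚ.∧-zeroʳ t))
        by-edge false e = trans (non-edge (vertex x) (vertex y) (λ q → x≢y (trans (sym (point-vertex x)) (trans (cong point q) (point-vertex y)))) ix iy (in-vertex x) (in-vertex y) e)
          (sym (Boolₚ.∧-identityʳ t))

      proper : ∀ {x y : Fin n} → x Fin.< y → vertex y ≢ isolate
      proper {x} {y} x<y = go (toℕ y) x<y
        where
        go : ∀ k → suc (toℕ x) ≤ k → decode k ≢ isolate
        go (suc zero) _ ()
        go (suc (suc k)) _ ()

    -- Away from the isolate, `U` is empty or the complement of the spider. Hence a coboundary
    -- inside the cut is empty or all of it.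
    U-multiple : ∃ λ t → ∀ σ → odd³ U (a σ) (b σ) (c σ) ≡ t ∧ big-cut s ε σ
    U-multiple = t , on
      where
      apart : ∀ {x y : Fin n} → x Fin.< y → x ≢ y
      apart p refl = Finₚ.<-irrefl refl p
      distrib : ∀ t p q r → (t ∧ p) xor ((t ∧ q) xor (t ∧ r)) ≡ t ∧ (p xor (q xor r))
      distrib true p q r = refl
      distrib false p q r = refl
      first : ∀ t q → (t ∧ q) xor false ≡ t ∧ (true xor (q xor true))
      first true true = refl
      first true false = refl
      first false _ = refl
      on : ∀ σ → odd³ U (a σ) (b σ) (c σ) ≡ t ∧ big-cut s ε σ
      on (triple zero y z p q) = trans (cong₂ (λ v w → v xor (adj U y z xor w)) (U₀ y) (U₀ z))
        (trans (cong (_xor false) (U-adj (apart q) (proper p) (proper q))) (first t (not (adj H y z))))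
      on (triple (suc x) y z p q) = trans (cong₂ _xor_ (U-adj (apart p) (not-isolate x) (proper p)) (cong₂ _xor_ (U-adj (apart q) (proper p) (proper q)) (U-adj (apart (Finₚ.<-trans p q)) (not-isolate x) (proper q))))
        (distrib t (not (adj H (suc x) y)) (not (adj H y z)) (not (adj H (suc x) z)))
        where
        not-isolate : ∀ x → vertex (suc x) ≢ isolate
        not-isolate zero ()
        not-isolate (suc x) ()

  private
    cob-not : ∀ (g : Fin n → Fin n → Bool) σ → cob (λ x y → not (g x y)) σ ≡ not (cob g σ)
    cob-not g σ = lem (g (a σ) (b σ)) (g (b σ) (c σ)) (g (a σ) (c σ))
      where
      lem : ∀ p q r → not p xor (not q xor not r) ≡ not (p xor (q xor r))
      lem false false false = refl
      lem false false true = refl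
      lem false true false = refl
      lem false true true = refl
      lem true false false = refl
      lem true false true = refl
      lem true true false = refl
      lem true true true = refl

  big-cut-hypercut : Hypercut (big-cut s ε)
  big-cut-hypercut = cob-hypercut (λ x y → not (adj H x y)) nonempty minimal
    where
    nonempty : ∃ λ σ → big-cut s ε σ ≡ true
    nonempty with sort {x = point isolate} {point centre} {point (outer 0)} (distinct in-isolate in-centre λ ()) (distinct in-centre in-outer-0 λ ()) (distinct in-isolate in-outer-0 λ ())
      where
      distinct : ∀ {w w'} → In w → In w' → w ≢ w' → point w ≢ point w'
      distinct {w} {w'} i i' w≢ q = w≢ (trans (sym (vertex-point w i)) (trans (cong vertex q) (vertex-point w' i')))
    ... | σ , sorted = σ , trans (cob-not (adj H) σ) (cong not (trans (sorted (odd³ H) (odd³-symmetric H)) (cong₂ _xor_ (H-value in-isolate in-centre) (cong₂ _xor_ (H-value in-centre in-outer-0) (H-value in-isolate in-outer-0)))))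
      where
      H-value : ∀ {w w'} → In w → In w' → adj H (point w) (point w') ≡ spider w w'
      H-value {w} {w'} i i' = cong₂ spider (vertex-point w i) (vertex-point w' i')
    minimal : ∀ g → cob g ⊆ big-cut s ε → (∃ λ σ → cob g σ ≡ true) → big-cut s ε ⊆ cob g
    minimal g sub (τ , e) = conclude (U-multiple U (odd³-irrefl Γ zero) U-even)
      where
      Γ U : Graph n
      -- Two negations leave the symmetrised `g`; its link at 0 isolates that vertex without
      -- changing the coboundary.
      Γ = complement (λ x y → not (g x y))
      U = link Γ zero
      U-cob : ∀ σ → odd³ U (a σ) (b σ) (c σ) ≡ cob g σ
      U-cob σ = trans (link-≈³ Γ zero (a σ) (b σ) (c σ)) (trans (complement-odd³ (λ x y → not (g x y)) σ) (trans (cong not (cob-not g σ)) (Boolₚ.not-involutive _)))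
      U-even : ∀ x y z → odd³ H x y z ≡ true → odd³ U x y z ≡ false
      U-even x y z o with x ≟ y | y ≟ z | x ≟ z
      ... | yes p | _ | _ = odd³-repeat U x y z (inj₁ p)
      ... | _ | yes p | _ = odd³-repeat U x y z (inj₂ (inj₁ p))
      ... | _ | _ | yes p = odd³-repeat U x y z (inj₂ (inj₂ p))
      ... | no p | no q | no r with sort p q r
      ... | σ , sorted = trans (sym (sorted (odd³ U) (odd³-symmetric U))) (trans (U-cob σ) (Boolₚ.¬-not λ e →
          case trans (sym (sub σ e)) (trans (cob-not (adj H) σ) (cong not (trans (sorted (odd³ H) (odd³-symmetric H)) o))) of λ ()))
      conclude : (∃ λ t → ∀ σ → odd³ U (a σ) (b σ) (c σ) ≡ t ∧ big-cut s ε σ) → big-cut s ε ⊆ cob g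
      conclude (true , form) σ h = trans (trans (sym (U-cob σ)) (form σ)) h
      conclude (false , form) _ _ = case trans (sym e) (trans (sym (U-cob τ)) (form τ)) of λ ()

  -- The missed number is B - A with both parts kept nonnegative, so the size of the cut is the
  -- binomial coefficient plus A minus B.
  maximum : ∀ {M p B} A → suc (suc (span s ε)) ≡ order M p → p ≤ 1 → threshold ≤ M →
    missed s ε + deficit M p ≡ n * n + 5 → missed s ε + A ≡ B → IsMaxHypercutSize n ((n C 3) + A ∸ B)
  maximum {M} {p} {B} A n≡ p≤1 large f≡ fA = (big-cut s ε , big-cut-hypercut , attained) , bounded
    where
    size-missed : ∀ (X : TSet n) → size X + count (not ∘ X) ≡ n C 3
    size-missed X = trans (count-not X) (count-triples n)
    attained : size (big-cut s ε) ≡ (n C 3) + A ∸ B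
    attained = sym (trans (cong₂ (λ k l → k + A ∸ l) (sym (size-missed (big-cut s ε))) (sym fA))
      (trans (cong (_∸ (missed s ε + A)) (+-assoc (size (big-cut s ε)) (missed s ε) A)) (m+n∸n≡m (size (big-cut s ε)) (missed s ε + A))))
    bounded : ∀ X → Hypercut X → size X ≤ (n C 3) + A ∸ B
    bounded X hyp = ≤-trans (≤-reflexive (sym (m+n∸n≡m (size X) B))) (∸-monoˡ-≤ B (begin
      size X + B ≡⟨ cong (size X +_) (sym fA) ⟩
      size X + (missed s ε + A) ≤⟨ +-monoʳ-≤ (size X) (+-monoˡ-≤ A (lower-bound _ M p n≡ p≤1 large X hyp (missed s ε) f≡)) ⟩
      size X + (count (not ∘ X) + A) ≡⟨ sym (+-assoc (size X) _ A) ⟩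
      size X + count (not ∘ X) + A ≡⟨ cong (_+ A) (size-missed X) ⟩
      (n C 3) + A ∎))
      where open ≤-Reasoning

-- The two parities of n

span-false : ∀ s → span s false ≡ 2 * s
span-false zero = refl
span-false (suc s) = trans (cong (2 +_) (span-false s)) (id₁ s)
  where
  id₁ : ∀ s → 2 + 2 * s ≡ 2 * suc s
  id₁ = solve-∀

span-true : ∀ s → span s true ≡ 2 * s + 1
span-true zero = refl
span-true (suc s) = trans (cong (2 +_) (span-true s)) (id₁ s)
  where
  id₁ : ∀ s → 2 + (2 * s + 1) ≡ 2 * suc s + 1
  id₁ = solve-∀

-- At n = 2m the subtracted quadratic is 3m² - 7m + 4, and at n = 2m + 1 it is 3m² - 5m + 3; the
-- linear terms are moved next to the binomial coefficient.
theorem3 : ∃ λ (N : ℕ) → ∀ (m : ℕ) → N ≤ m →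
    (IsMaxHypercutSize (2 * m) ((((2 * m) C 3) + 7 * m) ∸ (3 * (m * m) + 4)))
    × (IsMaxHypercutSize (2 * m + 1) ((((2 * m + 1) C 3) + 5 * m) ∸ (3 * (m * m) + 3)))
theorem3 = 2 + threshold , main
  where
  main : ∀ m → 2 + threshold ≤ m →
    (IsMaxHypercutSize (2 * m) ((((2 * m) C 3) + 7 * m) ∸ (3 * (m * m) + 4)))
    × (IsMaxHypercutSize (2 * m + 1) ((((2 * m + 1) C 3) + 5 * m) ∸ (3 * (m * m) + 3)))
  -- With m = s + 1, the even case has s full legs, M = s and p = 1; the odd case has one short leg
  -- more, M = m and p = 0.
  main (suc s) (s≤s large) =
      subst (λ n → IsMaxHypercutSize n (((n C 3) + 7 * suc s) ∸ (3 * (suc s * suc s) + 4))) n-even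
        (maximum s false 1≤s (7 * suc s) (trans n-even (id₁ s)) ≤-refl (≤-trans (n≤1+n _) large) deficit-even total-even)
    , subst (λ n → IsMaxHypercutSize n (((n C 3) + 5 * suc s) ∸ (3 * (suc s * suc s) + 3))) n-odd
        (maximum s true 1≤s (5 * suc s) (trans n-odd (id₂ s)) z≤n (≤-trans (n≤1+n _) (≤-trans large (n≤1+n _))) deficit-odd total-odd)
    where
    1≤s : 1 ≤ s
    1≤s = ≤-trans (s≤s z≤n) large
    id₁ : ∀ s → 2 * suc s ≡ 2 * s + 1 + 1
    id₁ = solve-∀
    id₂ : ∀ s → 2 * suc s + 1 ≡ 2 * suc s + 1 + 0
    id₂ = solve-∀
    n-even : 2 + span s false ≡ 2 * suc s
    n-even = trans (cong (2 +_) (span-false s)) (id₃ s)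
      where
      id₃ : ∀ s → 2 + 2 * s ≡ 2 * suc s
      id₃ = solve-∀
    n-odd : 2 + span s true ≡ 2 * suc s + 1
    n-odd = trans (cong (2 +_) (span-true s)) (id₃ s)
      where
      id₃ : ∀ s → 2 + (2 * s + 1) ≡ 2 * suc s + 1
      id₃ = solve-∀
    balance : ∀ m v w A B → m + w ≡ v → v + A ≡ B + w → m + A ≡ B
    balance m v w A B e q = +-cancelʳ-≡ w _ _ (trans (swap m A w) (trans (cong (_+ A) e) q))
      where
      swap : ∀ m A w → m + A + w ≡ m + w + A
      swap = solve-∀
    total-even : missed s false + 7 * suc s ≡ 3 * (suc s * suc s) + 4
    total-even = balance (missed s false) ((2 + span s false) * (2 * s + 0)) ((s + 0) * (s + 0) + (s * 5 + 0)) _ _ (missed-formula s false) (lem (span-false s))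
      where
      id₄ : ∀ s → (2 + 2 * s) * (2 * s + 0) + 7 * suc s ≡ 3 * (suc s * suc s) + 4 + ((s + 0) * (s + 0) + (s * 5 + 0))
      id₄ = solve-∀
      lem : ∀ {k} → k ≡ 2 * s → (2 + k) * (2 * s + 0) + 7 * suc s ≡ 3 * (suc s * suc s) + 4 + ((s + 0) * (s + 0) + (s * 5 + 0))
      lem refl = id₄ s
    total-odd : missed s true + 5 * suc s ≡ 3 * (suc s * suc s) + 3
    total-odd = balance (missed s true) ((2 + span s true) * (2 * s + 1)) ((s + 1) * (s + 1) + (s * 5 + 1)) _ _ (missed-formula s true) (lem (span-true s))
      where
      id₄ : ∀ s → (2 + (2 * s + 1)) * (2 * s + 1) + 5 * suc s ≡ 3 * (suc s * suc s) + 3 + ((s + 1) * (s + 1) + (s * 5 + 1))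
      id₄ = solve-∀
      lem : ∀ {k} → k ≡ 2 * s + 1 → (2 + k) * (2 * s + 1) + 5 * suc s ≡ 3 * (suc s * suc s) + 3 + ((s + 1) * (s + 1) + (s * 5 + 1))
      lem refl = id₄ s
    deficit-even : missed s false + deficit s 1 ≡ (2 + span s false) * (2 + span s false) + 5
    deficit-even = balance (missed s false) ((2 + span s false) * (2 * s + 0)) ((s + 0) * (s + 0) + (s * 5 + 0)) _ _ (missed-formula s false) (lem (span-false s))
      where
      id₄ : ∀ s → (2 + 2 * s) * (2 * s + 0) + (s * s + 3 * s + 3 * 1 + 3 * (2 * s + 1 + 1)) ≡ (2 + 2 * s) * (2 + 2 * s) + 5 + ((s + 0) * (s + 0) + (s * 5 + 0))
      id₄ = solve-∀
      lem : ∀ {k} → k ≡ 2 * s → (2 + k) * (2 * s + 0) + deficit s 1 ≡ (2 + k) * (2 + k) + 5 + ((s + 0) * (s + 0) + (s * 5 + 0))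
      lem refl = id₄ s
    deficit-odd : missed s true + deficit (suc s) 0 ≡ (2 + span s true) * (2 + span s true) + 5
    deficit-odd = balance (missed s true) ((2 + span s true) * (2 * s + 1)) ((s + 1) * (s + 1) + (s * 5 + 1)) _ _ (missed-formula s true) (lem (span-true s))
      where
      id₄ : ∀ s → (2 + (2 * s + 1)) * (2 * s + 1) + (suc s * suc s + 3 * suc s + 3 * 0 + 3 * (2 * suc s + 1 + 0)) ≡ (2 + (2 * s + 1)) * (2 + (2 * s + 1)) + 5 + ((s + 1) * (s + 1) + (s * 5 + 1))
      id₄ = solve-∀
      lem : ∀ {k} → k ≡ 2 * s + 1 → (2 + k) * (2 * s + 1) + deficit (suc s) 0 ≡ (2 + k) * (2 + k) + 5 + ((s + 1) * (s + 1) + (s * 5 + 1))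
      lem refl = id₄ s
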